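{- For every surface $S$, every integer $t\ge 0$ and every $\epsilon>0$, there exists a constant $c=c(S,t,\epsilon)$ such that every $n$-vertex triangulation on $S$ that has at most $t$ vertices of degree other than $6$ has a dominating set of size at most $n\left(\frac{1}{6}+\epsilon\right)+c$.
   Context: All graphs are finite and simple. A surface is a compact connected $2$-manifold without boundary (orientable $S_g$ or non-orientable $N_g$). A triangulation on a surface $S$ is a simple graph embedded on $S$ such that every face is bounded by a triangle. A dominating set of a graph $G$ is a set $D\subseteq V(G)$ such that every vertex of $G$ is in $D$ or adjacent to a vertex of $D$. -}

module Defs where

open import Data.Nat using (ℕ; _≤_)
open import Data.Bool using (Bool; not)
open import Data.Fin using (Fin)
open import Data.Fin.Properties using (any?; _≟_)
open import Data.Fin.Subset using (Subset; _∈_; _∉_; ∣_∣)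
open import Data.Vec using (tabulate)
open import Data.List using (List; _∷_; [])
open import Data.List.Membership.Propositional renaming (_∈_ to _∈ₗ_)
open import Data.Product using (Σ; ∃; _×_; _,_)
open import Data.Unit using (⊤)
open import Data.Empty using (⊥)
open import Data.Sum using (_⊎_)
open import Data.Integer as ℤ using (ℤ; +_; _-_)
open import Relation.Nullary using (¬_; Dec; yes; no)
open import Relation.Nullary.Decidable using (isYes; _×-dec_)
open import Relation.Binary.PropositionalEquality using (_≡_; _≢_)
open import Function using (_⇔_)

-- Surfaces (up to homeomorphism): S_g (orientable, genus g ≥ 0) and
-- N_g (non-orientable, genus g ≥ 1).

data Surface : Set where
  S : (g : ℕ) → Surface
  N : (g : ℕ) → 1 ≤ g → Surface

euler : Surface → ℤ
euler (S g)   = + 2 - (+ 2 ℤ.* + g)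
euler (N g _) = + 2 - + g

isOrientable : Surface → Set
isOrientable (S _)   = ⊤
isOrientable (N _ _) = ⊥

data Orb {m : ℕ} (gs : List (Fin m → Fin m)) (x : Fin m) : Fin m → Set where
  here : Orb gs x x
  step : ∀ {y} (g : Fin m → Fin m) → g ∈ₗ gs → Orb gs x y → Orb gs x (g y)

-- Combinatorial maps (flag / generalized-map representation of a
-- cellular embedding of a connected graph in a closed surface).
-- Flags are Fin nf; α₀, α₁, α₂ are the three fixed-point-free
-- involutions, α₀α₂ is a fixed-point-free involution, and the
-- monodromy group acts transitively. Vertices (resp. edges, faces)
-- are the orbits of ⟨α₁,α₂⟩ (resp. ⟨α₀,α₂⟩, ⟨α₀,α₁⟩); they are given
-- by labellings vtx, edg, fac whose fibres are exactly these orbits,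
-- so there are exactly n vertices, ne edges and nfc faces.

record Map (n : ℕ) : Set where
  field
    nf ne nfc : ℕ
    α₀ α₁ α₂  : Fin nf → Fin nf
    inv₀ : ∀ x → α₀ (α₀ x) ≡ x
    inv₁ : ∀ x → α₁ (α₁ x) ≡ x
    inv₂ : ∀ x → α₂ (α₂ x) ≡ x
    fpf₀ : ∀ x → α₀ x ≢ x
    fpf₁ : ∀ x → α₁ x ≢ x
    fpf₂ : ∀ x → α₂ x ≢ x
    comm₀₂ : ∀ x → α₀ (α₂ x) ≡ α₂ (α₀ x)
    fpf₀₂  : ∀ x → α₀ (α₂ x) ≢ x
    connected : ∀ x y → Orb (α₀ ∷ α₁ ∷ α₂ ∷ []) x y
    vtx : Fin nf → Fin n
    edg : Fin nf → Fin ne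
    fac : Fin nf → Fin nfc
    vtx-orb : ∀ x y → (vtx x ≡ vtx y) ⇔ Orb (α₁ ∷ α₂ ∷ []) x y
    edg-orb : ∀ x y → (edg x ≡ edg y) ⇔ Orb (α₀ ∷ α₂ ∷ []) x y
    fac-orb : ∀ x y → (fac x ≡ fac y) ⇔ Orb (α₀ ∷ α₁ ∷ []) x y
    vtx-onto : ∀ v → ∃ λ x → vtx x ≡ v
    edg-onto : ∀ e → ∃ λ x → edg x ≡ e
    fac-onto : ∀ f → ∃ λ x → fac x ≡ f

  χ : ℤ
  χ = (+ n - + ne) ℤ.+ + nfc

  -- orientable iff the flag graph is bipartite
  Orientable : Set
  Orientable = Σ (Fin nf → Bool) λ c →
    (∀ x → c (α₀ x) ≡ not (c x)) × (∀ x → c (α₁ x) ≡ not (c x))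
      × (∀ x → c (α₂ x) ≡ not (c x))

  Adj : Fin n → Fin n → Set
  Adj u v = ∃ λ x → vtx x ≡ u × vtx (α₀ x) ≡ v

  adj? : ∀ u v → Dec (Adj u v)
  adj? u v = any? (λ x → (vtx x ≟ u) ×-dec (vtx (α₀ x) ≟ v))

  neighbours : Fin n → Subset n
  neighbours v = tabulate (λ w → isYes (adj? v w))

  degree : Fin n → ℕ
  degree v = ∣ neighbours v ∣

  Simple : Set
  Simple = (∀ x → vtx x ≢ vtx (α₀ x))
         × (∀ x y → vtx x ≡ vtx y → vtx (α₀ x) ≡ vtx (α₀ y) → edg x ≡ edg y)

  -- every face is bounded by a closed walk of length exactly 3
  Triangular : Set
  Triangular = ∀ x → (α₀ (α₁ (α₀ (α₁ (α₀ (α₁ x)))))) ≡ x × α₀ (α₁ x) ≢ x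

  Dominating : Subset n → Set
  Dominating D = ∀ v → v ∈ D ⊎ ∃ λ u → u ∈ D × Adj u v

record Triangulation (Σs : Surface) (n : ℕ) : Set where
  field
    map        : Map n
  open Map map public
  field
    simple     : Simple
    triangular : Triangular
    euler-eq   : χ ≡ euler Σs
    orient-eq  : Orientable ⇔ isOrientable Σs

{-# OPTIONS --safe #-}

-- Let D be a minimum dominating set. If a set A of vertices is given and S dominates the closed
-- neighbourhood of A, then replacing D ∩ A by S shows |D ∩ A| ≤ |S|. So it suffices to average
-- |D ∩ A| over translates of a patch A whose neighbourhood has a dominating set of size close to |A|/6.
--
-- Write a, b, c for the three flag involutions. Away from the vertices of degree ≠ 6, the word
-- T = bcbcba moves a flag straight ahead, T and bTb commute, and a flag x spans a map ℤ² → flags,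
-- p ↦ x · p, which is locally the triangular lattice. Since x ↦ x · p is a bijection of all flags,
-- averaging over x costs only the boundedly many flags close to a vertex of degree ≠ 6
-- (their number is controlled by Euler's formula).
--
-- If x has no period p (x · p = x) in a fixed square, the patch is a 52 × 52 square, dominated by the
-- perfect code of density 1/7. Otherwise the shortest period τ makes the neighbourhood of x a tube ℤ²/τ;
-- the patch is a long segment of it, and every tube admitted by a simple graph has a periodic
-- dominating set of density at most 1/6: a code with a seam for wide tubes, a finite table for narrow ones.
--
-- The patch may fail to embed. Two independent periods bound the size of the whole triangulation.
-- The other possibility is that the patch meets a rotated or reflected copy of itself; two such
-- coincidences at different places along a line again give independent periods (or a flag fixed by a
-- reflection), so they are sparse.
module Submission where

open import Defs hiding (S; N)
open import Algebra.Bundles using (Group)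
open import Data.Bool.Base using (Bool; true; false; _∧_; _∨_; not; if_then_else_; T)
import Data.Bool.Properties as Boolₚ
open import Data.Empty using (⊥; ⊥-elim)
open import Data.Fin.Base as Fin using (Fin; zero; suc; toℕ; fromℕ<; combine; remQuot)
open import Data.Fin.Patterns
import Data.Fin.Permutation as Perm
import Data.Fin.Properties as Finₚ
open import Data.Fin.Subset using (Subset; _∉_; ∣_∣; ⊤)
import Data.Fin.Subset.Properties as Subsetₚ
open import Data.Integer using (+_)
open import Data.Integer.Base as ℤ using (ℤ; -[1+_])
import Data.Integer.DivMod as ℤDM
import Data.Integer.Properties as ℤₚ
open import Data.Integer.Tactic.RingSolver using (solve-∀)
open import Data.List.Base using (List; []; _∷_; _++_; map; concatMap; upTo; allFin; length; filter; cartesianProduct; cartesianProductWith)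
open import Data.List.Membership.Propositional using (_∈_; lose)
open import Data.List.Membership.Propositional.Properties using (∈-concatMap⁺; ∈-cartesianProductWith⁺; ∈-cartesianProduct⁺; ∈-upTo⁺; ∈-filter⁺; ∈-map⁺)
import Data.List.Properties as List
open import Data.List.Relation.Unary.Any using (here; there)
open import Data.Maybe.Base as Maybe using (Maybe; just; nothing)
open import Data.Nat using (ℕ; _≤_)
open import Data.Nat.Base as ℕ using (zero; suc; _<_; _⊔_; _∸_; _<ᵇ_; _≡ᵇ_; _≤ᵇ_; _%_; z≤n; s≤s)
open import Data.Nat.Coprimality using (Coprime)
import Data.Nat.Properties as ℕₚ
open import Data.Nat.Tactic.RingSolver using () renaming (solve-∀ to solve-∀ℕ)
open import Data.Product using (Σ; ∃; ∃₂; _×_; _,_; proj₁; proj₂)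
open import Data.Sum.Base using (_⊎_; inj₁; inj₂)
open import Data.Unit.Base using (tt)
open import Data.Vec.Base using ([]; _∷_; tabulate; lookup)
import Data.Vec.Properties as Vecₚ
open import Function.Base using (_∘_)
open import Function.Bundles using (Equivalence)
open import Level using (0ℓ)
open import Relation.Binary.Definitions using (tri<; tri≈; tri>)
open import Relation.Binary.PropositionalEquality using (_≡_; _≢_; refl; sym; trans; cong; cong₂; subst; module ≡-Reasoning)
open import Relation.Nullary using (¬_; Dec; yes; no)
open import Relation.Nullary.Decidable using (isYes; _⊎-dec_; _×-dec_)

open import Algebra.Properties.CommutativeMonoid.Sum ℕₚ.+-0-commutativeMonoid using (sum; ∑-comm; ∑-distrib-+; sum-permute; sum-cong-≗)

-- The constant may depend on the surface, `t` and `ε` only. Hence every local statement carries a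
-- depth that is the same for all systems (`◇`), and only finitely many of them can be used at once;
-- this forces patches of bounded size and periods from a bounded list. Tubes are the obstacle to
-- density 1/7: going round a tube, the perfect code need not match itself, and the seam costs two
-- cells in every seven columns. At height `j` this gives density (j+2)/(7j), which is at most 1/6
-- exactly for `j` ≥ 12; smaller heights need the table. A square with a margin of 2 on every side
-- can use the code once its side is about 50; the side 52 makes the enlarged side 56 a multiple of
-- 7. Differences inside this square have coordinates up to 51, so periods up to 51 have to be
-- treated as tubes. Turned coincidences cannot simply be excluded, since a glide reflection does
-- occur along the core of a Möbius band. Rarity is enough: a patch with a coincidence is charged
-- with all its cells.

-- Integer powers in a group, and two translations with two reflections

module GroupPowers {c ℓ} (G : Group c ℓ) where
  open Group G renaming (refl to ≈-refl; sym to ≈-sym; trans to ≈-trans)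
  open import Algebra.Properties.Group G using (⁻¹-involutive; \\-leftDividesʳ; \\-leftDividesˡ; ⁻¹-anti-homo-∙)
  open import Relation.Binary.Reasoning.Setoid setoid

  powℕ : Carrier → ℕ → Carrier
  powℕ x zero    = ε
  powℕ x (suc n) = x ∙ powℕ x n

  pow : Carrier → ℤ → Carrier
  pow x (+ n)    = powℕ x n
  pow x -[1+ n ] = powℕ (x ⁻¹) (suc n)

  Commute : Carrier → Carrier → Set ℓ
  Commute x y = x ∙ y ≈ y ∙ x

  intertwine-⁻¹ : ∀ {g x y} → g ∙ x ≈ y ∙ g → g ∙ x ⁻¹ ≈ y ⁻¹ ∙ g
  intertwine-⁻¹ {g} {x} {y} p = begin
    g ∙ x ⁻¹ ≈⟨ \\-leftDividesʳ y (g ∙ x ⁻¹) ⟨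
    y ⁻¹ ∙ (y ∙ (g ∙ x ⁻¹)) ≈⟨ ∙-congˡ (assoc y g (x ⁻¹)) ⟨
    y ⁻¹ ∙ ((y ∙ g) ∙ x ⁻¹) ≈⟨ ∙-congˡ (∙-congʳ p) ⟨
    y ⁻¹ ∙ ((g ∙ x) ∙ x ⁻¹) ≈⟨ ∙-congˡ (assoc g x (x ⁻¹)) ⟩
    y ⁻¹ ∙ (g ∙ (x ∙ x ⁻¹)) ≈⟨ ∙-congˡ (∙-congˡ (inverseʳ x)) ⟩
    y ⁻¹ ∙ (g ∙ ε) ≈⟨ ∙-congˡ (identityʳ g) ⟩
    y ⁻¹ ∙ g ∎

  intertwine-powℕ : ∀ {g x y} → g ∙ x ≈ y ∙ g → ∀ n → g ∙ powℕ x n ≈ powℕ y n ∙ g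
  intertwine-powℕ {g} p zero = ≈-trans (identityʳ g) (≈-sym (identityˡ g))
  intertwine-powℕ {g} {x} {y} p (suc n) = begin
    g ∙ (x ∙ powℕ x n) ≈⟨ assoc g x _ ⟨
    (g ∙ x) ∙ powℕ x n ≈⟨ ∙-congʳ p ⟩
    (y ∙ g) ∙ powℕ x n ≈⟨ assoc y g _ ⟩
    y ∙ (g ∙ powℕ x n) ≈⟨ ∙-congˡ (intertwine-powℕ p n) ⟩
    y ∙ (powℕ y n ∙ g) ≈⟨ assoc y _ g ⟨
    (y ∙ powℕ y n) ∙ g ∎

  intertwine-pow : ∀ {g x y} → g ∙ x ≈ y ∙ g → ∀ i → g ∙ pow x i ≈ pow y i ∙ g
  intertwine-pow p (+ n)    = intertwine-powℕ p n
  intertwine-pow p -[1+ n ] = intertwine-powℕ (intertwine-⁻¹ p) (suc n)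

  pow-suc : ∀ x i → pow x (ℤ.suc i) ≈ x ∙ pow x i
  pow-suc x (+ n)          = ≈-refl
  pow-suc x -[1+ zero ]    = ≈-sym (\\-leftDividesˡ x ε)
  pow-suc x -[1+ suc n ]   = ≈-sym (\\-leftDividesˡ x _)

  pow-pred : ∀ x i → pow x (ℤ.pred i) ≈ x ⁻¹ ∙ pow x i
  pow-pred x (+ zero)  = ≈-refl
  pow-pred x (+ suc n) = ≈-sym (\\-leftDividesʳ x _)
  pow-pred x -[1+ n ]  = ≈-refl

  pow-+ : ∀ x i j → pow x (i ℤ.+ j) ≈ pow x i ∙ pow x j
  pow-+ x (+ zero) j = ≈-trans (reflexive (cong (pow x) (ℤₚ.+-identityˡ j))) (≈-sym (identityˡ _))
  pow-+ x (+ suc n) j = begin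
    pow x (+ suc n ℤ.+ j) ≡⟨ cong (pow x) (ℤₚ.suc-+ n j) ⟩
    pow x (ℤ.suc (+ n ℤ.+ j)) ≈⟨ pow-suc x (+ n ℤ.+ j) ⟩
    x ∙ pow x (+ n ℤ.+ j) ≈⟨ ∙-congˡ (pow-+ x (+ n) j) ⟩
    x ∙ (pow x (+ n) ∙ pow x j) ≈⟨ assoc x _ _ ⟨
    pow x (+ suc n) ∙ pow x j ∎
  pow-+ x -[1+ zero ] j = begin
    pow x (ℤ.pred j) ≈⟨ pow-pred x j ⟩
    x ⁻¹ ∙ pow x j ≈⟨ ∙-congʳ (identityʳ _) ⟨
    x ⁻¹ ∙ ε ∙ pow x j ∎
  pow-+ x -[1+ suc n ] j = begin
    pow x (-[1+ suc n ] ℤ.+ j) ≡⟨ cong (pow x) (ℤₚ.+-assoc (ℤ.-1ℤ) -[1+ n ] j) ⟩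
    pow x (ℤ.pred (-[1+ n ] ℤ.+ j)) ≈⟨ pow-pred x (-[1+ n ] ℤ.+ j) ⟩
    x ⁻¹ ∙ pow x (-[1+ n ] ℤ.+ j) ≈⟨ ∙-congˡ (pow-+ x -[1+ n ] j) ⟩
    x ⁻¹ ∙ (pow x -[1+ n ] ∙ pow x j) ≈⟨ assoc _ _ _ ⟨
    pow x -[1+ suc n ] ∙ pow x j ∎

  pow-commute : ∀ {x y} → Commute x y → ∀ i j → Commute (pow x i) (pow y j)
  pow-commute p i j = ≈-sym (intertwine-pow (≈-sym (intertwine-pow p j)) i)

  interchange : ∀ {p q r s} → Commute q r → (p ∙ q) ∙ (r ∙ s) ≈ (p ∙ r) ∙ (q ∙ s)
  interchange {p} {q} {r} {s} e = begin
    (p ∙ q) ∙ (r ∙ s) ≈⟨ assoc p q (r ∙ s) ⟩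
    p ∙ (q ∙ (r ∙ s)) ≈⟨ ∙-congˡ (assoc q r s) ⟨
    p ∙ ((q ∙ r) ∙ s) ≈⟨ ∙-congˡ (∙-congʳ e) ⟩
    p ∙ ((r ∙ q) ∙ s) ≈⟨ ∙-congˡ (assoc r q s) ⟩
    p ∙ (r ∙ (q ∙ s)) ≈⟨ assoc p r (q ∙ s) ⟨
    (p ∙ r) ∙ (q ∙ s) ∎

  powℕ-∙ : ∀ {x y} → Commute x y → ∀ n → powℕ (x ∙ y) n ≈ powℕ x n ∙ powℕ y n
  powℕ-∙ e zero    = ≈-sym (identityˡ ε)
  powℕ-∙ e (suc n) = ≈-trans (∙-congˡ (powℕ-∙ e n)) (interchange (intertwine-powℕ (≈-sym e) n))

  powℕ-cong : ∀ {x y} → x ≈ y → ∀ n → powℕ x n ≈ powℕ y n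
  powℕ-cong e zero    = ≈-refl
  powℕ-cong e (suc n) = ∙-cong e (powℕ-cong e n)

  pow-⁻¹ : ∀ x i → pow (x ⁻¹) i ≈ pow x (ℤ.- i)
  pow-⁻¹ x (+ zero)  = ≈-refl
  pow-⁻¹ x (+ suc n) = ≈-refl
  pow-⁻¹ x -[1+ n ]  = powℕ-cong (⁻¹-involutive x) (suc n)

  pow-∙ : ∀ {x y} → Commute x y → ∀ i → pow (x ∙ y) i ≈ pow x i ∙ pow y i
  pow-∙ e (+ n) = powℕ-∙ e n
  pow-∙ {x} {y} e -[1+ n ] =
    ≈-trans (powℕ-cong (≈-trans (⁻¹-anti-homo-∙ x y) comm′) (suc n)) (powℕ-∙ (≈-sym comm′) (suc n))
    where
    comm′ : Commute (y ⁻¹) (x ⁻¹)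
    comm′ = intertwine-⁻¹ (≈-sym (intertwine-⁻¹ e))

  module Translations
    {t₁ t₂ r₁ r₂ : Carrier}
    (r₂r₂ : r₂ ∙ r₂ ≈ ε) (r₂t₁ : r₂ ∙ t₁ ≈ t₁ ∙ r₂) (r₂t₂r₂t₂ : (r₂ ∙ t₂) ∙ (r₂ ∙ t₂) ≈ t₁)
    (r₁t₁ : r₁ ∙ t₁ ≈ t₂ ∙ r₁) (r₁t₂ : r₁ ∙ t₂ ≈ t₁ ∙ r₁) where

    t₂r₂t₂r₂ : (t₂ ∙ r₂) ∙ (t₂ ∙ r₂) ≈ t₁
    t₂r₂t₂r₂ = begin
      (t₂ ∙ r₂) ∙ (t₂ ∙ r₂) ≈⟨ identityˡ _ ⟨
      ε ∙ ((t₂ ∙ r₂) ∙ (t₂ ∙ r₂)) ≈⟨ ∙-congʳ r₂r₂ ⟨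
      (r₂ ∙ r₂) ∙ ((t₂ ∙ r₂) ∙ (t₂ ∙ r₂)) ≈⟨ assoc r₂ r₂ _ ⟩
      r₂ ∙ (r₂ ∙ ((t₂ ∙ r₂) ∙ (t₂ ∙ r₂))) ≈⟨ ∙-congˡ (∙-congˡ (assoc (t₂ ∙ r₂) t₂ r₂)) ⟨
      r₂ ∙ (r₂ ∙ (((t₂ ∙ r₂) ∙ t₂) ∙ r₂)) ≈⟨ ∙-congˡ (assoc r₂ _ r₂) ⟨
      r₂ ∙ ((r₂ ∙ ((t₂ ∙ r₂) ∙ t₂)) ∙ r₂) ≈⟨ ∙-congˡ (∙-congʳ (∙-congˡ (assoc t₂ r₂ t₂))) ⟩
      r₂ ∙ ((r₂ ∙ (t₂ ∙ (r₂ ∙ t₂))) ∙ r₂) ≈⟨ ∙-congˡ (∙-congʳ (assoc r₂ t₂ _)) ⟨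
      r₂ ∙ (((r₂ ∙ t₂) ∙ (r₂ ∙ t₂)) ∙ r₂) ≈⟨ ∙-congˡ (∙-congʳ r₂t₂r₂t₂) ⟩
      r₂ ∙ (t₁ ∙ r₂) ≈⟨ ∙-congˡ r₂t₁ ⟨
      r₂ ∙ (r₂ ∙ t₁) ≈⟨ assoc r₂ r₂ t₁ ⟨
      (r₂ ∙ r₂) ∙ t₁ ≈⟨ ∙-congʳ r₂r₂ ⟩
      ε ∙ t₁ ≈⟨ identityˡ t₁ ⟩
      t₁ ∎

    -- Both `(r₂ t₂)²` and `(t₂ r₂)²` equal `t₁`, and `t₂ (r₂ t₂)² = (t₂ r₂)² t₂` by reassociation
    -- alone.
    t₁t₂ : Commute t₁ t₂
    t₁t₂ = begin
      t₁ ∙ t₂ ≈⟨ ∙-congʳ t₂r₂t₂r₂ ⟨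
      ((t₂ ∙ r₂) ∙ (t₂ ∙ r₂)) ∙ t₂ ≈⟨ assoc _ _ t₂ ⟩
      (t₂ ∙ r₂) ∙ ((t₂ ∙ r₂) ∙ t₂) ≈⟨ assoc t₂ r₂ _ ⟩
      t₂ ∙ (r₂ ∙ ((t₂ ∙ r₂) ∙ t₂)) ≈⟨ ∙-congˡ (∙-congˡ (assoc t₂ r₂ t₂)) ⟩
      t₂ ∙ (r₂ ∙ (t₂ ∙ (r₂ ∙ t₂))) ≈⟨ ∙-congˡ (assoc r₂ t₂ _) ⟨
      t₂ ∙ ((r₂ ∙ t₂) ∙ (r₂ ∙ t₂)) ≈⟨ ∙-congˡ r₂t₂r₂t₂ ⟩
      t₂ ∙ t₁ ∎

    r₂t₂ : r₂ ∙ t₂ ≈ (t₁ ∙ t₂ ⁻¹) ∙ r₂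
    r₂t₂ = begin
      r₂ ∙ t₂ ≈⟨ identityʳ _ ⟨
      (r₂ ∙ t₂) ∙ ε ≈⟨ ∙-congˡ r₂r₂ ⟨
      (r₂ ∙ t₂) ∙ (r₂ ∙ r₂) ≈⟨ assoc _ r₂ r₂ ⟨
      ((r₂ ∙ t₂) ∙ r₂) ∙ r₂ ≈⟨ ∙-congʳ (identityʳ _) ⟨
      (((r₂ ∙ t₂) ∙ r₂) ∙ ε) ∙ r₂ ≈⟨ ∙-congʳ (∙-congˡ (inverseʳ t₂)) ⟨
      (((r₂ ∙ t₂) ∙ r₂) ∙ (t₂ ∙ t₂ ⁻¹)) ∙ r₂ ≈⟨ ∙-congʳ (assoc _ t₂ (t₂ ⁻¹)) ⟨
      ((((r₂ ∙ t₂) ∙ r₂) ∙ t₂) ∙ t₂ ⁻¹) ∙ r₂ ≈⟨ ∙-congʳ (∙-congʳ (assoc _ r₂ t₂)) ⟩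
      (((r₂ ∙ t₂) ∙ (r₂ ∙ t₂)) ∙ t₂ ⁻¹) ∙ r₂ ≈⟨ ∙-congʳ (∙-congʳ r₂t₂r₂t₂) ⟩
      (t₁ ∙ t₂ ⁻¹) ∙ r₂ ∎

    translate : ℤ → ℤ → Carrier
    translate i j = pow t₁ i ∙ pow t₂ j

    translate-+ : ∀ i j k l → translate (i ℤ.+ k) (j ℤ.+ l) ≈ translate i j ∙ translate k l
    translate-+ i j k l = ≈-trans (∙-cong (pow-+ t₁ i k) (pow-+ t₂ j l)) (interchange (pow-commute t₁t₂ k j))

    reflect₁ : ∀ i j → r₁ ∙ translate i j ≈ translate j i ∙ r₁
    reflect₁ i j = begin
      r₁ ∙ (pow t₁ i ∙ pow t₂ j) ≈⟨ assoc r₁ _ _ ⟨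
      (r₁ ∙ pow t₁ i) ∙ pow t₂ j ≈⟨ ∙-congʳ (intertwine-pow r₁t₁ i) ⟩
      (pow t₂ i ∙ r₁) ∙ pow t₂ j ≈⟨ assoc _ r₁ _ ⟩
      pow t₂ i ∙ (r₁ ∙ pow t₂ j) ≈⟨ ∙-congˡ (intertwine-pow r₁t₂ j) ⟩
      pow t₂ i ∙ (pow t₁ j ∙ r₁) ≈⟨ assoc _ _ r₁ ⟨
      (pow t₂ i ∙ pow t₁ j) ∙ r₁ ≈⟨ ∙-congʳ (pow-commute t₁t₂ j i) ⟨
      (pow t₁ j ∙ pow t₂ i) ∙ r₁ ∎

    reflect₂ : ∀ i j → r₂ ∙ translate i j ≈ translate (i ℤ.+ j) (ℤ.- j) ∙ r₂
    reflect₂ i j = begin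
      r₂ ∙ (pow t₁ i ∙ pow t₂ j) ≈⟨ assoc r₂ _ _ ⟨
      (r₂ ∙ pow t₁ i) ∙ pow t₂ j ≈⟨ ∙-congʳ (intertwine-pow r₂t₁ i) ⟩
      (pow t₁ i ∙ r₂) ∙ pow t₂ j ≈⟨ assoc _ r₂ _ ⟩
      pow t₁ i ∙ (r₂ ∙ pow t₂ j) ≈⟨ ∙-congˡ (intertwine-pow r₂t₂ j) ⟩
      pow t₁ i ∙ (pow (t₁ ∙ t₂ ⁻¹) j ∙ r₂) ≈⟨ ∙-congˡ (∙-congʳ (pow-∙ (intertwine-⁻¹ t₁t₂) j)) ⟩
      pow t₁ i ∙ ((pow t₁ j ∙ pow (t₂ ⁻¹) j) ∙ r₂) ≈⟨ ∙-congˡ (∙-congʳ (∙-congˡ (pow-⁻¹ t₂ j))) ⟩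
      pow t₁ i ∙ ((pow t₁ j ∙ pow t₂ (ℤ.- j)) ∙ r₂) ≈⟨ assoc _ _ r₂ ⟨
      (pow t₁ i ∙ (pow t₁ j ∙ pow t₂ (ℤ.- j))) ∙ r₂ ≈⟨ ∙-congʳ (assoc _ _ _) ⟨
      ((pow t₁ i ∙ pow t₁ j) ∙ pow t₂ (ℤ.- j)) ∙ r₂ ≈⟨ ∙-congʳ (∙-congʳ (pow-+ t₁ i j)) ⟨
      (pow t₁ (i ℤ.+ j) ∙ pow t₂ (ℤ.- j)) ∙ r₂ ∎

-- Words acting on flags, and statements valid at uniform depth

data Gen : Set where
  g₀ g₁ g₂ : Gen

Word : Set
Word = List Gen

letter : ℕ → Gen
letter 0             = g₁
letter 1             = g₂
letter (suc (suc k)) = letter k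

-- The alternating word … g₁ g₂ g₁ of length k: it moves a flag k sectors around its vertex.
alt : ℕ → Word
alt zero    = []
alt (suc k) = letter k ∷ alt k

record Flags : Set where
  field
    nf       : ℕ
    α₀ α₁ α₂ : Fin nf → Fin nf

  act : Gen → Fin nf → Fin nf
  act g₀ = α₀
  act g₁ = α₁
  act g₂ = α₂

  run : Word → Fin nf → Fin nf
  run []      x = x
  run (g ∷ w) x = act g (run w x)

  run-++ : ∀ u w x → run (u ++ w) x ≡ run u (run w x)
  run-++ []      w x = refl
  run-++ (g ∷ u) w x = cong (act g) (run-++ u w x)

-- The relations between the involutions are global. Sixfold rotation, its freeness and the
-- distinctness of the neighbours are granted at `good` vertices only, where degree 6 and simplicity
-- will provide them.
record System : Set where
  field
    flags : Flags
  open Flags flags public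
  field
    nv         : ℕ
    inv        : ∀ g x → act g (act g x) ≡ x
    comm₀₂     : ∀ x → α₀ (α₂ x) ≡ α₂ (α₀ x)
    triangle   : ∀ x → α₀ (α₁ (α₀ (α₁ (α₀ (α₁ x))))) ≡ x
    connected  : ∀ x y → Orb (α₀ ∷ α₁ ∷ α₂ ∷ []) x y
    vtx        : Fin nf → Fin nv
    vtx₁       : ∀ x → vtx (α₁ x) ≡ vtx x
    vtx₂       : ∀ x → vtx (α₂ x) ≡ vtx x
    good       : Fin nv → Bool
    good-cycle : ∀ x → good (vtx x) ≡ true → run (alt 12) x ≡ x
    good-free  : ∀ x → good (vtx x) ≡ true → ∀ k → 0 < k → k < 12 → run (alt k) x ≢ x
    good-orbit : ∀ x → good (vtx x) ≡ true → ∀ z → vtx z ≡ vtx x →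
                 ∃ λ k → k < 12 × z ≡ run (alt k) x
    good-nbrs  : ∀ x → good (vtx x) ≡ true → ∀ k l → k < 6 → l < 6 →
                 vtx (α₀ (run (alt (k ℕ.+ k)) x)) ≡ vtx (α₀ (run (alt (l ℕ.+ l)) x)) → k ≡ l

  Flag : Set
  Flag = Fin nf

  -- The ball of radius `k` around the flag, in the graph of the three involutions, lies over good
  -- vertices. The value is Boolean so that such flags can be counted.
  deep : ℕ → Flag → Bool
  deep zero    x = good (vtx x)
  deep (suc k) x = deep k x ∧ (deep k (α₀ x) ∧ (deep k (α₁ x) ∧ deep k (α₂ x)))

  Deep : ℕ → Flag → Set
  Deep k x = deep k x ≡ true

  Adj : Fin nv → Fin nv → Set
  Adj u v = ∃ λ x → vtx x ≡ u × vtx (α₀ x) ≡ v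

  deep-pred : ∀ k x → Deep (suc k) x → Deep k x
  deep-pred k x d with deep k x
  ... | true = refl

  deep-act : ∀ k g x → Deep (suc k) x → Deep k (act g x)
  deep-act k g x d with deep k x | deep k (α₀ x) in e₀ | deep k (α₁ x) in e₁ | deep k (α₂ x) in e₂
  deep-act k g₀ x d | true | true | true | true = e₀
  deep-act k g₁ x d | true | true | true | true = e₁
  deep-act k g₂ x d | true | true | true | true = e₂

  deep-mono : ∀ {k l} x → k ≤ l → Deep l x → Deep k x
  deep-mono x k≤l d = go (ℕₚ.≤⇒≤′ k≤l) d
    where
    go : ∀ {k l} → k ℕ.≤′ l → Deep l x → Deep k x
    go ℕ.≤′-refl             d = d
    go (ℕ.≤′-step {n = n} p) d = go p (deep-pred n x d)

  deep-good : ∀ k x → Deep k x → good (vtx x) ≡ true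
  deep-good k x d = deep-mono {0} {k} x ℕ.z≤n d

  deep-run : ∀ w k x → Deep (length w ℕ.+ k) x → Deep k (run w x)
  deep-run []      k x d = d
  deep-run (g ∷ w) k x d =
    deep-act k g (run w x) (deep-run w (suc k) x (subst (λ m → Deep m x) (sym (ℕₚ.+-suc (length w) k)) d))

  vtx-alt : ∀ k x → vtx (run (alt k) x) ≡ vtx x
  vtx-alt zero    x = refl
  vtx-alt (suc k) x = trans (turn (run (alt k) x)) (vtx-alt k x)
    where
    turn : ∀ z → vtx (act (letter k) z) ≡ vtx z
    turn = go k
      where
      go : ∀ k z → vtx (act (letter k) z) ≡ vtx z
      go 0             = vtx₁
      go 1             = vtx₂
      go (suc (suc k)) = go k

-- P holds at every flag lying deep inside the 6-regular part of a large system; the meaning of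
-- "deep" and "large" does not depend on the system.

Property : Set₁
Property = (S : System) → System.Flag S → Set

◇ : Property → Set
◇ P = ∃ λ K → ∀ S → K < System.nf S → ∀ x → System.Deep S K x → P S x

always : ∀ {P} → (∀ S x → P S x) → ◇ P
always f = 0 , λ S _ x _ → f S x

◇-map : ∀ {P Q} → (∀ S x → P S x → Q S x) → ◇ P → ◇ Q
◇-map f (K , h) = K , λ S K<n x d → f S x (h S K<n x d)

◇-map₂ : ∀ {P Q R} → (∀ S x → P S x → Q S x → R S x) → ◇ P → ◇ Q → ◇ R
◇-map₂ f (K , h) (L , k) = K ⊔ L , λ S <n x d →
  f S x (h S (ℕₚ.≤-<-trans (ℕₚ.m≤m⊔n K L) <n) x (System.deep-mono S x (ℕₚ.m≤m⊔n K L) d))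
        (k S (ℕₚ.≤-<-trans (ℕₚ.m≤n⊔m K L) <n) x (System.deep-mono S x (ℕₚ.m≤n⊔m K L) d))

◇-map₃ : ∀ {P Q R T} → (∀ S x → P S x → Q S x → R S x → T S x) → ◇ P → ◇ Q → ◇ R → ◇ T
◇-map₃ f p q r = ◇-map₂ (λ S x g → g) (◇-map₂ f p q) r

◇-run : ∀ {P} w → ◇ P → ◇ (λ S x → P S (System.run S w x))
◇-run w (K , h) = length w ℕ.+ K , λ S <n x d →
  h S (ℕₚ.≤-<-trans (ℕₚ.m≤n+m K (length w)) <n) (System.run S w x) (System.deep-run S w K x d)

-- Only a finite family has a maximal depth. This is why cells, neighbours, turns and candidate
-- periods are all indexed by a `Fin`.
◇-∀ : ∀ m {P : Fin m → Property} → (∀ i → ◇ (P i)) → ◇ (λ S x → ∀ i → P i S x)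
◇-∀ zero    h = always λ S x ()
◇-∀ (suc m) h = ◇-map₂ (λ S x p q → λ { zero → p ; (suc i) → q i }) (h zero) (◇-∀ m (λ i → h (suc i)))

◇-deep : ∀ k → ◇ (λ S x → System.Deep S k x)
◇-deep k = k , λ S _ x d → d

◇-good : ◇ (λ S x → System.good S (System.vtx S x) ≡ true)
◇-good = ◇-deep 0

◇-large : ∀ k → ◇ (λ S x → k < System.nf S)
◇-large k = k , λ S p x d → p

infix 4 _≈_
record _≈_ (u w : Word) : Set where
  constructor mk≈
  field
    agree : ◇ (λ S x → System.run S u x ≡ System.run S w x)
open _≈_

always≈ : ∀ {u w} → (∀ S x → System.run S u x ≡ System.run S w x) → u ≈ w
always≈ f = mk≈ (always f)

inverse : Word → Word
inverse []      = []
inverse (g ∷ w) = inverse w ++ (g ∷ [])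

run-inverseʳ : ∀ S w x → System.run S w (System.run S (inverse w) x) ≡ x
run-inverseʳ S []      x = refl
run-inverseʳ S (g ∷ w) x = trans (cong (λ z → act g (run w z)) (run-++ (inverse w) (g ∷ []) x))
  (trans (cong (act g) (run-inverseʳ S w (act g x))) (inv g x))
  where open System S

run-inverseˡ : ∀ S w x → System.run S (inverse w) (System.run S w x) ≡ x
run-inverseˡ S []      x = refl
run-inverseˡ S (g ∷ w) x = trans (run-++ (inverse w) (g ∷ []) _)
  (trans (cong (run (inverse w)) (inv g _)) (run-inverseˡ S w x))
  where open System S

run-injective : ∀ S w {x y} → System.run S w x ≡ System.run S w y → x ≡ y
run-injective S w {x} {y} e = trans (sym (run-inverseˡ S w x)) (trans (cong (System.run S (inverse w)) e) (run-inverseˡ S w y))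

++-cong : ∀ {u u′ w w′} → u ≈ u′ → w ≈ w′ → u ++ w ≈ u′ ++ w′
++-cong {u} {u′} {w} {w′} p q = mk≈ (◇-map₂
  (λ S x e f → trans (System.run-++ S u w x) (trans e (trans (cong (System.run S u′) f) (sym (System.run-++ S u′ w′ x)))))
  (◇-run w (agree p)) (agree q))

inverse-cong : ∀ {u w} → u ≈ w → inverse u ≈ inverse w
inverse-cong {u} {w} p = mk≈ (◇-map
  (λ S x e → run-injective S w (trans (sym e) (trans (run-inverseʳ S u x) (sym (run-inverseʳ S w x)))))
  (◇-run (inverse u) (agree p)))

-- Each relation between words holds from a depth of its own. Words up to eventual agreement hide
-- these depths and form a genuine group, to which the algebra of `Translations` applies.
wordGroup : Group 0ℓ 0ℓ
wordGroup = record
  { Carrier = Word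
  ; _≈_ = _≈_
  ; _∙_ = _++_
  ; ε = []
  ; _⁻¹ = inverse
  ; isGroup = record
    { isMonoid = record
      { isSemigroup = record
        { isMagma = record
          { isEquivalence = record
            { refl  = always≈ λ S x → refl
            ; sym   = λ p → mk≈ (◇-map (λ S x → sym) (agree p))
            ; trans = λ p q → mk≈ (◇-map₂ (λ S x → trans) (agree p) (agree q)) }
          ; ∙-cong = ++-cong }
        ; assoc = λ u v w → ≡⇒≈ (List.++-assoc u v w) }
      ; identity = (λ w → ≡⇒≈ refl) , λ w → ≡⇒≈ (List.++-identityʳ w) }
    ; inverse = (λ w → always≈ λ S x → trans (System.run-++ S (inverse w) w x) (run-inverseˡ S w x))
              , (λ w → always≈ λ S x → trans (System.run-++ S w (inverse w) x) (run-inverseʳ S w x))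
    ; ⁻¹-cong = inverse-cong } }
  where
  ≡⇒≈ : ∀ {u w} → u ≡ w → u ≈ w
  ≡⇒≈ refl = always≈ λ S x → refl

open GroupPowers wordGroup

-- Straight-ahead translation along the edge of a flag, and its mirror image in the next edge.
t₁ t₂ : Word
t₁ = g₁ ∷ g₂ ∷ g₁ ∷ g₂ ∷ g₁ ∷ g₀ ∷ []
t₂ = g₁ ∷ t₁ ++ (g₁ ∷ [])

-- This is where degree 6 enters: around the vertex of `α₀ x`, six sectors in one sense and six in
-- the other lead to the same flag, because twelve close up.
g₂t₁ : (g₂ ∷ []) ++ t₁ ≈ t₁ ++ (g₂ ∷ [])
g₂t₁ = mk≈ (◇-map lemma (◇-run (g₀ ∷ []) ◇-good))
  where
  lemma : ∀ S x → System.good S (System.vtx S (System.α₀ S x)) ≡ true →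
          System.run S ((g₂ ∷ []) ++ t₁) x ≡ System.run S (t₁ ++ (g₂ ∷ [])) x
  lemma S x h = trans half (cong (run (g₁ ∷ g₂ ∷ g₁ ∷ g₂ ∷ g₁ ∷ [])) (sym (comm₀₂ x)))
    where
    open System S
    y = α₀ x
    half : run (alt 6) y ≡ run (g₁ ∷ g₂ ∷ g₁ ∷ g₂ ∷ g₁ ∷ g₂ ∷ []) y
    half = trans (sym (run-inverseˡ S (alt 6) (run (alt 6) y)))
                 (cong (run (inverse (alt 6))) (good-cycle y h))

-- The geometry is that of one triangular face. Once adjacent involutions cancel, what remains is
-- that four of the six steps around the triangle equal the other two reversed.
g₂t₂g₂t₂ : (g₂ ∷ t₂) ++ (g₂ ∷ t₂) ≈ t₁
g₂t₂g₂t₂ = always≈ λ S x →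
  let open System S
      y = α₀ (α₁ x)
      z = α₁ (α₂ (α₁ (α₂ (α₁ y))))
  in begin
  α₂ (α₁ (α₁ (α₂ (α₁ (α₂ (α₁ (α₀ (α₁ (α₂ (α₁ z))))))))))
    ≡⟨ cong α₂ (inv g₁ _) ⟩
  α₂ (α₂ (α₁ (α₂ (α₁ (α₀ (α₁ (α₂ (α₁ z))))))))
    ≡⟨ inv g₂ _ ⟩
  α₁ (α₂ (α₁ (α₀ (α₁ (α₂ (α₁ z))))))
    ≡⟨ cong (λ u → α₁ (α₂ (α₁ (α₀ (α₁ (α₂ u)))))) (inv g₁ _) ⟩
  α₁ (α₂ (α₁ (α₀ (α₁ (α₂ (α₂ (α₁ (α₂ (α₁ y)))))))))
    ≡⟨ cong (λ u → α₁ (α₂ (α₁ (α₀ (α₁ u))))) (inv g₂ _) ⟩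
  α₁ (α₂ (α₁ (α₀ (α₁ (α₁ (α₂ (α₁ y)))))))
    ≡⟨ cong (λ u → α₁ (α₂ (α₁ (α₀ u)))) (inv g₁ _) ⟩
  α₁ (α₂ (α₁ (α₀ (α₂ (α₁ y)))))
    ≡⟨ cong (λ u → α₁ (α₂ (α₁ u))) (comm₀₂ _) ⟩
  α₁ (α₂ (α₁ (α₂ (α₀ (α₁ (α₀ (α₁ x)))))))
    ≡⟨ cong (λ u → α₁ (α₂ (α₁ (α₂ u)))) (begin
         α₀ (α₁ (α₀ (α₁ x))) ≡⟨ inv g₁ _ ⟨
         α₁ (α₁ (α₀ (α₁ (α₀ (α₁ x))))) ≡⟨ cong α₁ (inv g₀ _) ⟨
         α₁ (α₀ (α₀ (α₁ (α₀ (α₁ (α₀ (α₁ x))))))) ≡⟨ cong (λ u → α₁ (α₀ u)) (triangle x) ⟩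
         α₁ (α₀ x) ∎) ⟩
  α₁ (α₂ (α₁ (α₂ (α₁ (α₀ x))))) ∎
  where open ≡-Reasoning

-- Lattice coordinates, turns and periods

Vec : Set
Vec = ℤ × ℤ

infixl 6 _⊕_ _⊖_
_⊕_ _⊖_ : Vec → Vec → Vec
(i , j) ⊕ (k , l) = i ℤ.+ k , j ℤ.+ l
(i , j) ⊖ (k , l) = i ℤ.- k , j ℤ.- l

infixr 7 _⊙_
_⊙_ : ℤ → Vec → Vec
m ⊙ (i , j) = m ℤ.* i , m ℤ.* j

𝟎 e₁ e₂ : Vec
𝟎  = + 0 , + 0
e₁ = + 1 , + 0
e₂ = + 0 , + 1

private
  module Tr = Translations {t₁} {t₂} {g₁ ∷ []} {g₂ ∷ []}
    (always≈ λ S x → System.inv S g₂ x) g₂t₁ g₂t₂g₂t₂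
    (always≈ λ S x → cong (System.run S (g₁ ∷ t₁)) (sym (System.inv S g₁ x)))
    (always≈ λ S x → System.inv S g₁ _)

tr : Vec → Word
tr (i , j) = Tr.translate i j

tr-⊕ : ∀ p q → tr (p ⊕ q) ≈ tr p ++ tr q
tr-⊕ (i , j) (k , l) = Tr.translate-+ i j k l

-- Conjugation of translations in an oblique basis with angle 60°: `g₁` exchanges `t₁` and `t₂`,
-- while `g₂` fixes `t₁` and sends `t₂` to `t₁ t₂⁻¹`.
reflect : Gen → Vec → Vec
reflect g₀ p       = p
reflect g₁ (i , j) = j , i
reflect g₂ (i , j) = i ℤ.+ j , ℤ.- j

tr-reflect : ∀ k p → letter k ∷ tr p ≈ tr (reflect (letter k) p) ++ (letter k ∷ [])
tr-reflect 0             (i , j) = Tr.reflect₁ i j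
tr-reflect 1             (i , j) = Tr.reflect₂ i j
tr-reflect (suc (suc k)) p       = tr-reflect k p

at : (S : System) → System.Flag S → Vec → System.Flag S
at S x p = System.run S (tr p) x

vec≡ : ∀ {i j k l : ℤ} → i ≡ k → j ≡ l → _≡_ {A = Vec} (i , j) (k , l)
vec≡ = cong₂ _,_

⊕-comm : ∀ p q → p ⊕ q ≡ q ⊕ p
⊕-comm (i , j) (k , l) = vec≡ (ℤₚ.+-comm i k) (ℤₚ.+-comm j l)

⊖-⊕-cancel : ∀ p q → (p ⊖ q) ⊕ q ≡ p
⊖-⊕-cancel (i , j) (k , l) = vec≡ (cancel i k) (cancel j l)
  where
  cancel : ∀ i k → (i ℤ.- k) ℤ.+ k ≡ i
  cancel = solve-∀

at-⊕ : ∀ p q → ◇ (λ S x → at S (at S x p) q ≡ at S x (p ⊕ q))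
at-⊕ p q = ◇-map
  (λ S x e → trans (sym (System.run-++ S (tr q) (tr p) x)) (trans (sym e) (cong (at S x) (⊕-comm q p))))
  (agree (tr-⊕ q p))

-- The linear map induced by `alt k`: for `k` < 12 the even values give the six rotations of the
-- triangular lattice, and the odd values its six reflections.
rotate unrotate : ℕ → Vec → Vec
rotate zero    p = p
rotate (suc k) p = reflect (letter k) (rotate k p)
unrotate zero    p = p
unrotate (suc k) p = unrotate k (reflect (letter k) p)

reflect-involutive : ∀ g p → reflect g (reflect g p) ≡ p
reflect-involutive g₀ p       = refl
reflect-involutive g₁ p       = refl
reflect-involutive g₂ (i , j) = vec≡ (cancel i j) (ℤₚ.neg-involutive j)
  where
  cancel : ∀ i j → (i ℤ.+ j) ℤ.+ ℤ.- j ≡ i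
  cancel = solve-∀

rotate-unrotate : ∀ k p → rotate k (unrotate k p) ≡ p
rotate-unrotate zero    p = refl
rotate-unrotate (suc k) p =
  trans (cong (reflect (letter k)) (rotate-unrotate k (reflect (letter k) p))) (reflect-involutive (letter k) p)

alt-at : ∀ k p → ◇ (λ S x → System.run S (alt k) (at S x p) ≡ at S (System.run S (alt k) x) (rotate k p))
alt-at zero    p = always λ S x → refl
alt-at (suc k) p = ◇-map₂
  (λ S x ih e → trans (cong (System.act S (letter k)) ih)
                      (trans e (System.run-++ S (tr (rotate (suc k) p)) (letter k ∷ []) _)))
  (alt-at k p) (◇-run (alt k) (agree (tr-reflect k (rotate k p))))

at-alt : ∀ k p → ◇ (λ S x → at S (System.run S (alt k) x) p ≡ System.run S (alt k) (at S x (unrotate k p)))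
at-alt k p = ◇-map
  (λ S x e → sym (trans e (cong (at S (System.run S (alt k) x)) (rotate-unrotate k p))))
  (alt-at k (unrotate k p))

Per : Vec → Property
Per p S x = at S x p ≡ x

per-⊕ : ∀ p q → ◇ (λ S x → Per p S x → Per q S x → Per (p ⊕ q) S x)
per-⊕ p q = ◇-map (λ S x e hp hq → trans (sym e) (trans (cong (λ z → at S z q) hp) hq)) (at-⊕ p q)

at-cancel : ∀ p q r → p ⊕ r ≡ q → ◇ (λ S x → at S (at S x p) r ≡ at S x q)
at-cancel p q r refl = at-⊕ p r

at≡⇒per : ∀ p q → ◇ (λ S x → at S x p ≡ at S x q → Per (p ⊖ q) S x)
at≡⇒per p q = ◇-map₂
  (λ S x e f h → trans (sym e) (trans (cong (λ z → at S z (𝟎 ⊖ q)) h) f))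
  (at-cancel p (p ⊖ q) (𝟎 ⊖ q) (lemma p q)) (at-cancel q 𝟎 (𝟎 ⊖ q) (lemma′ q))
  where
  lemma : ∀ p q → p ⊕ (𝟎 ⊖ q) ≡ p ⊖ q
  lemma (i , j) (k , l) = vec≡ (eq i k) (eq j l)
    where
    eq : ∀ i k → i ℤ.+ (+ 0 ℤ.- k) ≡ i ℤ.- k
    eq = solve-∀
  lemma′ : ∀ q → q ⊕ (𝟎 ⊖ q) ≡ 𝟎
  lemma′ (k , l) = vec≡ (eq k) (eq l)
    where
    eq : ∀ k → k ℤ.+ (+ 0 ℤ.- k) ≡ + 0
    eq = solve-∀

per⇒at≡ : ∀ p q → ◇ (λ S x → Per (p ⊖ q) S x → at S x p ≡ at S x q)
per⇒at≡ p q = ◇-map (λ S x e h → trans (sym e) (cong (λ z → at S z q) h))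
  (at-cancel (p ⊖ q) p q (⊖-⊕-cancel p q))

per-neg : ∀ p → ◇ (λ S x → Per p S x → Per (𝟎 ⊖ p) S x)
per-neg p = ◇-map (λ S x f h → f (sym h)) (at≡⇒per 𝟎 p)

per-cong : ∀ {p q} → p ≡ q → ◇ (λ S x → Per p S x → Per q S x)
per-cong refl = always λ S x h → h

per-⊙⁺ : ∀ n p → ◇ (λ S x → Per p S x → Per (+ n ⊙ p) S x)
per-⊙⁺ zero    (i , j) = always λ S x h → refl
per-⊙⁺ (suc n) p       = ◇-map₃ (λ S x f g k h → k (f h (g h)))
  (per-⊕ p (+ n ⊙ p)) (per-⊙⁺ n p) (per-cong (lemma p))
  where
  lemma : ∀ p → p ⊕ (+ n ⊙ p) ≡ + suc n ⊙ p
  lemma (i , j) = vec≡ (sym (ℤₚ.suc-* (+ n) i)) (sym (ℤₚ.suc-* (+ n) j))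

per-⊙ : ∀ m p → ◇ (λ S x → Per p S x → Per (m ⊙ p) S x)
per-⊙ (+ n)    p = per-⊙⁺ n p
per-⊙ -[1+ n ] p = ◇-map₃ (λ S x f g k h → k (f (g h)))
  (per-neg (+ suc n ⊙ p)) (per-⊙⁺ (suc n) p) (per-cong (lemma p))
  where
  eq : ∀ i → + 0 ℤ.- (+ suc n ℤ.* i) ≡ -[1+ n ] ℤ.* i
  eq i = trans (ℤₚ.+-identityˡ _) (ℤₚ.neg-distribˡ-* (+ suc n) i)
  lemma : ∀ p → 𝟎 ⊖ (+ suc n ⊙ p) ≡ -[1+ n ] ⊙ p
  lemma (i , j) = vec≡ (eq i) (eq j)

per-combination : ∀ k l p q r → (k ⊙ p) ⊕ (l ⊙ q) ≡ r → ◇ (λ S x → Per p S x → Per q S x → Per r S x)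
per-combination k l p q r refl = ◇-map₃ (λ S x f g h hp hq → h (f hp) (g hq))
  (per-⊙ k p) (per-⊙ l q) (per-⊕ (k ⊙ p) (l ⊙ q))

-- Turning around a vertex

turn-cases : ∀ k g → g ≢ g₀ → g ≡ letter k ⊎ g ≡ letter (suc k)
turn-cases 0             g₀ n = ⊥-elim (n refl)
turn-cases 0             g₁ n = inj₁ refl
turn-cases 0             g₂ n = inj₂ refl
turn-cases 1             g₀ n = ⊥-elim (n refl)
turn-cases 1             g₁ n = inj₂ refl
turn-cases 1             g₂ n = inj₁ refl
turn-cases (suc (suc k)) g  n = turn-cases k g n

-- The twelve flags `alt k y` form a cycle in which, at each position, one of the two involutions
-- moves forward and the other back. `good-cycle` joins the two ends.
turn : ∀ S y → System.good S (System.vtx S y) ≡ true → ∀ k → k < 12 → ∀ g → g ≢ g₀ →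
       ∃ λ l → l < 12 × System.act S g (System.run S (alt k) y) ≡ System.run S (alt l) y
turn S y h k k<12 g n with turn-cases k g n
turn S y h k k<12 g n | inj₁ refl with suc k ℕₚ.<? 12
... | yes sk<12 = suc k , sk<12 , refl
... | no  sk≮12 = 0 , ℕ.s≤s ℕ.z≤n , trans (cong (λ m → System.run S (alt m) y) (ℕₚ.≤-antisym k<12 (ℕₚ.≮⇒≥ sk≮12))) (System.good-cycle S y h)
turn S y h zero    k<12 g n | inj₂ refl = 11 , ℕₚ.≤-refl ,
  trans (cong (System.act S g₂) (sym (System.good-cycle S y h))) (System.inv S g₂ _)
turn S y h (suc k) k<12 g n | inj₂ refl = k , ℕₚ.<-trans (ℕₚ.n<1+n k) k<12 , System.inv S (letter k) _

-- Up to turning around a vertex, crossing an edge is a translation. A set of flags closed under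
-- turns and under `e₁` is therefore closed under all three involutions.
α₀-as-translation : ∀ S z → System.α₀ S z ≡ System.run S (g₁ ∷ g₂ ∷ g₁ ∷ g₂ ∷ g₁ ∷ []) (at S z e₁)
α₀-as-translation S z = sym (run-inverseˡ S (g₁ ∷ g₂ ∷ g₁ ∷ g₂ ∷ g₁ ∷ []) (System.α₀ S z))

letter≢g₀ : ∀ k → letter k ≢ g₀
letter≢g₀ 0             ()
letter≢g₀ 1             ()
letter≢g₀ (suc (suc k)) = letter≢g₀ k

-- A flag with two independent periods generates a quotient torus of bounded size, which is the whole system.
module SquarePeriod (δ : ℕ) where
  private
    Δ : ℕ
    Δ = suc δ

  position : Fin Δ → Fin Δ → Vec
  position i j = + toℕ i , + toℕ j

  Image : (S : System) (x z : System.Flag S) → Set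
  Image S x z = ∃ λ (k : Fin 12) → ∃₂ λ (i j : Fin Δ) → z ≡ System.run S (alt (toℕ k)) (at S x (position i j))

  reduce : ∀ q → ◇ (λ S x → Per (+ Δ , + 0) S x → Per (+ 0 , + Δ) S x →
                     ∃₂ λ (i j : Fin Δ) → at S x q ≡ at S x (position i j))
  reduce q@(a , b) = ◇-map₂
    (λ S x f g hp hq → i , j , trans (sym g) (cong (λ z → at S z r) (f hp hq)))
    (per-combination ka kb (+ Δ , + 0) (+ 0 , + Δ) m refl)
    (at-cancel m q r eq)
    where
    ka = a ℤDM./ℕ Δ
    kb = b ℤDM./ℕ Δ
    i = fromℕ< (ℤDM.n%ℕd<d a Δ)
    j = fromℕ< (ℤDM.n%ℕd<d b Δ)
    r = position i j
    m = (ka ⊙ (+ Δ , + 0)) ⊕ (kb ⊙ (+ 0 , + Δ))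
    e₁′ : ∀ u k l d → u ℤ.+ k ℤ.* d ≡ (k ℤ.* d ℤ.+ l ℤ.* + 0) ℤ.+ u
    e₁′ = solve-∀
    e₂′ : ∀ u k l d → u ℤ.+ l ℤ.* d ≡ (k ℤ.* + 0 ℤ.+ l ℤ.* d) ℤ.+ u
    e₂′ = solve-∀
    eq : m ⊕ r ≡ q
    eq = sym (vec≡
      (trans (ℤDM.a≡a%ℕn+[a/ℕn]*n a Δ) (trans (cong (λ t → + t ℤ.+ ka ℤ.* + Δ) (sym (Finₚ.toℕ-fromℕ< _))) (e₁′ (+ toℕ i) ka kb (+ Δ))))
      (trans (ℤDM.a≡a%ℕn+[a/ℕn]*n b Δ) (trans (cong (λ t → + t ℤ.+ kb ℤ.* + Δ) (sym (Finₚ.toℕ-fromℕ< _))) (e₂′ (+ toℕ j) ka kb (+ Δ)))))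

  Closed₀ : Fin 12 → Fin Δ → Fin Δ → Property
  Closed₀ k i j S x = Per (+ Δ , + 0) S x → Per (+ 0 , + Δ) S x →
    ∃₂ λ (i′ j′ : Fin Δ) → at S (System.run S (alt (toℕ k)) (at S x (position i j))) e₁
                         ≡ System.run S (alt (toℕ k)) (at S x (position i′ j′))

  closed₀ : ∀ k i j → ◇ (Closed₀ k i j)
  closed₀ k i j = ◇-map₃
    (λ S x f g h hp hq → proj₁ (h hp hq) , proj₁ (proj₂ (h hp hq)) ,
       trans f (cong (System.run S (alt (toℕ k))) (trans g (proj₂ (proj₂ (h hp hq))))))
    (◇-run (tr (position i j)) (at-alt (toℕ k) e₁))
    (at-⊕ (position i j) (unrotate (toℕ k) e₁))
    (reduce (position i j ⊕ unrotate (toℕ k) e₁))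

  -- The `12Δ²` flags listed by `Image` are closed under the involutions, so by connectedness there
  -- are no others. A system with more flags is then impossible.
  no-square-period : ◇ (λ S x → Per (+ Δ , + 0) S x → Per (+ 0 , + Δ) S x → ⊥)
  no-square-period = ◇-map₃ contra
    (◇-∀ 12 λ k → ◇-∀ Δ λ i → ◇-∀ Δ λ j → closed₀ k i j)
    (◇-∀ Δ λ i → ◇-∀ Δ λ j → ◇-run (tr (position i j)) ◇-good)
    (◇-large (12 ℕ.* (Δ ℕ.* Δ)))
    where
    contra : ∀ S x → (∀ k i j → Closed₀ k i j S x) →
             (∀ i j → System.good S (System.vtx S (at S x (position i j))) ≡ true) →
             12 ℕ.* (Δ ℕ.* Δ) < System.nf S →
             Per (+ Δ , + 0) S x → Per (+ 0 , + Δ) S x → ⊥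
    contra S x cl gd large hp hq = ℕₚ.<⇒≱ large (Finₚ.injective⇒≤ {f = code} code-injective)
      where
      open System S
      turned : ∀ g z → g ≢ g₀ → Image S x z → Image S x (act g z)
      turned g z n (k , i , j , refl) =
        let (l , l<12 , e) = turn S (at S x (position i j)) (gd i j) (toℕ k) (Finₚ.toℕ<n k) g n
        in fromℕ< l<12 , i , j , trans e (cong (λ m → run (alt m) (at S x (position i j))) (sym (Finₚ.toℕ-fromℕ< l<12)))
      turned-alt : ∀ k z → Image S x z → Image S x (run (alt k) z)
      turned-alt zero    z im = im
      turned-alt (suc k) z im = turned (letter k) _ (letter≢g₀ k) (turned-alt k z im)
      moved : ∀ z → Image S x z → Image S x (α₀ z)
      moved z (k , i , j , refl) =
        let (i′ , j′ , e) = cl k i j hp hq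
        in subst (Image S x) (sym (trans (α₀-as-translation S z) (cong (run (alt 5)) e)))
             (turned-alt 5 _ (turned-alt (toℕ k) _ (zero , i′ , j′ , refl)))
      everything : ∀ {z} → Orb (α₀ ∷ α₁ ∷ α₂ ∷ []) x z → Image S x z
      everything here                                   = zero , zero , zero , refl
      everything (step g (here refl) o)                 = moved _ (everything o)
      everything (step g (there (here refl)) o)         = turned g₁ _ (λ ()) (everything o)
      everything (step g (there (there (here refl))) o) = turned g₂ _ (λ ()) (everything o)
      image : ∀ z → Image S x z
      image z = everything (connected x z)
      code : Fin nf → Fin (12 ℕ.* (Δ ℕ.* Δ))
      code z = let (k , i , j , _) = image z in combine k (combine i j)
      code-injective : ∀ {y z} → code y ≡ code z → y ≡ z
      code-injective {y} {z} e with image y | image z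
      ... | k , i , j , refl | k′ , i′ , j′ , refl with Finₚ.combine-injective k (combine i j) k′ (combine i′ j′) e
      ... | refl , e′ with Finₚ.combine-injective i j i′ j′ e′
      ... | refl , refl = refl

det : Vec → Vec → ℤ
det (i , j) (k , l) = i ℤ.* l ℤ.- j ℤ.* k

-- Cramer's rule: suitable integer combinations of `p` and `q` are `|det p q|` times the two unit
-- vectors, which reduces the claim to a square of periods.
no-independent-periods : ∀ p q → det p q ≢ + 0 → ◇ (λ S x → Per p S x → Per q S x → ⊥)
no-independent-periods p@(i , j) q@(k , l) nz with det p q in e
... | + zero    = ⊥-elim (nz refl)
... | + suc δ   = ◇-map₃ (λ S x f g h hp hq → h (f hp hq) (g hp hq))
  (per-combination l (ℤ.- j) p q (+ suc δ , + 0) (vec≡ (trans (a₁ i j k l) e) (a₂ j l)))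
  (per-combination (ℤ.- k) i p q (+ 0 , + suc δ) (vec≡ (a₃ i k) (trans (a₄ i j k l) e)))
  (SquarePeriod.no-square-period δ)
  where
  a₁ : ∀ i j k l → l ℤ.* i ℤ.+ ℤ.- j ℤ.* k ≡ i ℤ.* l ℤ.- j ℤ.* k
  a₁ = solve-∀
  a₂ : ∀ j l → l ℤ.* j ℤ.+ ℤ.- j ℤ.* l ≡ + 0
  a₂ = solve-∀
  a₃ : ∀ i k → ℤ.- k ℤ.* i ℤ.+ i ℤ.* k ≡ + 0
  a₃ = solve-∀
  a₄ : ∀ i j k l → ℤ.- k ℤ.* j ℤ.+ i ℤ.* l ≡ i ℤ.* l ℤ.- j ℤ.* k
  a₄ = solve-∀
... | -[1+ δ ]  = ◇-map₃ (λ S x f g h hp hq → h (f hp hq) (g hp hq))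
  (per-combination (ℤ.- l) j p q (+ suc δ , + 0) (vec≡ (trans (a₁ i j k l) (cong ℤ.-_ e)) (a₂ j l)))
  (per-combination k (ℤ.- i) p q (+ 0 , + suc δ) (vec≡ (a₃ i k) (trans (a₄ i j k l) (cong ℤ.-_ e))))
  (SquarePeriod.no-square-period δ)
  where
  a₁ : ∀ i j k l → ℤ.- l ℤ.* i ℤ.+ j ℤ.* k ≡ ℤ.- (i ℤ.* l ℤ.- j ℤ.* k)
  a₁ = solve-∀
  a₂ : ∀ j l → ℤ.- l ℤ.* j ℤ.+ j ℤ.* l ≡ + 0
  a₂ = solve-∀
  a₃ : ∀ i k → k ℤ.* i ℤ.+ ℤ.- i ℤ.* k ≡ + 0
  a₃ = solve-∀
  a₄ : ∀ i j k l → k ℤ.* j ℤ.+ ℤ.- i ℤ.* l ≡ ℤ.- (i ℤ.* l ℤ.- j ℤ.* k)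
  a₄ = solve-∀

-- Neighbours

dir : Fin 6 → Vec
dir k = unrotate (toℕ k ℕ.+ toℕ k) e₁

vtx-dir : ∀ k → ◇ (λ S x → System.vtx S (at S x (dir k)) ≡ System.vtx S (System.α₀ S (System.run S (alt (toℕ k ℕ.+ toℕ k)) x)))
vtx-dir k = ◇-map
  (λ S x e → let open System S in
     trans (sym (vtx-alt (toℕ k ℕ.+ toℕ k) _)) (trans (cong vtx (sym e)) (vtx-alt 5 _)))
  (at-alt (toℕ k ℕ.+ toℕ k) e₁)

-- Two of the six neighbours of the vertex would coincide, against simplicity. Thus the thinnest
-- tubes never occur.
no-short-period : ∀ k l → k ≢ l → ◇ (λ S x → Per (dir k ⊖ dir l) S x → ⊥)
no-short-period k l k≢l = ◇-map₂
  (λ S x d f h → k≢l (Finₚ.toℕ-injective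
     (System.good-nbrs S x (proj₁ d) (toℕ k) (toℕ l) (Finₚ.toℕ<n k) (Finₚ.toℕ<n l)
       (trans (sym (proj₁ (proj₂ d))) (trans (cong (System.vtx S) (f h)) (proj₂ (proj₂ d)))))))
  (◇-map₃ (λ S x g e f → g , e , f) ◇-good (vtx-dir k) (vtx-dir l))
  (per⇒at≡ (dir k) (dir l))

step₇ : Fin 7 → Vec
step₇ zero    = 𝟎
step₇ (suc k) = dir k

Dominates : (S : System) → Fin (System.nv S) → Fin (System.nv S) → Set
Dominates S u v = u ≡ v ⊎ System.Adj S u v

step-dominated : ∀ m → ◇ (λ S x → Dominates S (System.vtx S x) (System.vtx S (at S x (step₇ m))))
step-dominated zero    = always λ S x → inj₁ refl
step-dominated (suc k) = ◇-map (λ S x e → inj₂ (_ , System.vtx-alt S (toℕ k ℕ.+ toℕ k) x , sym e)) (vtx-dir k)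

halve : ∀ m → ∃ λ k → m ≡ k ℕ.+ k ⊎ m ≡ suc (k ℕ.+ k)
halve zero    = 0 , inj₁ refl
halve (suc m) with halve m
... | k , inj₁ refl = k , inj₂ refl
... | k , inj₂ refl = suc k , inj₁ (cong suc (sym (ℕₚ.+-suc k k)))

double-< : ∀ k l → k ℕ.+ k < l ℕ.+ l → k < l
double-< k l h = ℕₚ.≰⇒> λ l≤k → ℕₚ.<⇒≱ h (ℕₚ.+-mono-≤ l≤k l≤k)

letter-odd : ∀ k → letter (suc (k ℕ.+ k)) ≡ g₂
letter-odd zero    = refl
letter-odd (suc k) = trans (cong letter (ℕₚ.+-suc k k)) (letter-odd k)

-- A flag and its `α₂`-image lie on the same edge, so an odd position has the same far end as the
-- next even one. Position 11 wraps round to direction 0.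
neighbour-direction : ∀ S x → System.good S (System.vtx S x) ≡ true → ∀ m → m < 12 →
  ∃ λ (k : Fin 6) → System.vtx S (System.α₀ S (System.run S (alt m) x))
                  ≡ System.vtx S (System.α₀ S (System.run S (alt (toℕ k ℕ.+ toℕ k)) x))
neighbour-direction S x h m m<12 with halve m
... | k , inj₁ refl = fromℕ< k<6 , cong (λ l → vtx (α₀ (run (alt (l ℕ.+ l)) x))) (sym (Finₚ.toℕ-fromℕ< k<6))
  where
  open System S
  k<6 = double-< k 6 m<12
... | k , inj₂ refl = result (ℕₚ.m≤n⇒m<n∨m≡n (double-< k 6 (ℕₚ.<-trans (ℕₚ.n<1+n _) m<12)))
  where
  open System S
  z = run (alt (suc (k ℕ.+ k))) x
  next : run (alt (suc k ℕ.+ suc k)) x ≡ α₂ z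
  next = trans (cong (λ l → run (alt (suc l)) x) (ℕₚ.+-suc k k)) (cong (λ g → act g z) (letter-odd k))
  same : vtx (α₀ z) ≡ vtx (α₀ (run (alt (suc k ℕ.+ suc k)) x))
  same = trans (sym (vtx₂ (α₀ z))) (cong vtx (trans (sym (comm₀₂ z)) (cong α₀ (sym next))))
  result : suc k < 6 ⊎ suc k ≡ 6 → _
  result (inj₁ sk<6) = fromℕ< sk<6 , trans same (cong (λ l → vtx (α₀ (run (alt (l ℕ.+ l)) x))) (sym (Finₚ.toℕ-fromℕ< sk<6)))
  result (inj₂ refl) = zero , trans same (cong (λ z → vtx (α₀ z)) (good-cycle x h))

dominated-step : ◇ (λ S x → ∀ v → Dominates S (System.vtx S x) v → ∃ λ m → v ≡ System.vtx S (at S x (step₇ m)))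
dominated-step = ◇-map₂ find ◇-good (◇-∀ 6 vtx-dir)
  where
  find : ∀ S x → System.good S (System.vtx S x) ≡ true →
         (∀ k → System.vtx S (at S x (dir k)) ≡ System.vtx S (System.α₀ S (System.run S (alt (toℕ k ℕ.+ toℕ k)) x))) →
         ∀ v → Dominates S (System.vtx S x) v → ∃ λ m → v ≡ System.vtx S (at S x (step₇ m))
  find S x h vd v (inj₁ e)            = zero , sym e
  find S x h vd v (inj₂ (z , ez , e)) with System.good-orbit S x h z ez
  ... | m , m<12 , refl with neighbour-direction S x h m m<12
  ... | k , e′ = suc k , trans (sym e) (trans e′ (sym (vd k)))

-- Counting over flags, and the rarity of turned coincidences

module _ where
  open import Data.Nat.Base using (_+_; _*_; _^_)

  ind : Bool → ℕ
  ind false = 0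
  ind true  = 1

  count : ∀ {m} → (Fin m → Bool) → ℕ
  count P = sum (ind ∘ P)

  sum-mono : ∀ {m} {f g : Fin m → ℕ} → (∀ i → f i ≤ g i) → sum f ≤ sum g
  sum-mono {zero}  h = z≤n
  sum-mono {suc m} h = ℕₚ.+-mono-≤ (h zero) (sum-mono (h ∘ suc))

  sum-const : ∀ m c → sum {m} (λ _ → c) ≡ m * c
  sum-const zero    c = refl
  sum-const (suc m) c = cong (ℕ._+_ c) (sum-const m c)

  sum-*ˡ : ∀ {m} c (f : Fin m → ℕ) → sum (λ i → c * f i) ≡ c * sum f
  sum-*ˡ {zero}  c f = sym (ℕₚ.*-zeroʳ c)
  sum-*ˡ {suc m} c f = trans (cong (ℕ._+_ (c * f zero)) (sum-*ˡ c (f ∘ suc))) (sym (ℕₚ.*-distribˡ-+ c (f zero) _))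

  sum-bijection : ∀ {m} (f : Fin m → ℕ) (σ σ⁻¹ : Fin m → Fin m) →
    (∀ x → σ (σ⁻¹ x) ≡ x) → (∀ x → σ⁻¹ (σ x) ≡ x) → sum (f ∘ σ) ≡ sum f
  sum-bijection f σ σ⁻¹ r l = sym (sum-permute f (Perm.permutation σ σ⁻¹ r l))

  sum-run : ∀ S w (f : System.Flag S → ℕ) → sum (f ∘ System.run S w) ≡ sum f
  sum-run S w f = sum-bijection f (System.run S w) (System.run S (inverse w)) (run-inverseʳ S w) (run-inverseˡ S w)

  ind-mono : ∀ {b c} → (b ≡ true → c ≡ true) → ind b ≤ ind c
  ind-mono {false} h = z≤n
  ind-mono {true}  h rewrite h refl = ℕₚ.≤-refl

  ind≤1 : ∀ b → ind b ≤ 1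
  ind≤1 false = z≤n
  ind≤1 true  = ℕₚ.≤-refl

  count≤ : ∀ {m} (P : Fin m → Bool) → count P ≤ m
  count≤ {m} P = ℕₚ.≤-trans (sum-mono (λ i → ind≤1 (P i))) (ℕₚ.≤-reflexive (trans (sum-const m 1) (ℕₚ.*-identityʳ m)))

  sum≡0 : ∀ {m} {f : Fin m → ℕ} → (∀ i → f i ≡ 0) → sum f ≡ 0
  sum≡0 {zero}  h = refl
  sum≡0 {suc m} h = cong₂ _+_ (h zero) (sum≡0 (h ∘ suc))

  term≤sum : ∀ {m} (f : Fin m → ℕ) i → f i ≤ sum f
  term≤sum {suc m} f zero    = ℕₚ.m≤m+n (f zero) _
  term≤sum {suc m} f (suc i) = ℕₚ.≤-trans (term≤sum (f ∘ suc) i) (ℕₚ.m≤n+m _ (f zero))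

  count-unique : ∀ {m} (P : Fin m → Bool) → (∀ i j → P i ≡ true → P j ≡ true → toℕ i < toℕ j → ⊥) → count P ≤ 1
  count-unique {zero}  P h = z≤n
  count-unique {suc m} P h with P zero in e
  ... | false = count-unique (P ∘ suc) λ i j p q i<j → h (suc i) (suc j) p q (s≤s i<j)
  ... | true  = ℕₚ.≤-reflexive (cong suc (sum≡0 λ i → others i))
    where
    others : ∀ i → ind (P (suc i)) ≡ 0
    others i with P (suc i) in e′
    ... | false = refl
    ... | true  = ⊥-elim (h zero (suc i) e e′ (s≤s z≤n))

  -- A failure at depth `k + 1` is a failure at depth `k` of the flag or of one of its three images.
  -- Each image map is a bijection, so every level costs at most a factor 4.
  count-nondeep : ∀ S k → count (not ∘ System.deep S k) ≤ 4 ^ k * count (λ x → not (System.good S (System.vtx S x)))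
  count-nondeep S zero    = ℕₚ.≤-reflexive (sym (ℕₚ.*-identityˡ _))
  count-nondeep S (suc k) = begin
    count (not ∘ deep (suc k)) ≤⟨ sum-mono pointwise ⟩
    sum (λ x → f x + (f (α₀ x) + (f (α₁ x) + f (α₂ x)))) ≡⟨ ∑-distrib-+ f _ ⟩
    sum f + sum (λ x → f (α₀ x) + (f (α₁ x) + f (α₂ x))) ≡⟨ cong (ℕ._+_ (sum f)) (∑-distrib-+ (f ∘ α₀) _) ⟩
    sum f + (sum (f ∘ α₀) + sum (λ x → f (α₁ x) + f (α₂ x))) ≡⟨ cong (λ z → sum f + (sum (f ∘ α₀) + z)) (∑-distrib-+ (f ∘ α₁) _) ⟩
    sum f + (sum (f ∘ α₀) + (sum (f ∘ α₁) + sum (f ∘ α₂))) ≡⟨ cong₂ (λ u v → sum f + (u + v)) (sum-run S (g₀ ∷ []) f) (cong₂ _+_ (sum-run S (g₁ ∷ []) f) (sum-run S (g₂ ∷ []) f)) ⟩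
    sum f + (sum f + (sum f + sum f)) ≡⟨ cong (λ z → sum f + (sum f + (sum f + z))) (sym (ℕₚ.+-identityʳ _)) ⟩
    4 * sum f ≤⟨ ℕₚ.*-monoʳ-≤ 4 (count-nondeep S k) ⟩
    4 * (4 ^ k * count (λ x → not (good (vtx x)))) ≡⟨ ℕₚ.*-assoc 4 (4 ^ k) _ ⟨
    4 ^ suc k * count (λ x → not (good (vtx x))) ∎
    where
    open System S
    open ℕₚ.≤-Reasoning
    f : Flag → ℕ
    f x = ind (not (deep k x))
    pointwise : ∀ x → ind (not (deep (suc k) x)) ≤ f x + (f (α₀ x) + (f (α₁ x) + f (α₂ x)))
    pointwise x with deep k x | deep k (α₀ x) | deep k (α₁ x) | deep k (α₂ x)
    ... | false | _     | _     | _     = s≤s z≤n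
    ... | true  | false | _     | _     = s≤s z≤n
    ... | true  | true  | false | _     = s≤s z≤n
    ... | true  | true  | true  | false = s≤s z≤n
    ... | true  | true  | true  | true  = z≤n

  iterate : ∀ {A : Set} → (A → A) → ℕ → A → A
  iterate σ zero    x = x
  iterate σ (suc n) x = σ (iterate σ n x)

  iterate-+ : ∀ {A : Set} (σ : A → A) m n x → iterate σ (m + n) x ≡ iterate σ m (iterate σ n x)
  iterate-+ σ zero    n x = refl
  iterate-+ σ (suc m) n x = cong σ (iterate-+ σ m n x)

  -- The first W preimages of P under the powers of σ are disjoint.
  sparse-bound : ∀ {m} (σ σ⁻¹ : Fin m → Fin m) → (∀ x → σ (σ⁻¹ x) ≡ x) → (∀ x → σ⁻¹ (σ x) ≡ x) →
    ∀ W (P : Fin m → Bool) →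
    (∀ y → P y ≡ true → ∀ n → 0 < n → n < W → P (iterate σ n y) ≡ true → ⊥) →
    W * count P ≤ m
  sparse-bound {m} σ σ⁻¹ r l W P sparse = begin
    W * count P ≡⟨ sum-const W (count P) ⟨
    sum {W} (λ _ → count P) ≡⟨ sum-cong-≗ {W} (λ k → sym (shifted (toℕ k))) ⟩
    sum {W} (λ k → sum (λ x → ind (P (iterate σ (toℕ k) x)))) ≡⟨ ∑-comm {W} (λ k x → ind (P (iterate σ (toℕ k) x))) ⟩
    sum (λ x → sum {W} (λ k → ind (P (iterate σ (toℕ k) x)))) ≤⟨ sum-mono (λ x → count-unique (λ k → P (iterate σ (toℕ k) x)) (once x)) ⟩
    sum {m} (λ _ → 1) ≡⟨ sum-const m 1 ⟩
    m * 1 ≡⟨ ℕₚ.*-identityʳ m ⟩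
    m ∎
    where
    open ℕₚ.≤-Reasoning
    shifted : ∀ n → sum (λ x → ind (P (iterate σ n x))) ≡ count P
    shifted zero    = refl
    shifted (suc n) = trans (sum-cong-≗ (λ x → cong (ind ∘ P) (comm n x))) (trans (sum-bijection (λ x → ind (P (iterate σ n x))) σ σ⁻¹ r l) (shifted n))
      where
      comm : ∀ n x → σ (iterate σ n x) ≡ iterate σ n (σ x)
      comm zero    x = refl
      comm (suc n) x = cong σ (comm n x)
    once : ∀ x (i j : Fin W) → P (iterate σ (toℕ i) x) ≡ true → P (iterate σ (toℕ j) x) ≡ true → toℕ i < toℕ j → ⊥
    once x i j p q i<j = sparse (iterate σ (toℕ i) x) p (toℕ j ℕ.∸ toℕ i) (ℕₚ.m<n⇒0<n∸m i<j)
      (ℕₚ.≤-<-trans (ℕₚ.m∸n≤m (toℕ j) (toℕ i)) (Finₚ.toℕ<n j))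
      (subst (λ z → P z ≡ true) (trans (cong (λ n → iterate σ n x) (sym (ℕₚ.m∸n+n≡m (ℕₚ.<⇒≤ i<j)))) (iterate-+ σ (toℕ j ℕ.∸ toℕ i) (toℕ i) x)) q)

  sparse-run : ∀ S w W (P : System.Flag S → Bool) →
    (∀ y → P y ≡ true → ∀ n → 0 < n → n < W → P (iterate (System.run S w) n y) ≡ true → ⊥) →
    W * count P ≤ System.nf S
  sparse-run S w = sparse-bound (System.run S w) (System.run S (inverse w)) (run-inverseʳ S w) (run-inverseˡ S w)

  -- Coincidences of a patch with a turned copy of itself

  iterate-tr : ∀ n v → ◇ (λ S x → iterate (System.run S (tr v)) n x ≡ at S x (+ n ⊙ v))
  iterate-tr zero    v = always λ S x → refl
  iterate-tr (suc n) v = ◇-map₂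
    (λ S x ih e → trans (cong (System.run S (tr v)) ih) e)
    (iterate-tr n v) (at-cancel (+ n ⊙ v) (+ suc n ⊙ v) v (eq v))
    where
    eq : ∀ v → (+ n ⊙ v) ⊕ v ≡ + suc n ⊙ v
    eq (i , j) = trans (⊕-comm (+ n ⊙ (i , j)) (i , j)) (vec≡ (sym (ℤₚ.suc-* (+ n) i)) (sym (ℤₚ.suc-* (+ n) j)))

  -- This is how a patch meets a turned copy of itself: two cells with difference `d` lie at the
  -- same vertex, and their flags differ by `alt k`.
  Turned : ℕ → Vec → Property
  Turned k d S x = at S x d ≡ System.run S (alt k) x

  -- Go along `q` and then `d`, or along `d` and then `q`. The second route walks in the turned
  -- frame, where `q` becomes `unrotate k q`; cancelling `alt k` leaves a period.
  turned-pair : ∀ k d q → ◇ (λ S x → Turned k d S x → Turned k d S (at S x q) → Per (q ⊖ unrotate k q) S x)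
  turned-pair k d q = ◇-map₂ derive
    (◇-map₃ (λ S x e f g → e , f , g) (at-⊕ q d) (at-cancel d (q ⊕ d) q (⊕-comm d q)) (at-alt k q))
    (at≡⇒per q (unrotate k q))
    where
    derive : ∀ S x → at S (at S x q) d ≡ at S x (q ⊕ d)
      × at S (at S x d) q ≡ at S x (q ⊕ d)
      × at S (System.run S (alt k) x) q ≡ System.run S (alt k) (at S x (unrotate k q)) →
      (at S x q ≡ at S x (unrotate k q) → Per (q ⊖ unrotate k q) S x) →
      Turned k d S x → Turned k d S (at S x q) → Per (q ⊖ unrotate k q) S x
    derive S x (e , f , g) toPer h h′ = toPer (run-injective S (alt k)
      (trans (sym h′) (trans e (trans (sym f) (trans (cong (λ z → at S z q) h) g)))))

  reflect-⊙ : ∀ m g p → reflect g (m ⊙ p) ≡ m ⊙ reflect g p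
  reflect-⊙ m g₀ p       = refl
  reflect-⊙ m g₁ p       = refl
  reflect-⊙ m g₂ (i , j) = vec≡ (sym (ℤₚ.*-distribˡ-+ m i j)) (ℤₚ.neg-distribʳ-* m j)

  unrotate-⊙ : ∀ k m p → unrotate k (m ⊙ p) ≡ m ⊙ unrotate k p
  unrotate-⊙ zero    m p = refl
  unrotate-⊙ (suc k) m p = trans (cong (unrotate k) (reflect-⊙ m (letter k) p)) (unrotate-⊙ k m (reflect (letter k) p))

  displacement : ℕ → Vec → Vec
  displacement k v = v ⊖ unrotate k v

  displacement-⊙ : ∀ k m v → (m ⊙ v) ⊖ unrotate k (m ⊙ v) ≡ m ⊙ displacement k v
  displacement-⊙ k m v = trans (cong ((m ⊙ v) ⊖_) (unrotate-⊙ k m v)) (eq v (unrotate k v))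
    where
    ring : ∀ m i k → m ℤ.* i ℤ.- m ℤ.* k ≡ m ℤ.* (i ℤ.- k)
    ring = solve-∀
    eq : ∀ p q → (m ⊙ p) ⊖ (m ⊙ q) ≡ m ⊙ (p ⊖ q)
    eq (i , j) (k , l) = vec≡ (ring m i k) (ring m j l)

  det-⊙ : ∀ m n p q → det (m ⊙ p) (n ⊙ q) ≡ (m ℤ.* n) ℤ.* det p q
  det-⊙ m n (i , j) (k , l) = ring m n i j k l
    where
    ring : ∀ m n i j k l → (m ℤ.* i) ℤ.* (n ℤ.* l) ℤ.- (m ℤ.* j) ℤ.* (n ℤ.* k) ≡ (m ℤ.* n) ℤ.* (i ℤ.* l ℤ.- j ℤ.* k)
    ring = solve-∀

  nonzero-* : ∀ i j → i ≢ + 0 → j ≢ + 0 → i ℤ.* j ≢ + 0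
  nonzero-* i j p q e with ℤₚ.i*j≡0⇒i≡0∨j≡0 i e
  ... | inj₁ z = p z
  ... | inj₂ z = q z

  turned-iterate : ∀ k d v n → ◇ (λ S x → Turned k d S x →
    Turned k d S (iterate (System.run S (tr v)) n x) → Per (+ n ⊙ displacement k v) S x)
  turned-iterate k d v n = ◇-map₃
    (λ S x e f g h h′ → g (f h (subst (Turned k d S) e h′)))
    (iterate-tr n v) (turned-pair k d (+ n ⊙ v)) (per-cong (displacement-⊙ k (+ n) v))

  -- Rotations move every vector, so two of their returns give independent periods.
  rotation-returns : ∀ k d → det (displacement k e₁) (displacement k e₂) ≢ + 0 → ∀ m n →
    ◇ (λ S x → Turned k d S x → Turned k d S (iterate (System.run S (tr e₁)) (suc m) x) →
               Turned k d S (iterate (System.run S (tr e₂)) (suc n) x) → ⊥)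
  rotation-returns k d nz m n = ◇-map₃ (λ S x f g contra h h₁ h₂ → contra (f h h₁) (g h h₂))
    (turned-iterate k d e₁ (suc m)) (turned-iterate k d e₂ (suc n))
    (no-independent-periods (+ suc m ⊙ displacement k e₁) (+ suc n ⊙ displacement k e₂)
      λ e → nonzero-* (+ suc m ℤ.* + suc n) _ (λ ()) nz (trans (sym (det-⊙ (+ suc m) (+ suc n) (displacement k e₁) (displacement k e₂))) e))

  -- A reflection with glide d: either the glide is nonzero, and its square is a period independent of
  -- the displacement of v, or some flag would be fixed.
  record Glide (k : ℕ) : Set where
    field
      palindrome : inverse (alt k) ≡ alt k
      v          : Vec
      glide      : Vec → ℤ
      scale      : ℤ
      scale≢0    : scale ≢ + 0
      image      : Vec → Vec
      rotate≡    : ∀ p → rotate k p ≡ image p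
      det-glide  : ∀ d → det (d ⊕ image d) (displacement k v) ≡ scale ℤ.* glide d
      mirror     : ∀ d → glide d ≡ + 0 → ∃ λ q → d ⊕ image q ≡ q

  module _ {k : ℕ} (G : Glide k) (0<k : 0 < k) (k<12 : k < 12) where
    open Glide G

    -- A glide reflection composed with itself is a translation; `palindrome` makes `alt k` its own
    -- inverse.
    glide-square : ∀ d → ◇ (λ S x → Turned k d S x → Per (d ⊕ rotate k d) S x)
    glide-square d = ◇-map₂
      (λ S x e f h → trans (sym f) (trans (cong (λ z → at S z (rotate k d)) h) (trans (sym e)
        (trans (cong (System.run S (alt k)) h) (subst (λ w → System.run S (alt k) (System.run S w x) ≡ x) palindrome (run-inverseʳ S (alt k) x))))))
      (alt-at k d) (at-⊕ d (rotate k d))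

    -- Such a `q` leads to the mirror: the flag there would be fixed by `alt k`, which `good-free`
    -- forbids.
    no-mirror : ∀ d q → d ⊕ rotate k q ≡ q → ◇ (λ S x → Turned k d S x → ⊥)
    no-mirror d q eq = ◇-map₃
      (λ S x e f g h → System.good-free S (at S x q) g k 0<k k<12
         (trans e (trans (cong (λ z → at S z (rotate k q)) (sym h)) f)))
      (alt-at k q) (at-cancel d q (rotate k q) eq) (◇-run (tr q) ◇-good)

    reflection-returns : ∀ d n → ◇ (λ S x → Turned k d S x → Turned k d S (iterate (System.run S (tr v)) (suc n) x) → ⊥)
    reflection-returns d n with glide d ℤₚ.≟ + 0
    ... | yes z = let (q , eq) = mirror d z in ◇-map (λ S x f h _ → f h) (no-mirror d q (trans (cong (d ⊕_) (rotate≡ q)) eq))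
    ... | no nz = ◇-map₃ (λ S x f g contra h h′ → contra (f h) (g h h′))
      (glide-square d) (turned-iterate k d v (suc n))
      (no-independent-periods (d ⊕ rotate k d) (+ suc n ⊙ displacement k v)
        λ e → nonzero-* (+ suc n) _ (λ ()) (nonzero-* scale (glide d) scale≢0 nz) (trans (sym (trans (scaled (d ⊕ rotate k d) (displacement k v)) (cong (+ suc n ℤ.*_) (trans (cong (λ r → det (d ⊕ r) (displacement k v)) (rotate≡ d)) (det-glide d))))) e))
      where
      scaled : ∀ p q → det p (+ suc n ⊙ q) ≡ + suc n ℤ.* det p q
      scaled (i , j) (k , l) = ring (+ suc n) i j k l
        where
        ring : ∀ m i j k l → i ℤ.* (m ℤ.* l) ℤ.- j ℤ.* (m ℤ.* k) ≡ m ℤ.* (i ℤ.* l ℤ.- j ℤ.* k)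
        ring = solve-∀

  -- Serves the field `mirror`: each required equation is a polynomial identity up to a multiple of
  -- the glide `ℓ`, and in that form the ring solver can prove it.
  vanish : ∀ {x y} c ℓ → x ≡ y ℤ.+ c ℤ.* ℓ → ℓ ≡ + 0 → x ≡ y
  vanish {y = y} c ℓ e refl = trans e (trans (cong (λ z → y ℤ.+ z) (ℤₚ.*-zeroʳ c)) (ℤₚ.+-identityʳ y))

  turn₂ : Vec → Vec
  turn₂ p = reflect g₁ (reflect g₂ p)

  -- Unfolding `rotate k` piles up sums and negations. Normalising after every two letters keeps the
  -- formulas in `image` small.
  rotate₅ : ∀ ((i , j) : Vec) → rotate 5 (i , j) ≡ (ℤ.- (j ℤ.+ i) , j)
  rotate₅ (i , j) = vec≡ refl (ring i j)
    where
    ring : ∀ i j → ℤ.- i ℤ.+ (j ℤ.+ i) ≡ j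
    ring = solve-∀

  rotate₇ : ∀ ((i , j) : Vec) → rotate 7 (i , j) ≡ (ℤ.- j , ℤ.- i)
  rotate₇ (i , j) = trans (cong turn₂ (rotate₅ (i , j))) (vec≡ refl (ring i j))
    where
    ring : ∀ i j → ℤ.- (j ℤ.+ i) ℤ.+ j ≡ ℤ.- i
    ring = solve-∀

  rotate₉ : ∀ ((i , j) : Vec) → rotate 9 (i , j) ≡ (i , ℤ.- j ℤ.+ ℤ.- i)
  rotate₉ (i , j) = trans (cong turn₂ (rotate₇ (i , j))) (vec≡ (ℤₚ.neg-involutive i) refl)

  rotate₁₁ : ∀ ((i , j) : Vec) → rotate 11 (i , j) ≡ (j ℤ.+ i , ℤ.- j)
  rotate₁₁ (i , j) = trans (cong turn₂ (rotate₉ (i , j))) (vec≡ (ring₁ i j) (ring₂ i j))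
    where
    ring₁ : ∀ i j → ℤ.- (ℤ.- j ℤ.+ ℤ.- i) ≡ j ℤ.+ i
    ring₁ = solve-∀
    ring₂ : ∀ i j → i ℤ.+ (ℤ.- j ℤ.+ ℤ.- i) ≡ ℤ.- j
    ring₂ = solve-∀

  glide₁ : Glide 1
  glide₁ = record
    { palindrome = refl
    ; v          = e₁
    ; glide      = λ (i , j) → i ℤ.+ j
    ; scale      = -[1+ 1 ]
    ; scale≢0    = λ ()
    ; image      = λ (i , j) → j , i
    ; rotate≡    = λ _ → refl
    ; det-glide  = λ (i , j) → det-ring i j
    ; mirror     = λ (i , j) e → (i , + 0) ,
        vec≡ (vanish (+ 0) (i ℤ.+ j) (ring₁ i j) e) (vanish (+ 1) (i ℤ.+ j) (ring₂ i j) e) }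
    where
    det-ring : ∀ i j → (i ℤ.+ j) ℤ.* -[1+ 0 ] ℤ.- (j ℤ.+ i) ℤ.* + 1 ≡ -[1+ 1 ] ℤ.* (i ℤ.+ j)
    det-ring = solve-∀
    ring₁ : ∀ i j → i ℤ.+ ((+ 0)) ≡ i ℤ.+ + 0 ℤ.* (i ℤ.+ j)
    ring₁ = solve-∀
    ring₂ : ∀ i j → j ℤ.+ i ≡ + 0 ℤ.+ + 1 ℤ.* (i ℤ.+ j)
    ring₂ = solve-∀

  glide₃ : Glide 3
  glide₃ = record
    { palindrome = refl
    ; v          = e₁
    ; glide      = λ (i , j) → i ℤ.+ + 2 ℤ.* j
    ; scale      = -[1+ 1 ]
    ; scale≢0    = λ ()
    ; image      = λ (i , j) → ℤ.- i , j ℤ.+ i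
    ; rotate≡    = λ _ → refl
    ; det-glide  = λ (i , j) → det-ring i j
    ; mirror     = λ (i , j) e → (ℤ.- j , + 0) ,
        vec≡ (vanish (+ 1) (i ℤ.+ + 2 ℤ.* j) (ring₁ i j) e) (vanish (+ 0) (i ℤ.+ + 2 ℤ.* j) (ring₂ i j) e) }
    where
    det-ring : ∀ i j → (i ℤ.+ (ℤ.- i)) ℤ.* -[1+ 0 ] ℤ.- (j ℤ.+ (j ℤ.+ i)) ℤ.* + 2 ≡ -[1+ 1 ] ℤ.* (i ℤ.+ + 2 ℤ.* j)
    det-ring = solve-∀
    ring₁ : ∀ i j → i ℤ.+ (ℤ.- (ℤ.- j)) ≡ ℤ.- j ℤ.+ + 1 ℤ.* (i ℤ.+ + 2 ℤ.* j)
    ring₁ = solve-∀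
    ring₂ : ∀ i j → j ℤ.+ ((+ 0) ℤ.+ (ℤ.- j)) ≡ + 0 ℤ.+ + 0 ℤ.* (i ℤ.+ + 2 ℤ.* j)
    ring₂ = solve-∀

  glide₅ : Glide 5
  glide₅ = record
    { palindrome = refl
    ; v          = e₁
    ; glide      = λ (i , j) → j
    ; scale      = -[1+ 3 ]
    ; scale≢0    = λ ()
    ; image      = λ (i , j) → ℤ.- (j ℤ.+ i) , j
    ; rotate≡    = rotate₅
    ; det-glide  = λ (i , j) → det-ring i j
    ; mirror     = λ (i , j) e → (+ 0 , i) ,
        vec≡ (vanish (+ 0) (j) (ring₁ i j) e) (vanish (+ 1) (j) (ring₂ i j) e) }
    where
    det-ring : ∀ i j → (i ℤ.+ (ℤ.- (j ℤ.+ i))) ℤ.* + 0 ℤ.- (j ℤ.+ j) ℤ.* + 2 ≡ -[1+ 3 ] ℤ.* (j)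
    det-ring = solve-∀
    ring₁ : ∀ i j → i ℤ.+ (ℤ.- (i ℤ.+ (+ 0))) ≡ + 0 ℤ.+ + 0 ℤ.* (j)
    ring₁ = solve-∀
    ring₂ : ∀ i j → j ℤ.+ i ≡ i ℤ.+ + 1 ℤ.* (j)
    ring₂ = solve-∀

  glide₇ : Glide 7
  glide₇ = record
    { palindrome = refl
    ; v          = e₁
    ; glide      = λ (i , j) → i ℤ.- j
    ; scale      = + 2
    ; scale≢0    = λ ()
    ; image      = λ (i , j) → ℤ.- j , ℤ.- i
    ; rotate≡    = rotate₇
    ; det-glide  = λ (i , j) → det-ring i j
    ; mirror     = λ (i , j) e → (i , + 0) ,
        vec≡ (vanish (+ 0) (i ℤ.- j) (ring₁ i j) e) (vanish (-[1+ 0 ]) (i ℤ.- j) (ring₂ i j) e) }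
    where
    det-ring : ∀ i j → (i ℤ.+ (ℤ.- j)) ℤ.* + 1 ℤ.- (j ℤ.+ (ℤ.- i)) ℤ.* + 1 ≡ + 2 ℤ.* (i ℤ.- j)
    det-ring = solve-∀
    ring₁ : ∀ i j → i ℤ.+ (ℤ.- (+ 0)) ≡ i ℤ.+ + 0 ℤ.* (i ℤ.- j)
    ring₁ = solve-∀
    ring₂ : ∀ i j → j ℤ.+ (ℤ.- i) ≡ + 0 ℤ.+ -[1+ 0 ] ℤ.* (i ℤ.- j)
    ring₂ = solve-∀

  glide₉ : Glide 9
  glide₉ = record
    { palindrome = refl
    ; v          = e₁
    ; glide      = λ (i , j) → i
    ; scale      = + 2
    ; scale≢0    = λ ()
    ; image      = λ (i , j) → i , ℤ.- j ℤ.+ ℤ.- i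
    ; rotate≡    = rotate₉
    ; det-glide  = λ (i , j) → det-ring i j
    ; mirror     = λ (i , j) e → (j , + 0) ,
        vec≡ (vanish (+ 1) (i) (ring₁ i j) e) (vanish (+ 0) (i) (ring₂ i j) e) }
    where
    det-ring : ∀ i j → (i ℤ.+ i) ℤ.* + 1 ℤ.- (j ℤ.+ (ℤ.- j ℤ.+ ℤ.- i)) ℤ.* + 0 ≡ + 2 ℤ.* (i)
    det-ring = solve-∀
    ring₁ : ∀ i j → i ℤ.+ j ≡ j ℤ.+ + 1 ℤ.* (i)
    ring₁ = solve-∀
    ring₂ : ∀ i j → j ℤ.+ (ℤ.- (+ 0) ℤ.+ ℤ.- j) ≡ + 0 ℤ.+ + 0 ℤ.* (i)
    ring₂ = solve-∀

  glide₁₁ : Glide 11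
  glide₁₁ = record
    { palindrome = refl
    -- This reflection fixes `e₁`, whose displacement would vanish.
    ; v          = e₂
    ; glide      = λ (i , j) → + 2 ℤ.* i ℤ.+ j
    ; scale      = + 2
    ; scale≢0    = λ ()
    ; image      = λ (i , j) → j ℤ.+ i , ℤ.- j
    ; rotate≡    = rotate₁₁
    ; det-glide  = λ (i , j) → det-ring i j
    ; mirror     = λ (i , j) e → (+ 0 , ℤ.- i) ,
        vec≡ (vanish (+ 0) (+ 2 ℤ.* i ℤ.+ j) (ring₁ i j) e) (vanish (+ 1) (+ 2 ℤ.* i ℤ.+ j) (ring₂ i j) e) }
    where
    det-ring : ∀ i j → (i ℤ.+ (j ℤ.+ i)) ℤ.* + 2 ℤ.- (j ℤ.+ (ℤ.- j)) ℤ.* -[1+ 0 ] ≡ + 2 ℤ.* (+ 2 ℤ.* i ℤ.+ j)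
    det-ring = solve-∀
    ring₁ : ∀ i j → i ℤ.+ ((ℤ.- i) ℤ.+ (+ 0)) ≡ + 0 ℤ.+ + 0 ℤ.* (+ 2 ℤ.* i ℤ.+ j)
    ring₁ = solve-∀
    ring₂ : ∀ i j → j ℤ.+ (ℤ.- (ℤ.- i)) ≡ ℤ.- i ℤ.+ + 1 ℤ.* (+ 2 ℤ.* i ℤ.+ j)
    ring₂ = solve-∀

  turnedᵇ : ℕ → Vec → (S : System) → System.Flag S → Bool
  turnedᵇ k d S x = isYes (at S x d Finₚ.≟ System.run S (alt k) x)

  isYes⇒ : ∀ {A : Set} (a? : Dec A) → isYes a? ≡ true → A
  isYes⇒ (yes a) _ = a

  isYes⇐ : ∀ {A : Set} (a? : Dec A) → A → isYes a? ≡ true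
  isYes⇐ (yes a) _ = refl
  isYes⇐ (no ¬a) a = ⊥-elim (¬a a)

  ∧-true : ∀ {b c} → b ∧ c ≡ true → b ≡ true × c ≡ true
  ∧-true {true} {true} _ = refl , refl

  SparseTurns : ℕ → Vec → ℕ → Set
  SparseTurns k d W = ∃ λ K → ∀ S → K < System.nf S →
    W * count (λ y → System.deep S K y ∧ turnedᵇ k d S y) ≤ 2 * System.nf S

  deep-turned : ∀ k d S K y → System.deep S K y ∧ turnedᵇ k d S y ≡ true → System.Deep S K y × Turned k d S y
  deep-turned k d S K y h = let (p , q) = ∧-true h in p , isYes⇒ (_ Finₚ.≟ _) q

  module SparseFromReturns (k : ℕ) (d : Vec) (W : ℕ) (S : System) (K : ℕ) where
    open System S
    open ℕₚ.≤-Reasoning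

    Y : Flag → Bool
    Y y = deep K y ∧ turnedᵇ k d S y

    advance : Vec → ℕ → Flag → Flag
    advance v = iterate (run (tr v))

    single : ∀ v → (∀ y → Deep K y → ∀ (n : Fin W) → Turned k d S y → Turned k d S (advance v (suc (toℕ n)) y) → ⊥) →
             W * count Y ≤ 2 * nf
    single v noReturn = ℕₚ.≤-trans (sparse-run S (tr v) W Y sparse) (ℕₚ.m≤n*m nf 2)
      where
      sparse : ∀ y → Y y ≡ true → ∀ n → 0 < n → n < W → Y (advance v n y) ≡ true → ⊥
      sparse y p (suc n) _ n<W q =
        noReturn y (proj₁ (deep-turned k d S K y p)) (Fin.fromℕ< n<W′) (proj₂ (deep-turned k d S K y p))
          (subst (λ m → Turned k d S (advance v (suc m) y)) (sym (Finₚ.toℕ-fromℕ< n<W′)) (proj₂ (deep-turned k d S K _ q)))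
        where n<W′ = ℕₚ.<-trans (ℕₚ.n<1+n n) n<W

    returning? : ∀ v y → Dec (∃ λ (n : Fin W) → Y (advance v (suc (toℕ n)) y) ≡ true)
    returning? v y = Finₚ.any? λ n → Y (advance v (suc (toℕ n)) y) Boolₚ.≟ true

    lone : Vec → Flag → Bool
    lone v y = Y y ∧ not (isYes (returning? v y))

    few : ∀ v → W * count (lone v) ≤ nf
    few v = sparse-run S (tr v) W (lone v) sparse
      where
      sparse : ∀ y → lone v y ≡ true → ∀ n → 0 < n → n < W → lone v (advance v n y) ≡ true → ⊥
      sparse y p (suc n) _ n<W q with returning? v y | proj₂ (∧-true {Y y} p)
      ... | no ¬r | _ = ¬r (Fin.fromℕ< n<W′ ,
        subst (λ m → Y (advance v (suc m) y) ≡ true) (sym (Finₚ.toℕ-fromℕ< n<W′)) (proj₁ (∧-true q)))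
        where n<W′ = ℕₚ.<-trans (ℕₚ.n<1+n n) n<W

    -- Only a return along `e₁` together with one along `e₂` is contradictory. So every flag of `Y`
    -- lacks a return along one of the two, and each of the two resulting sets is sparse; hence the
    -- factor 2.
    double : (∀ y → Deep K y → ∀ (m n : Fin W) → Turned k d S y → Turned k d S (advance e₁ (suc (toℕ m)) y) →
               Turned k d S (advance e₂ (suc (toℕ n)) y) → ⊥) →
             W * count Y ≤ 2 * nf
    double noReturn = begin
      W * count Y ≤⟨ ℕₚ.*-monoʳ-≤ W (sum-mono split) ⟩
      W * sum (λ y → ind (lone e₁ y) + ind (lone e₂ y)) ≡⟨ cong (W *_) (∑-distrib-+ (ind ∘ lone e₁) (ind ∘ lone e₂)) ⟩
      W * (count (lone e₁) + count (lone e₂)) ≡⟨ ℕₚ.*-distribˡ-+ W (count (lone e₁)) _ ⟩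
      W * count (lone e₁) + W * count (lone e₂) ≤⟨ ℕₚ.+-mono-≤ (few e₁) (few e₂) ⟩
      nf + nf ≡⟨ cong (ℕ._+_ nf) (ℕₚ.+-identityʳ nf) ⟨
      2 * nf ∎
      where
      cases : ∀ y b → Y y ≡ b → (r₁ : Dec (∃ λ (n : Fin W) → Y (advance e₁ (suc (toℕ n)) y) ≡ true)) (r₂ : Dec (∃ λ (n : Fin W) → Y (advance e₂ (suc (toℕ n)) y) ≡ true)) →
              ind b ≤ ind (b ∧ not (isYes r₁)) + ind (b ∧ not (isYes r₂))
      cases y false _ _ _ = z≤n
      cases y true ey (no _)        _             = s≤s z≤n
      cases y true ey (yes _)       (no _)        = s≤s z≤n
      cases y true ey (yes (m , p)) (yes (n , q)) =
        let (dp , tp) = deep-turned k d S K y ey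
        in ⊥-elim (noReturn y dp m n tp (proj₂ (deep-turned k d S K _ p)) (proj₂ (deep-turned k d S K _ q)))
      split : ∀ y → ind (Y y) ≤ ind (lone e₁ y) + ind (lone e₂ y)
      split y = cases y (Y y) refl (returning? e₁ y) (returning? e₂ y)

  sparse-reflection : ∀ {k} → Glide k → 0 < k → k < 12 → ∀ d W → SparseTurns k d W
  sparse-reflection {k} G 0<k k<12 d W = conclude (◇-∀ W λ n → reflection-returns G 0<k k<12 d (toℕ n))
    where
    conclude : ◇ (λ S x → ∀ (n : Fin W) → Turned k d S x → Turned k d S (iterate (System.run S (tr (Glide.v G))) (suc (toℕ n)) x) → ⊥) →
               SparseTurns k d W
    conclude (K , h) = K , λ S large → SparseFromReturns.single k d W S K (Glide.v G) (h S large)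

  sparse-rotation : ∀ k → det (displacement k e₁) (displacement k e₂) ≢ + 0 → ∀ d W → SparseTurns k d W
  sparse-rotation k nz d W = conclude (◇-∀ W λ m → ◇-∀ W λ n → rotation-returns k d nz (toℕ m) (toℕ n))
    where
    conclude : ◇ (λ S x → ∀ (m n : Fin W) → Turned k d S x →
                 Turned k d S (iterate (System.run S (tr e₁)) (suc (toℕ m)) x) →
                 Turned k d S (iterate (System.run S (tr e₂)) (suc (toℕ n)) x) → ⊥) → SparseTurns k d W
    conclude (K , h) = K , λ S large → SparseFromReturns.double k d W S K (h S large)

  sparse-turns : ∀ (k : Fin 11) d W → SparseTurns (suc (toℕ k)) d W
  sparse-turns 0F = sparse-reflection glide₁ (s≤s z≤n) (ℕₚ.<ᵇ⇒< 1 12 tt)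
  sparse-turns 1F = sparse-rotation 2 λ ()
  sparse-turns 2F = sparse-reflection glide₃ (s≤s z≤n) (ℕₚ.<ᵇ⇒< 3 12 tt)
  sparse-turns 3F = sparse-rotation 4 λ ()
  sparse-turns 4F = sparse-reflection glide₅ (s≤s z≤n) (ℕₚ.<ᵇ⇒< 5 12 tt)
  sparse-turns 5F = sparse-rotation 6 λ ()
  sparse-turns 6F = sparse-reflection glide₇ (s≤s z≤n) (ℕₚ.<ᵇ⇒< 7 12 tt)
  sparse-turns 7F = sparse-rotation 8 λ ()
  sparse-turns 8F = sparse-reflection glide₉ (s≤s z≤n) (ℕₚ.<ᵇ⇒< 9 12 tt)
  sparse-turns 9F = sparse-rotation 10 λ ()
  sparse-turns (suc 9F) = sparse-reflection glide₁₁ (s≤s z≤n) (ℕₚ.<ᵇ⇒< 11 12 tt)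

  -- Periodic dominating patterns on tubes, checked by computation

  anyᵇ : ∀ {A : Set} → (A → Bool) → List A → Bool
  anyᵇ P []       = false
  anyᵇ P (x ∷ xs) = P x ∨ anyᵇ P xs

  allBelow : ℕ → (ℕ → Bool) → Bool
  allBelow zero    P = true
  allBelow (suc n) P = P n ∧ allBelow n P

  -- A set of cells in a strip of the lattice, periodic in the first coordinate with period suc N′;
  -- the y-th list holds the first coordinates in row y. `wraps` says whether the top and bottom
  -- rows of the strip rely on the identification of the two sides.
  record Pattern : Set where
    constructor mkPattern
    field
      N′    : ℕ
      wraps : Bool
      rows  : List (List ℕ)

  row : List (List ℕ) → ℕ → List ℕ
  row []       n       = []
  row (r ∷ rs) zero    = r
  row (r ∷ rs) (suc n) = row rs n

  shifts : Bool → List ℤ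
  shifts false = + 0 ∷ []
  shifts true  = + 0 ∷ + 1 ∷ -[1+ 0 ] ∷ []

  module _ (P : Pattern) (i : ℤ) (j : ℕ) where
    open Pattern P

    inRow : ℤ → ℤ → Bool
    inRow -[1+ _ ] a = false
    inRow (+ n)    a = (n <ᵇ j) ∧ anyᵇ (λ r → (a ℤDM.%ℕ suc N′) ≡ᵇ r) (row rows n)

    -- cell (x , y) is a neighbour, in direction m, of a pattern cell, after k translations by (i , j)
    hit : ℕ → ℕ → Fin 7 → ℤ → Bool
    hit x y m k = inRow (+ y ℤ.- proj₂ (step₇ m) ℤ.- k ℤ.* + j) (+ x ℤ.- proj₁ (step₇ m) ℤ.- k ℤ.* i)

    covers : Bool
    covers = allBelow (suc N′) λ x → allBelow j λ y → anyᵇ (λ m → anyᵇ (hit x y m) (shifts wraps)) (allFin 7)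

    block : List (ℕ × ℕ)
    block = concatMap (λ y → map (_, y) (row rows y)) (upTo j)

    sparse : Bool
    sparse = (6 * length block) ≤ᵇ (suc N′ * j)

    valid : Bool
    valid = sparse ∧ covers

  -- The hexagon of radius 2. Its nonzero vectors are the differences of two distinct unit vectors,
  -- that is, the periods excluded by `no-short-period`.
  short : ℤ → ℕ → Bool
  short i j = (ℤ.∣ i ∣ ≤ᵇ 2) ∧ ((j ≤ᵇ 2) ∧ (ℤ.∣ i ℤ.+ + j ∣ ≤ᵇ 2))

  -- Alternate cells of every third row dominate three rows.
  thirds : Pattern
  thirds = mkPattern 1 false (map (λ y → if (y % 3) ≡ᵇ 1 then 0 ∷ [] else []) (upTo 9))

  -- The perfect code x + 3y ≡ 0 (mod 7), with one extra cell in the first and in the last row.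
  code : ℕ → Pattern
  code j = mkPattern 6 false (map cells (upTo j))
    where
    cells : ℕ → List ℕ
    cells y = ((4 * y) % 7) ∷ (if y ≡ᵇ 0 then 3 ∷ [] else (if suc y ≡ᵇ j then ((4 * j) % 7) ∷ [] else []))

  -- The entries were found by a computer search.
  narrow : ℕ → ℤ → Pattern
  narrow 2 (+ 1) = mkPattern 2 true ([] ∷ (0 ∷ []) ∷ [])
  narrow 2 i = mkPattern 11 true ((7 ∷ 9 ∷ []) ∷ (2 ∷ 4 ∷ []) ∷ [])
  narrow 4 i =
    if (i ℤDM.%ℕ 3) ≡ᵇ 0 then mkPattern 2 true ((0 ∷ []) ∷ [] ∷ (0 ∷ []) ∷ [] ∷ []) else
    (if (i ℤDM.%ℕ 3) ≡ᵇ 1 then mkPattern 2 true ([] ∷ (1 ∷ []) ∷ [] ∷ (2 ∷ []) ∷ []) else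
    (mkPattern 2 true ((1 ∷ []) ∷ [] ∷ (2 ∷ []) ∷ [] ∷ [])))
  narrow 5 i =
    if (i ℤDM.%ℕ 5) ≡ᵇ 0 then mkPattern 4 true ([] ∷ (2 ∷ 4 ∷ []) ∷ [] ∷ (4 ∷ []) ∷ (1 ∷ []) ∷ []) else
    (if (i ℤDM.%ℕ 5) ≡ᵇ 1 then mkPattern 4 true ([] ∷ (4 ∷ []) ∷ (1 ∷ []) ∷ [] ∷ (2 ∷ 4 ∷ []) ∷ []) else
    (if (i ℤDM.%ℕ 5) ≡ᵇ 4 then mkPattern 4 true ((0 ∷ []) ∷ (2 ∷ []) ∷ [] ∷ (2 ∷ 4 ∷ []) ∷ [] ∷ []) else
    (if (i ℤDM.%ℕ 6) ≡ᵇ 2 then mkPattern 5 true ((0 ∷ []) ∷ (2 ∷ []) ∷ (3 ∷ []) ∷ (5 ∷ []) ∷ (1 ∷ []) ∷ []) else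
    (if (i ℤDM.%ℕ 6) ≡ᵇ 3 then mkPattern 5 true ((5 ∷ []) ∷ (1 ∷ []) ∷ (3 ∷ []) ∷ (4 ∷ []) ∷ (0 ∷ []) ∷ []) else
    (mkPattern 5 true ((4 ∷ []) ∷ (2 ∷ []) ∷ (5 ∷ []) ∷ (2 ∷ []) ∷ (5 ∷ []) ∷ []))))))
  narrow 7 i =
    if (i ℤDM.%ℕ 6) ≡ᵇ 0 then mkPattern 5 true ((5 ∷ []) ∷ (3 ∷ []) ∷ (0 ∷ []) ∷ (4 ∷ []) ∷ (1 ∷ []) ∷ (5 ∷ []) ∷ (2 ∷ []) ∷ []) else
    (if (i ℤDM.%ℕ 6) ≡ᵇ 1 then mkPattern 5 true ((4 ∷ []) ∷ (0 ∷ []) ∷ (1 ∷ []) ∷ (3 ∷ []) ∷ (5 ∷ []) ∷ (1 ∷ []) ∷ (3 ∷ []) ∷ []) else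
    (if (i ℤDM.%ℕ 6) ≡ᵇ 2 then mkPattern 5 true ((4 ∷ []) ∷ (0 ∷ []) ∷ (2 ∷ []) ∷ (4 ∷ []) ∷ (0 ∷ []) ∷ (2 ∷ []) ∷ (4 ∷ []) ∷ []) else
    (if (i ℤDM.%ℕ 6) ≡ᵇ 3 then mkPattern 5 true ((4 ∷ []) ∷ (1 ∷ []) ∷ (4 ∷ []) ∷ (1 ∷ []) ∷ (4 ∷ []) ∷ (1 ∷ []) ∷ (4 ∷ []) ∷ []) else
    (if (i ℤDM.%ℕ 6) ≡ᵇ 4 then mkPattern 5 true ((0 ∷ []) ∷ (3 ∷ []) ∷ (0 ∷ []) ∷ (3 ∷ []) ∷ (0 ∷ []) ∷ (3 ∷ []) ∷ (1 ∷ []) ∷ []) else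
    (mkPattern 5 true ((4 ∷ []) ∷ (2 ∷ []) ∷ (5 ∷ []) ∷ (2 ∷ []) ∷ (0 ∷ []) ∷ (3 ∷ []) ∷ (0 ∷ []) ∷ []))))))
  narrow 8 i =
    if (i ℤDM.%ℕ 3) ≡ᵇ 0 then mkPattern 2 true ((2 ∷ []) ∷ [] ∷ (2 ∷ []) ∷ [] ∷ (0 ∷ []) ∷ [] ∷ (1 ∷ []) ∷ [] ∷ []) else
    (if (i ℤDM.%ℕ 3) ≡ᵇ 1 then mkPattern 2 true ((0 ∷ []) ∷ [] ∷ (0 ∷ []) ∷ [] ∷ (1 ∷ []) ∷ [] ∷ (1 ∷ []) ∷ [] ∷ []) else
    (mkPattern 2 true ([] ∷ (0 ∷ []) ∷ [] ∷ (1 ∷ []) ∷ [] ∷ (1 ∷ []) ∷ [] ∷ (2 ∷ []) ∷ [])))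
  narrow 10 i =
    if (i ℤDM.%ℕ 3) ≡ᵇ 0 then mkPattern 2 true ([] ∷ (0 ∷ []) ∷ [] ∷ (0 ∷ []) ∷ [] ∷ (1 ∷ []) ∷ [] ∷ (2 ∷ []) ∷ [] ∷ (0 ∷ []) ∷ []) else
    (if (i ℤDM.%ℕ 3) ≡ᵇ 1 then mkPattern 2 true ([] ∷ (2 ∷ []) ∷ [] ∷ (2 ∷ []) ∷ [] ∷ (0 ∷ []) ∷ [] ∷ (0 ∷ []) ∷ [] ∷ (0 ∷ []) ∷ []) else
    (mkPattern 2 true ((1 ∷ []) ∷ [] ∷ (1 ∷ []) ∷ [] ∷ (2 ∷ []) ∷ [] ∷ (0 ∷ []) ∷ [] ∷ (0 ∷ []) ∷ [] ∷ [])))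
  narrow 11 i =
    if (i ℤDM.%ℕ 5) ≡ᵇ 0 then mkPattern 4 true ((4 ∷ []) ∷ (1 ∷ []) ∷ [] ∷ (1 ∷ 3 ∷ []) ∷ [] ∷ (3 ∷ []) ∷ (0 ∷ []) ∷ [] ∷ (0 ∷ 2 ∷ []) ∷ [] ∷ (2 ∷ []) ∷ []) else
    (if (i ℤDM.%ℕ 5) ≡ᵇ 1 then mkPattern 4 true ([] ∷ (2 ∷ 4 ∷ []) ∷ [] ∷ (4 ∷ []) ∷ (1 ∷ []) ∷ [] ∷ (2 ∷ 4 ∷ []) ∷ [] ∷ (4 ∷ []) ∷ (1 ∷ []) ∷ (3 ∷ []) ∷ []) else
    (if (i ℤDM.%ℕ 5) ≡ᵇ 2 then mkPattern 4 true ((2 ∷ 4 ∷ []) ∷ [] ∷ (4 ∷ []) ∷ (1 ∷ []) ∷ [] ∷ (1 ∷ 3 ∷ []) ∷ [] ∷ (4 ∷ []) ∷ (1 ∷ []) ∷ (3 ∷ []) ∷ [] ∷ []) else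
    (if (i ℤDM.%ℕ 5) ≡ᵇ 3 then mkPattern 4 true ([] ∷ (1 ∷ 4 ∷ []) ∷ [] ∷ (2 ∷ []) ∷ (4 ∷ []) ∷ [] ∷ (1 ∷ 4 ∷ []) ∷ [] ∷ (2 ∷ []) ∷ (4 ∷ []) ∷ (1 ∷ []) ∷ []) else
    (mkPattern 4 true ((4 ∷ []) ∷ (1 ∷ []) ∷ (3 ∷ []) ∷ [] ∷ (1 ∷ 4 ∷ []) ∷ [] ∷ (2 ∷ []) ∷ (4 ∷ []) ∷ [] ∷ (0 ∷ 2 ∷ []) ∷ [] ∷ [])))))
  narrow j i = thirds

  -- The threshold comes from the seam: `code j` has `j + 2` cells among `7j`, and `6(j + 2) ≤ 7j`
  -- means `j ≥ 12`. Its two extra cells are the code cells of the rows just outside the strip,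
  -- moved in by one row.
  patternFor : ℤ → ℕ → Pattern
  patternFor i j = if j <ᵇ 12 then narrow j i else code j

  -- The natural number `a` stands for `i = a − j`, so a loop over `a ≤ 2j` runs through all
  -- `|i| ≤ j`.
  narrowCase : ℕ → ℕ → Bool
  narrowCase j a = (j ≡ᵇ 0) ∨ (short i j ∨ valid (patternFor i j) i j)
    where i = + a ℤ.- + j

  narrowCases : ℕ → Bool
  narrowCases n = allBelow n λ j → allBelow (suc (j + j)) (narrowCase j)

  narrow-valid : narrowCases 12 ≡ true
  narrow-valid = refl

  wideCases : ℤ → ℕ → Bool
  wideCases i n = allBelow n λ a → valid (patternFor i (12 + a)) i (12 + a)

  -- The computation runs with `i` a variable: `code` does not wrap, so only the shift 0 occurs, and
  -- its product with `i` reduces to 0. The 40 cases are the heights 12 to 51.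
  wide-valid : ∀ i → wideCases i 40 ≡ true
  wide-valid i = refl

  toT : ∀ {b} → b ≡ true → T b
  toT refl = tt

  anyᵇ-sound : ∀ {A : Set} (P : A → Bool) xs → anyᵇ P xs ≡ true → ∃ λ x → x ∈ xs × P x ≡ true
  anyᵇ-sound P (x ∷ xs) h with P x in e
  ... | true  = x , here refl , e
  ... | false = let (y , y∈ , p) = anyᵇ-sound P xs h in y , there y∈ , p

  allBelow-sound : ∀ n {P : ℕ → Bool} → allBelow n P ≡ true → ∀ k → k < n → P k ≡ true
  allBelow-sound (suc n) {P} h k k<n with ℕₚ.m≤n⇒m<n∨m≡n (ℕₚ.≤-pred k<n)
  ... | inj₁ k<n′ = allBelow-sound n (proj₂ (∧-true {P n} h)) k k<n′
  ... | inj₂ refl = proj₁ (∧-true h)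

  ∣_∣≤1 : ℤ → Set
  ∣ z ∣≤1 = z ≡ + 0 ⊎ z ≡ + 1 ⊎ z ≡ -[1+ 0 ]

  step-small : ∀ m → ∣ proj₁ (step₇ m) ∣≤1 × ∣ proj₂ (step₇ m) ∣≤1
  step-small 0F = inj₁ refl , inj₁ refl
  step-small 1F = inj₂ (inj₁ refl) , inj₁ refl
  step-small 2F = inj₁ refl , inj₂ (inj₁ refl)
  step-small 3F = inj₂ (inj₂ refl) , inj₂ (inj₁ refl)
  step-small 4F = inj₂ (inj₂ refl) , inj₁ refl
  step-small 5F = inj₁ refl , inj₂ (inj₂ refl)
  step-small 6F = inj₂ (inj₁ refl) , inj₂ (inj₂ refl)

  small-abs : ∀ {z} → ∣ z ∣≤1 → ℤ.∣ z ∣ ≤ 1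
  small-abs (inj₁ refl)        = z≤n
  small-abs (inj₂ (inj₁ refl)) = s≤s z≤n
  small-abs (inj₂ (inj₂ refl)) = s≤s z≤n

  shifts-small : ∀ b {k} → k ∈ shifts b → ∣ k ∣≤1
  shifts-small false (here refl)                 = inj₁ refl
  shifts-small true  (here refl)                 = inj₁ refl
  shifts-small true  (there (here refl))         = inj₂ (inj₁ refl)
  shifts-small true  (there (there (here refl))) = inj₂ (inj₂ refl)

  ≤∣∣ : ∀ {z c} → ℤ.∣ z ∣ ≤ c → z ℤ.≤ + c
  ≤∣∣ {+ n}      h = ℤ.+≤+ h
  ≤∣∣ { -[1+ n ]} h = ℤ.-≤+

  -≤∣∣ : ∀ {z c} → ℤ.∣ z ∣ ≤ c → ℤ.- z ℤ.≤ + c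
  -≤∣∣ {z} h = ≤∣∣ (subst (_≤ _) (sym (ℤₚ.∣-i∣≡∣i∣ z)) h)

  small-sum : ∀ d k i B → ∣ d ∣≤1 → ∣ k ∣≤1 → ℤ.∣ i ∣ ≤ B → ℤ.∣ d ℤ.+ k ℤ.* i ∣ ≤ suc B
  small-sum d k i B hd hk hi = ℕₚ.≤-trans (ℤₚ.∣i+j∣≤∣i∣+∣j∣ d (k ℤ.* i))
    (ℕₚ.+-mono-≤ (small-abs hd) (ℕₚ.≤-trans (ℕₚ.≤-reflexive (ℤₚ.abs-* k i))
      (ℕₚ.≤-trans (ℕₚ.*-mono-≤ (small-abs hk) hi) (ℕₚ.≤-reflexive (ℕₚ.*-identityˡ B)))))

  small-neg : ∀ {k} → ∣ k ∣≤1 → ∣ ℤ.- k ∣≤1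
  small-neg (inj₁ refl)        = inj₁ refl
  small-neg (inj₂ (inj₁ refl)) = inj₂ (inj₂ refl)
  small-neg (inj₂ (inj₂ refl)) = inj₂ (inj₁ refl)

  unscale-≤ : ∀ z n c → z ℤ.* + suc n ℤ.≤ + c → z ℤ.≤ + c
  unscale-≤ -[1+ m ] n c h = ℤ.-≤+
  unscale-≤ (+ m)    n c h = ℤ.+≤+ (ℕₚ.≤-trans (ℕₚ.m≤m*n m (suc n))
    (ℤₚ.drop‿+≤+ (subst (ℤ._≤ + c) (sym (ℤₚ.pos-* m (suc n))) h)))

  -- Finite pieces of tubes and of the plane

  box : ∀ a b → Fin (a * b) → Vec
  box a b t = + toℕ (proj₁ (remQuot {a} b t)) , + toℕ (proj₂ (remQuot {a} b t))

  box-injective : ∀ a b s t → box a b s ≡ box a b t → s ≡ t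
  box-injective a b s t e = trans (sym (Finₚ.combine-remQuot {a} b s)) (trans
    (cong₂ combine (Finₚ.toℕ-injective (ℤₚ.+-injective (cong proj₁ e))) (Finₚ.toℕ-injective (ℤₚ.+-injective (cong proj₂ e))))
    (Finₚ.combine-remQuot {a} b t))

  -- Q is the patch inspected around a flag; S dominates its closed neighbourhood modulo τ.
  record Piece (E : ℕ) (τ : Vec) : Set where
    field
      width height : ℕ
      S            : List Vec
    size : ℕ
    size = width * height
    Q : Fin size → Vec
    Q = box width height
    field
      nonempty  : 0 < size
      density   : (6 * E) * length S ≤ (E + 6) * size
      dominated : ∀ t m → ∃ λ s → s ∈ S × ∃₂ λ m′ k → Q t ⊕ step₇ m ≡ (s ⊕ step₇ m′) ⊕ (k ⊙ τ)

  length-cartesianProductWith : ∀ {A B C : Set} (f : A → B → C) xs ys →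
    length (cartesianProductWith f xs ys) ≡ length xs * length ys
  length-cartesianProductWith f []       ys = refl
  length-cartesianProductWith f (x ∷ xs) ys = trans (List.length-++ (map (f x) ys))
    (cong₂ ℕ._+_ (List.length-map (f x) ys) (length-cartesianProductWith f xs ys))

  module Tube (P : Pattern) (i : ℤ) (j′ : ℕ) (ok : valid P i (suc j′) ≡ true) (∣i∣≤51 : ℤ.∣ i ∣ ≤ 51) (E′ : ℕ) where
    open Pattern P
    j N E len : ℕ
    j   = suc j′
    N   = suc N′
    E   = suc E′
    -- The segment consists of `len` blocks of `N` columns, and its dominating set has 220 more
    -- blocks. The allowance is `6 · len / E = 222` blocks.
    len = 37 * E

    τ : Vec
    τ = i , + j

    inRow-sound : ∀ Y a → inRow P i j Y a ≡ true → ∃₂ λ n r → n < j × r ∈ row rows n × Y ≡ + n × a ℤDM.%ℕ N ≡ r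
    inRow-sound (+ n) a h =
      let (p , q) = ∧-true {n <ᵇ j} h
          (r , r∈ , e) = anyᵇ-sound (λ r → (a ℤDM.%ℕ N) ≡ᵇ r) (row rows n) q
      in n , r , ℕₚ.<ᵇ⇒< n j (toT p) , r∈ , refl , ℕₚ.≡ᵇ⇒≡ _ r (toT e)

    -- The column is reduced modulo `N`, the validity of the pattern gives a dominating cell there,
    -- and the two quotients by `N` add up to the number `M` of its block.
    cell : ∀ X y → y < j → ∃₂ λ n r → ∃₂ λ m k → ∃ λ M →
      n < j × r ∈ row rows n × r < N × ∣ k ∣≤1 ×
      (X , + y) ≡ ((+ r ℤ.+ M ℤ.* + N , + n) ⊕ step₇ m) ⊕ (k ⊙ τ)
    cell X y y<j =
      let x = X ℤDM.%ℕ N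
          cov = proj₂ (∧-true {sparse P i j} ok)
          (m , _ , h₁) = anyᵇ-sound (λ m → anyᵇ (hit P i j x y m) (shifts wraps)) (allFin 7) (allBelow-sound j (allBelow-sound N cov x (ℤDM.n%ℕd<d X N)) y y<j)
          (k , k∈ , h₂) = anyᵇ-sound (hit P i j x y m) (shifts wraps) h₁
          (dx , dy) = step₇ m
          a = + x ℤ.- dx ℤ.- k ℤ.* i
          (n , r , n<j , r∈ , eY , er) = inRow-sound (+ y ℤ.- dy ℤ.- k ℤ.* + j) a h₂
      in n , r , m , k , a ℤDM./ℕ N ℤ.+ X ℤDM./ℕ N , n<j , r∈ , subst (_< N) er (ℤDM.n%ℕd<d a N) , shifts-small wraps k∈ ,
         vec≡ (column X (+ x) (+ r) dx k (a ℤDM./ℕ N) (X ℤDM./ℕ N) (ℤDM.a≡a%ℕn+[a/ℕn]*n X N)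
                 (trans (ℤDM.a≡a%ℕn+[a/ℕn]*n a N) (cong (λ z → + z ℤ.+ a ℤDM./ℕ N ℤ.* + N) er)))
              (level (+ y) (+ n) dy k eY)
      where
      ring₁ : ∀ x dx ki → x ≡ ((x ℤ.- dx ℤ.- ki) ℤ.+ dx) ℤ.+ ki
      ring₁ = solve-∀
      ring₂ : ∀ r dx ki u w n → (((r ℤ.+ u ℤ.* n) ℤ.+ dx) ℤ.+ ki) ℤ.+ w ℤ.* n ≡ ((r ℤ.+ (u ℤ.+ w) ℤ.* n) ℤ.+ dx) ℤ.+ ki
      ring₂ = solve-∀
      column : ∀ X x r dx k u w → X ≡ x ℤ.+ w ℤ.* + N → x ℤ.- dx ℤ.- k ℤ.* i ≡ r ℤ.+ u ℤ.* + N →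
               X ≡ ((r ℤ.+ (u ℤ.+ w) ℤ.* + N) ℤ.+ dx) ℤ.+ k ℤ.* i
      column X x r dx k u w eX ea = trans eX (trans
        (cong (λ z → z ℤ.+ w ℤ.* + N) (trans (ring₁ x dx (k ℤ.* i)) (cong (λ z → (z ℤ.+ dx) ℤ.+ k ℤ.* i) ea)))
        (ring₂ r dx (k ℤ.* i) u w (+ N)))
      level : ∀ y n dy k → y ℤ.- dy ℤ.- k ℤ.* + j ≡ n → y ≡ (n ℤ.+ dy) ℤ.+ k ℤ.* + j
      level y n dy k e = trans (ring₁ y dy (k ℤ.* + j)) (cong (λ z → (z ℤ.+ dy) ℤ.+ k ℤ.* + j) e)

    -- A step leaves the strip by at most one row, and one copy of `τ` brings it back; the price is
    -- a horizontal shift by `i`.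
    normalise-row : ∀ y d → y < j → ∣ d ∣≤1 → ∃₂ λ y′ k → y′ < j × ∣ k ∣≤1 × + y ℤ.+ d ≡ + y′ ℤ.+ k ℤ.* + j
    normalise-row y d y<j (inj₁ refl) = y , + 0 , y<j , inj₁ refl , refl
    normalise-row y d y<j (inj₂ (inj₁ refl)) with ℕₚ.m≤n⇒m<n∨m≡n y<j
    ... | inj₁ y<j′ = suc y , + 0 , y<j′ , inj₁ refl , cong +_ (trans (ℕₚ.+-comm y 1) (sym (ℕₚ.+-identityʳ (suc y))))
    ... | inj₂ refl = 0 , + 1 , s≤s z≤n , inj₂ (inj₁ refl) , trans (cong +_ (ℕₚ.+-comm y 1)) (sym (trans (ℤₚ.+-identityˡ _) (ℤₚ.*-identityˡ (+ j))))
    normalise-row zero    d y<j (inj₂ (inj₂ refl)) = j′ , -[1+ 0 ] , ℕₚ.≤-refl , inj₂ (inj₂ refl) , ring (+ j′)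
      where
      ring : ∀ z → -[1+ 0 ] ≡ z ℤ.+ -[1+ 0 ] ℤ.* (+ 1 ℤ.+ z)
      ring = solve-∀
    normalise-row (suc y) d y<j (inj₂ (inj₂ refl)) = y , + 0 , ℕₚ.<-trans (ℕₚ.n<1+n y) y<j , inj₁ refl , cong +_ (sym (ℕₚ.+-identityʳ y))

    cellAt : ℕ → ℕ × ℕ → Vec
    cellAt m (r , n) = + r ℤ.+ (+ m ℤ.- + 110) ℤ.* + N , + n

    cells : List Vec
    -- Index `m` stands for block `m − 110`. Returning to the strip and then passing to a dominating
    -- cell each shift the column by at most `1 + 51`, so no block outside -106, ..., `len + 104` is
    -- reached.
    cells = cartesianProductWith cellAt (upTo (len + 220)) (block P i j)

    cell∈ : ∀ n r M → n < j → r ∈ row rows n → ℤ.- (M ℤ.+ + 1) ℤ.≤ + 105 → M ℤ.- + len ℤ.≤ + 104 →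
            (+ r ℤ.+ M ℤ.* + N , + n) ∈ cells
    cell∈ n r M n<j r∈ lo hi = subst (_∈ cells) (cong (λ z → + r ℤ.+ z ℤ.* + N , + n) eqM)
      (∈-cartesianProductWith⁺ cellAt (∈-upTo⁺ m<) (∈-concatMap⁺ (λ y → map (_, y) (row rows y)) (lose (∈-upTo⁺ n<j) (∈-map⁺ (_, n) r∈))))
      where
      ring₁ : ∀ M → + 105 ℤ.- ℤ.- (M ℤ.+ + 1) ℤ.+ + 4 ≡ M ℤ.+ + 110
      ring₁ = solve-∀
      ring₂ : ∀ M l → (M ℤ.- l) ℤ.+ (l ℤ.+ + 110) ≡ M ℤ.+ + 110
      ring₂ = solve-∀
      ring₃ : ∀ M → (M ℤ.+ + 110) ℤ.- + 110 ≡ M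
      ring₃ = solve-∀
      nonneg : + 0 ℤ.≤ M ℤ.+ + 110
      nonneg = subst (+ 0 ℤ.≤_) (ring₁ M) (ℤₚ.+-mono-≤ (ℤₚ.i≤j⇒0≤j-i lo) (ℤ.+≤+ {0} {4} z≤n))
      m = ℤ.∣ M ℤ.+ + 110 ∣
      eqm : + m ≡ M ℤ.+ + 110
      eqm = ℤₚ.0≤i⇒+∣i∣≡i nonneg
      eqM : + m ℤ.- + 110 ≡ M
      eqM = trans (cong (ℤ._- + 110) eqm) (ring₃ M)
      m≤ : m ≤ 104 + (len + 110)
      m≤ = ℤₚ.drop‿+≤+ (subst (ℤ._≤ + (104 + (len + 110))) (trans (ring₂ M (+ len)) (sym eqm))
             (ℤₚ.+-monoˡ-≤ (+ len ℤ.+ + 110) hi))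
      m< : m < len + 220
      m< = ℕₚ.≤-<-trans m≤ (ℕₚ.≤-trans (ℕₚ.≤-reflexive (ringℕ len)) (ℕₚ.+-monoʳ-≤ len (ℕₚ.≤ᵇ⇒≤ 215 220 tt)))
        where
        ringℕ : ∀ l → suc (104 + (l + 110)) ≡ l + 215
        ringℕ = solve-∀ℕ

    -- M is the number of the block holding a pattern cell that dominates a cell of column X.
    block-bounds : ∀ X r M d k → r < N → ∣ d ∣≤1 → ∣ k ∣≤1 → X ≡ ((+ r ℤ.+ M ℤ.* + N) ℤ.+ d) ℤ.+ k ℤ.* i →
      ℤ.- X ℤ.≤ + 52 → X ℤ.- + (len * N) ℤ.≤ + 52 → ℤ.- (M ℤ.+ + 1) ℤ.≤ + 105 × M ℤ.- + len ℤ.≤ + 104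
    block-bounds X r M d k r<N hd hk refl lo hi =
      ℤₚ.≤-trans (unscale-≤ (ℤ.- (M ℤ.+ + 1)) N′ 104 (subst (ℤ._≤ + 104) (ring₁ (+ r) M (+ N) d (k ℤ.* i))
        (ℤₚ.+-mono-≤ (ℤₚ.+-mono-≤ lo (ℤₚ.i≤j⇒i-j≤0 (ℤ.+≤+ (ℕₚ.<⇒≤ r<N)))) (≤∣∣ {d ℤ.+ k ℤ.* i} small)))) (ℤ.+≤+ (ℕₚ.n≤1+n 104)) ,
      unscale-≤ (M ℤ.- + len) N′ 104 (subst (ℤ._≤ + 104)
        (trans (cong (λ z → (X ℤ.- z ℤ.- + r) ℤ.- (d ℤ.+ k ℤ.* i)) (ℤₚ.pos-* len N)) (ring₂ (+ r) M (+ N) d (k ℤ.* i) (+ len)))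
        (ℤₚ.+-mono-≤ (ℤₚ.i≤j⇒i-k≤j (+ r) hi) (-≤∣∣ {d ℤ.+ k ℤ.* i} small)))
      where
      small : ℤ.∣ d ℤ.+ k ℤ.* i ∣ ≤ 52
      small = small-sum d k i 51 hd hk ∣i∣≤51
      ring₁ : ∀ r M n d ki → (ℤ.- (((r ℤ.+ M ℤ.* n) ℤ.+ d) ℤ.+ ki) ℤ.+ (r ℤ.- n)) ℤ.+ (d ℤ.+ ki) ≡ ℤ.- (M ℤ.+ + 1) ℤ.* n
      ring₁ = solve-∀
      ring₂ : ∀ r M n d ki l → ((((r ℤ.+ M ℤ.* n) ℤ.+ d) ℤ.+ ki) ℤ.- l ℤ.* n ℤ.- r) ℤ.- (d ℤ.+ ki) ≡ (M ℤ.- l) ℤ.* n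
      ring₂ = solve-∀

    piece : Piece E τ
    piece = record
      { width     = len * N
      ; height    = j
      ; S         = cells
      ; nonempty  = s≤s z≤n
      ; density   = dens
      ; dominated = dom
      }
      where
      dens : (6 * E) * length cells ≤ (E + 6) * ((len * N) * j)
      dens = begin
        (6 * E) * length cells ≡⟨ cong ((6 * E) ℕ.*_) (trans (length-cartesianProductWith cellAt (upTo (len + 220)) (block P i j)) (cong (ℕ._* length (block P i j)) (List.length-upTo (len + 220)))) ⟩
        (6 * E) * ((len + 220) * length (block P i j)) ≡⟨ ring₁ E (len + 220) (length (block P i j)) ⟩
        (E * (len + 220)) * (6 * length (block P i j)) ≤⟨ ℕₚ.*-monoʳ-≤ (E * (len + 220)) (ℕₚ.≤ᵇ⇒≤ _ _ (toT (proj₁ (∧-true {sparse P i j} ok)))) ⟩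
        (E * (len + 220)) * (N * j) ≤⟨ ℕₚ.*-monoˡ-≤ (N * j) (ℕₚ.≤-trans (ℕₚ.m≤m+n _ (2 * E)) (ℕₚ.≤-reflexive (ring₂ E))) ⟩
        ((E + 6) * len) * (N * j) ≡⟨ ring₃ (E + 6) len N j ⟩
        (E + 6) * ((len * N) * j) ∎
        where
        open ℕₚ.≤-Reasoning
        ring₁ : ∀ e l b → (6 * e) * (l * b) ≡ (e * l) * (6 * b)
        ring₁ = solve-∀ℕ
        ring₂ : ∀ e → e * (37 * e + 220) + 2 * e ≡ (e + 6) * (37 * e)
        ring₂ = solve-∀ℕ
        ring₃ : ∀ a l n j → (a * l) * (n * j) ≡ a * ((l * n) * j)
        ring₃ = solve-∀ℕ
      dom : ∀ t m → ∃ λ s → s ∈ cells × ∃₂ λ m′ k → box (len * N) j t ⊕ step₇ m ≡ (s ⊕ step₇ m′) ⊕ (k ⊙ τ)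
      dom t m =
        let u = proj₁ (remQuot {len * N} j t)
            w = proj₂ (remQuot {len * N} j t)
            (dx , dy) = step₇ m
            (y , k₁ , y<j , hk₁ , ey) = normalise-row (toℕ w) dy (Finₚ.toℕ<n w) (proj₂ (step-small m))
            X = + toℕ u ℤ.+ (dx ℤ.+ (ℤ.- k₁) ℤ.* i)
            near = small-sum dx (ℤ.- k₁) i 51 (proj₁ (step-small m)) (small-neg hk₁) ∣i∣≤51
            (n , r , m′ , k₂ , M , n<j , r∈ , r<N , hk₂ , e) = cell X y y<j
            (lo , hi) = block-bounds X r M (proj₁ (step₇ m′)) k₂ r<N (proj₁ (step-small m′)) hk₂ (cong proj₁ e)
                          (lower (toℕ u) (dx ℤ.+ (ℤ.- k₁) ℤ.* i) near) (upper (toℕ u) (dx ℤ.+ (ℤ.- k₁) ℤ.* i) (Finₚ.toℕ<n u) near)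
        in (+ r ℤ.+ M ℤ.* + N , + n) , cell∈ n r M n<j r∈ lo hi , m′ , k₂ ℤ.+ k₁ ,
           vec≡ (trans (ring₁ (+ toℕ u) dx k₁ i) (trans (cong (λ z → z ℤ.+ k₁ ℤ.* i) (cong proj₁ e)) (ring₂ (+ r ℤ.+ M ℤ.* + N) (proj₁ (step₇ m′)) k₂ k₁ i)))
                (trans ey (trans (cong (λ z → z ℤ.+ k₁ ℤ.* + j) (cong proj₂ e)) (ring₂ (+ n) (proj₂ (step₇ m′)) k₂ k₁ (+ j))))
        where
        ring₁ : ∀ u dx k i → u ℤ.+ dx ≡ (u ℤ.+ (dx ℤ.+ (ℤ.- k) ℤ.* i)) ℤ.+ k ℤ.* i
        ring₁ = solve-∀
        ring₂ : ∀ s d k₂ k₁ i → ((s ℤ.+ d) ℤ.+ k₂ ℤ.* i) ℤ.+ k₁ ℤ.* i ≡ (s ℤ.+ d) ℤ.+ (k₂ ℤ.+ k₁) ℤ.* i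
        ring₂ = solve-∀
        lower : ∀ u D → ℤ.∣ D ∣ ≤ 52 → ℤ.- (+ u ℤ.+ D) ℤ.≤ + 52
        lower u D h = subst (ℤ._≤ + 52) (sym (ring (+ u) D)) (ℤₚ.i≤j⇒i-k≤j (+ u) (-≤∣∣ {D} h))
          where
          ring : ∀ u D → ℤ.- (u ℤ.+ D) ≡ ℤ.- D ℤ.- u
          ring = solve-∀
        upper : ∀ u D → u < len * N → ℤ.∣ D ∣ ≤ 52 → (+ u ℤ.+ D) ℤ.- + (len * N) ℤ.≤ + 52
        upper u D u< h = subst (ℤ._≤ + 52) (sym (ring (+ u) D (+ (len * N)))) (ℤₚ.+-mono-≤ (ℤₚ.i≤j⇒i-j≤0 (ℤ.+≤+ (ℕₚ.<⇒≤ u<))) (≤∣∣ h))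
          where
          ring : ∀ u D l → (u ℤ.+ D) ℤ.- l ≡ (u ℤ.- l) ℤ.+ D
          ring = solve-∀

  -- The perfect code on a 56 × 56 square dominates the neighbourhood of the concentric 52 × 52 square;
  -- it has 448 cells, and 52 · 52 / 6 > 450.
  codeSquare : ℕ → List (ℕ × ℕ)
  codeSquare n = filter (λ (x , y) → ((x + 3 * y) % 7) ℕₚ.≟ 0) (cartesianProduct (upTo n) (upTo n))

  codeSquare-size : length (codeSquare 56) ≡ 448
  codeSquare-size = refl

  ∈-codeSquare : ∀ n x y → x < n → y < n → (x + 3 * y) % 7 ≡ 0 → (x , y) ∈ codeSquare n
  ∈-codeSquare n x y x<n y<n e = ∈-filter⁺ (λ (x , y) → ((x + 3 * y) % 7) ℕₚ.≟ 0)
    (∈-cartesianProduct⁺ (∈-upTo⁺ x<n) (∈-upTo⁺ y<n)) e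

  centred : ℕ × ℕ → Vec
  centred (x , y) = + x ℤ.- + 2 , + y ℤ.- + 2

  -- This is `(1 , 1) − step₇ m`. In shifted coordinates the neighbourhood of the square starts at
  -- -1 and the code at -2, so all positions are natural numbers and the check computes in ℕ.
  offset : Fin 7 → ℕ × ℕ
  offset 0F = 1 , 1
  offset 1F = 0 , 1
  offset 2F = 1 , 0
  offset 3F = 2 , 0
  offset 4F = 2 , 1
  offset 5F = 1 , 2
  offset 6F = 0 , 2

  codeNear : ℕ → ℕ → Fin 7 → Bool
  codeNear u w m = (((u + proj₁ (offset m)) + 3 * (w + proj₂ (offset m))) % 7) ≡ᵇ 0

  codeCovers : ℕ → Bool
  codeCovers n = allBelow n λ u → allBelow n λ w → anyᵇ (codeNear u w) (allFin 7)

  code-covers : codeCovers 54 ≡ true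
  code-covers = refl

  -- Stated for a variable `n`, so that the Boolean check stays folded where its result is used;
  -- `narrow-sound` and `wide-sound` have the same form.
  codeCovers-sound : ∀ n → codeCovers n ≡ true → ∀ u w → u < n → w < n → ∃ λ m → codeNear u w m ≡ true
  codeCovers-sound n h u w u<n w<n =
    let (m , _ , e) = anyᵇ-sound (codeNear u w) (allFin 7) (allBelow-sound n (allBelow-sound n h u u<n) w w<n) in m , e

  thickPiece : ∀ E τ → Piece E τ
  thickPiece E τ@(τ₁ , τ₂) = record
    { width     = 52
    ; height    = 52
    ; S         = map centred (codeSquare 56)
    ; nonempty  = s≤s z≤n
    ; density   = dens
    ; dominated = dom
    }
    where
    dens : (6 * E) * length (map centred (codeSquare 56)) ≤ (E + 6) * 2704
    dens = begin
      (6 * E) * length (map centred (codeSquare 56)) ≡⟨ cong ((6 * E) ℕ.*_) (trans (List.length-map centred (codeSquare 56)) codeSquare-size) ⟩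
      (6 * E) * 448 ≡⟨ ring E ⟩
      E * 2688 ≤⟨ ℕₚ.*-mono-≤ (ℕₚ.m≤m+n E 6) (ℕₚ.≤ᵇ⇒≤ 2688 2704 tt) ⟩
      (E + 6) * 2704 ∎
      where
      open ℕₚ.≤-Reasoning
      ring : ∀ e → (6 * e) * 448 ≡ e * 2688
      ring = solve-∀ℕ
    offset-step : ∀ m → + proj₁ (offset m) ℤ.+ proj₁ (step₇ m) ≡ + 1 × + proj₂ (offset m) ℤ.+ proj₂ (step₇ m) ≡ + 1
    offset-step 0F = refl , refl
    offset-step 1F = refl , refl
    offset-step 2F = refl , refl
    offset-step 3F = refl , refl
    offset-step 4F = refl , refl
    offset-step 5F = refl , refl
    offset-step 6F = refl , refl
    offset≤2 : ∀ m → proj₁ (offset m) ≤ 2 × proj₂ (offset m) ≤ 2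
    offset≤2 0F = s≤s z≤n , s≤s z≤n
    offset≤2 1F = z≤n , s≤s z≤n
    offset≤2 2F = s≤s z≤n , z≤n
    offset≤2 3F = s≤s (s≤s z≤n) , z≤n
    offset≤2 4F = s≤s (s≤s z≤n) , s≤s z≤n
    offset≤2 5F = s≤s z≤n , s≤s (s≤s z≤n)
    offset≤2 6F = z≤n , s≤s (s≤s z≤n)
    back : ∀ x d → x < 52 → ∣ d ∣≤1 → ∃ λ u → u < 54 × + x ℤ.+ d ≡ + u ℤ.- + 1
    back x d x<52 (inj₁ refl)        = suc x , s≤s (ℕₚ.m≤n⇒m≤1+n x<52) , ring (+ x)
      where
      ring : ∀ x → x ℤ.+ + 0 ≡ (+ 1 ℤ.+ x) ℤ.- + 1
      ring = solve-∀
    back x d x<52 (inj₂ (inj₁ refl)) = suc (suc x) , s≤s (s≤s x<52) , ring (+ x)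
      where
      ring : ∀ x → x ℤ.+ + 1 ≡ (+ 2 ℤ.+ x) ℤ.- + 1
      ring = solve-∀
    back x d x<52 (inj₂ (inj₂ refl)) = x , ℕₚ.m≤n⇒m≤1+n (ℕₚ.m≤n⇒m≤1+n x<52) , refl
    ring : ∀ u o d k → o ℤ.+ d ≡ + 1 → u ℤ.- + 1 ≡ (((u ℤ.+ o) ℤ.- + 2) ℤ.+ d) ℤ.+ + 0 ℤ.* k
    ring u o d k e = trans (trans (ring₁ u) (cong (λ z → (u ℤ.+ z) ℤ.- + 2) (sym e))) (ring₂ u o d k)
      where
      ring₁ : ∀ u → u ℤ.- + 1 ≡ (u ℤ.+ + 1) ℤ.- + 2
      ring₁ = solve-∀
      ring₂ : ∀ u o d k → (u ℤ.+ (o ℤ.+ d)) ℤ.- + 2 ≡ (((u ℤ.+ o) ℤ.- + 2) ℤ.+ d) ℤ.+ + 0 ℤ.* k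
      ring₂ = solve-∀
    dom : ∀ t m → ∃ λ s → s ∈ map centred (codeSquare 56) × ∃₂ λ m′ k → box 52 52 t ⊕ step₇ m ≡ (s ⊕ step₇ m′) ⊕ (k ⊙ τ)
    dom t m =
      let x = proj₁ (remQuot {52} 52 t)
          y = proj₂ (remQuot {52} 52 t)
          (u , u< , eu) = back (toℕ x) (proj₁ (step₇ m)) (Finₚ.toℕ<n x) (proj₁ (step-small m))
          (w , w< , ew) = back (toℕ y) (proj₂ (step₇ m)) (Finₚ.toℕ<n y) (proj₂ (step-small m))
          (m′ , h) = codeCovers-sound 54 code-covers u w u< w<
          c = u + proj₁ (offset m′) , w + proj₂ (offset m′)
      in centred c ,
         ∈-map⁺ centred (∈-codeSquare 56 _ _ (ℕₚ.+-mono-≤ u< (proj₁ (offset≤2 m′))) (ℕₚ.+-mono-≤ w< (proj₂ (offset≤2 m′)))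
           (ℕₚ.≡ᵇ⇒≡ _ 0 (toT h))) ,
         m′ , + 0 ,
         vec≡ (trans eu (ring (+ u) (+ proj₁ (offset m′)) (proj₁ (step₇ m′)) τ₁ (proj₁ (offset-step m′))))
              (trans ew (ring (+ w) (+ proj₂ (offset m′)) (proj₂ (step₇ m′)) τ₂ (proj₂ (offset-step m′))))

  ∨-true : ∀ {b c} → b ∨ c ≡ true → b ≡ true ⊎ c ≡ true
  ∨-true {true}  h = inj₁ refl
  ∨-true {false} h = inj₂ h

  narrow-sound : ∀ n → narrowCases n ≡ true → ∀ j a → j < n → a < suc (j + j) → narrowCase j a ≡ true
  narrow-sound n h j a j<n a< = allBelow-sound (suc (j + j)) (allBelow-sound n h j j<n) a a<

  wide-sound : ∀ i n → wideCases i n ≡ true → ∀ a → a < n → valid (patternFor i (12 + a)) i (12 + a) ≡ true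
  wide-sound i n h = allBelow-sound n h

  abs-shift : ∀ i j → ℤ.∣ i ∣ ≤ j → + ℤ.∣ i ℤ.+ + j ∣ ℤ.- + j ≡ i
  abs-shift i j h = trans (cong (ℤ._- + j) (ℤₚ.0≤i⇒+∣i∣≡i nonneg)) (ring₂ i (+ j))
    where
    ring₁ : ∀ i j → j ℤ.- ℤ.- i ≡ i ℤ.+ j
    ring₁ = solve-∀
    ring₂ : ∀ i j → (i ℤ.+ j) ℤ.- j ≡ i
    ring₂ = solve-∀
    nonneg : + 0 ℤ.≤ i ℤ.+ + j
    nonneg = subst (+ 0 ℤ.≤_) (ring₁ i (+ j)) (ℤₚ.i≤j⇒0≤j-i (-≤∣∣ {i} h))

  pattern-valid : ∀ i j → 1 ≤ j → j ≤ 51 → ℤ.∣ i ∣ ≤ j → short i j ≡ true ⊎ valid (patternFor i j) i j ≡ true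
  pattern-valid i j 1≤j j≤51 h with j ℕₚ.<? 12
  ... | yes j<12 = cases (∨-true (narrow-sound 12 narrow-valid j a j<12
                     (s≤s (ℕₚ.≤-trans (ℤₚ.∣i+j∣≤∣i∣+∣j∣ i (+ j)) (ℕₚ.+-monoˡ-≤ j h)))))
    where
    a = ℤ.∣ i ℤ.+ + j ∣
    Goal : ℤ → Set
    Goal i = short i j ≡ true ⊎ valid (patternFor i j) i j ≡ true
    cases : (j ≡ᵇ 0) ≡ true ⊎ (short (+ a ℤ.- + j) j ∨ valid (patternFor (+ a ℤ.- + j) j) (+ a ℤ.- + j) j) ≡ true → Goal i
    cases (inj₁ e) = ⊥-elim (ℕₚ.<⇒≢ 1≤j (sym (ℕₚ.≡ᵇ⇒≡ j 0 (toT e))))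
    cases (inj₂ e) = subst Goal (abs-shift i j h) (∨-true e)
  ... | no j≮12 = inj₂ (subst (λ j → valid (patternFor i j) i j ≡ true) (ℕₚ.m+[n∸m]≡n (ℕₚ.≮⇒≥ j≮12))
                    (wide-sound i 40 (wide-valid i) (j ℕ.∸ 12) (s≤s (ℕₚ.∸-monoˡ-≤ 12 j≤51))))

  short-difference : ∀ i j → short i (suc j) ≡ true → ∃₂ λ k l → k ≢ l × dir k ⊖ dir l ≡ (i , + suc j)
  short-difference i j h =
    let (p , qr) = ∧-true {ℤ.∣ i ∣ ≤ᵇ 2} h
        (q , r) = ∧-true {suc j ≤ᵇ 2} qr
    in table i j (ℕₚ.≤ᵇ⇒≤ _ _ (toT p)) (ℕₚ.≤ᵇ⇒≤ _ _ (toT q)) (ℕₚ.≤ᵇ⇒≤ _ _ (toT r))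
    where
    table : ∀ i j → ℤ.∣ i ∣ ≤ 2 → suc j ≤ 2 → ℤ.∣ i ℤ.+ + suc j ∣ ≤ 2 → ∃₂ λ k l → k ≢ l × dir k ⊖ dir l ≡ (i , + suc j)
    table (+ 0)       0 _ _ _ = 0F , 5F , (λ ()) , refl
    table (+ 1)       0 _ _ _ = 0F , 4F , (λ ()) , refl
    table (+ 2)       0 _ _ (s≤s (s≤s ()))
    table (-[1+ 0 ])  0 _ _ _ = 1F , 0F , (λ ()) , refl
    table (-[1+ 1 ])  0 _ _ _ = 3F , 5F , (λ ()) , refl
    table (+ 0)       1 _ _ _ = 1F , 4F , (λ ()) , refl
    table (+ 1)       1 _ _ (s≤s (s≤s ()))
    table (+ 2)       1 _ _ (s≤s (s≤s ()))
    table (-[1+ 0 ])  1 _ _ _ = 2F , 4F , (λ ()) , refl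
    table (-[1+ 1 ])  1 _ _ _ = 2F , 5F , (λ ()) , refl
    table (+ suc (suc (suc n)))  _ (s≤s (s≤s ())) _ _
    table (-[1+ suc (suc n) ])   _ (s≤s (s≤s ())) _ _
    table _ (suc (suc j)) _ (s≤s (s≤s ())) _

  -- Classification of flags by their shortest period

  swap : Vec → Vec
  swap = reflect g₁

  -- Up to sign and exchange of coordinates, a nonzero vector is `(i , j)` with `j ≥ 1` and
  -- `|i| ≤ j`. Only these tubes are tabulated; the mirror symmetry of `g₁` supplies the others.
  orient : Fin 2 → Vec → Vec
  orient zero    p = p
  orient (suc _) p = swap p

  swap-dir : Fin 6 → Fin 6
  swap-dir 0F = 1F
  swap-dir 1F = 0F
  swap-dir 2F = 5F
  swap-dir 3F = 4F
  swap-dir 4F = 3F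
  swap-dir 5F = 2F

  swap-dir-involutive : ∀ k → swap-dir (swap-dir k) ≡ k
  swap-dir-involutive 0F = refl
  swap-dir-involutive 1F = refl
  swap-dir-involutive 2F = refl
  swap-dir-involutive 3F = refl
  swap-dir-involutive 4F = refl
  swap-dir-involutive 5F = refl

  swap-dir-correct : ∀ k → swap (dir k) ≡ dir (swap-dir k)
  swap-dir-correct 0F = refl
  swap-dir-correct 1F = refl
  swap-dir-correct 2F = refl
  swap-dir-correct 3F = refl
  swap-dir-correct 4F = refl
  swap-dir-correct 5F = refl

  swap-step : ∀ m → ∃ λ m′ → swap (step₇ m) ≡ step₇ m′
  swap-step zero    = zero , refl
  swap-step (suc k) = suc (swap-dir k) , swap-dir-correct k

  no-short : ∀ f i j → 1 ≤ j → short i j ≡ true → ◇ (λ S x → Per (orient f (i , + j)) S x → ⊥)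
  no-short zero i (suc j) _ h =
    let (k , l , k≢l , e) = short-difference i j h
    in subst (λ p → ◇ (λ S x → Per p S x → ⊥)) e (no-short-period k l k≢l)
  no-short (suc _) i (suc j) _ h =
    let (k , l , k≢l , e) = short-difference i j h
        k′≢l′ = λ e′ → k≢l (trans (sym (swap-dir-involutive k)) (trans (cong swap-dir e′) (swap-dir-involutive l)))
    in subst (λ p → ◇ (λ S x → Per p S x → ⊥))
         (trans (sym (cong₂ _⊖_ (swap-dir-correct k) (swap-dir-correct l))) (cong swap e))
         (no-short-period (swap-dir k) (swap-dir l) k′≢l′)

  -- `density` is `|S| ≤ (1/6 + 1/E) |Q|` with denominators cleared. The cells need no longer be
  -- listed as a box, since a piece may have been mirrored.
  record Patch (E : ℕ) (τ : Vec) : Set where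
    field
      size      : ℕ
      Q         : Fin size → Vec
      S         : List Vec
      nonempty  : 0 < size
      density   : (6 * E) * length S ≤ (E + 6) * size
      dominated : ∀ t m → ∃ λ s → s ∈ S × ∃₂ λ m′ k → Q t ⊕ step₇ m ≡ (s ⊕ step₇ m′) ⊕ (k ⊙ τ)

  orientPiece : ∀ {E τ} f → Piece E τ → Patch E (orient f τ)
  orientPiece zero P = record { Piece P }
  orientPiece {E} {τ} (suc _) P = record
    { size      = size
    ; Q         = λ t → swap (Q t)
    ; S         = map swap S
    ; nonempty  = nonempty
    ; density   = subst (λ n → (6 * E) * n ≤ (E + 6) * size) (sym (List.length-map swap S)) density
    ; dominated = λ t m →
        let (m₁ , e₁) = swap-step m
            (s , s∈ , m₂ , k , e) = dominated t m₁
            (m₃ , e₃) = swap-step m₂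
        in swap s , ∈-map⁺ swap s∈ , m₃ , k ,
           trans (cong (λ z → swap (Q t) ⊕ swap z) e₁)
                 (trans (cong swap e) (cong (λ z → (swap s ⊕ z) ⊕ (k ⊙ swap τ)) e₃))
    }
    where open Piece P

  firstTrue : ∀ n → (Fin n → Bool) → Maybe (Fin n)
  firstTrue zero    P = nothing
  firstTrue (suc n) P = if P zero then just zero else Maybe.map suc (firstTrue n (λ i → P (suc i)))

  firstTrue-just : ∀ n P {i} → firstTrue n P ≡ just i → P i ≡ true × (∀ j → toℕ j < toℕ i → P j ≡ false)
  firstTrue-just (suc n) P e with P zero in e₀
  firstTrue-just (suc n) P refl | true = e₀ , λ j ()
  ... | false with firstTrue n (λ i → P (suc i)) in e₁
  firstTrue-just (suc n) P refl | false | just i =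
    let (p , q) = firstTrue-just n (λ i → P (suc i)) e₁
    in p , λ { zero _ → e₀ ; (suc j) (s≤s j<i) → q j j<i }

  firstTrue-nothing : ∀ n P → firstTrue n P ≡ nothing → ∀ j → P j ≡ false
  firstTrue-nothing (suc n) P e j with P zero in e₀
  ... | false with firstTrue n (λ i → P (suc i)) in e₁
  firstTrue-nothing (suc n) P e zero    | false | nothing = e₀
  firstTrue-nothing (suc n) P e (suc j) | false | nothing = firstTrue-nothing n (λ i → P (suc i)) e₁ j

  firstTrue-cong : ∀ n {P P′ : Fin n → Bool} → (∀ i → P i ≡ P′ i) → firstTrue n P ≡ firstTrue n P′
  firstTrue-cong zero    h = refl
  firstTrue-cong (suc n) h = cong₂ (λ b m → if b then just zero else Maybe.map suc m) (h zero) (firstTrue-cong n λ i → h (suc i))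

  isYes-cong : ∀ {A B : Set} (a? : Dec A) (b? : Dec B) → (A → B) → (B → A) → isYes a? ≡ isYes b?
  isYes-cong (yes a) (yes b) f g = refl
  isYes-cong (yes a) (no ¬b) f g = ⊥-elim (¬b (f a))
  isYes-cong (no ¬a) (yes b) f g = ⊥-elim (¬a (g b))
  isYes-cong (no ¬a) (no ¬b) f g = refl

  -- Translations commute, so all translates of a flag share its periods. The class is therefore
  -- constant along translates, and the averaging can be done class by class.
  per-invariant : ∀ τ p → ◇ (λ S x → (Per τ S (at S x p) → Per τ S x) × (Per τ S x → Per τ S (at S x p)))
  per-invariant τ p = ◇-map₂
    (λ S x e f → (λ h → run-injective S (tr p) (trans f (trans (sym e) h)))
               , (λ h → trans e (trans (sym f) (cong (λ z → at S z p) h))))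
    (at-⊕ p τ) (at-cancel τ (p ⊕ τ) p (⊕-comm τ p))

  det-orient : ∀ f p q → det p q ≢ + 0 → det (orient f p) (orient f q) ≢ + 0
  det-orient zero    p q h = h
  det-orient (suc _) p@(i , j) q@(k , l) h e = h (trans (ring i j k l) (cong ℤ.-_ e))
    where
    ring : ∀ i j k l → i ℤ.* l ℤ.- j ℤ.* k ≡ ℤ.- (j ℤ.* k ℤ.- i ℤ.* l)
    ring = solve-∀

  orient-⊖ : ∀ f p q → orient f p ⊖ orient f q ≡ orient f (p ⊖ q)
  orient-⊖ zero    p q = refl
  orient-⊖ (suc _) p q = refl

  -- A vector parallel to `(i , j + 1)` has its slope. A lower period parallel to `τ` is thus in the
  -- enumerated range and would have been found earlier.
  parallel-bound : ∀ i j a b → ℤ.∣ i ∣ ≤ suc j → det (a , + b) (i , + suc j) ≡ + 0 → ℤ.∣ a ∣ ≤ b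
  parallel-bound i j a b h e = ℕₚ.*-cancelʳ-≤ ℤ.∣ a ∣ b (suc j) (begin
    ℤ.∣ a ∣ * suc j ≡⟨ ℤₚ.abs-* a (+ suc j) ⟨
    ℤ.∣ a ℤ.* + suc j ∣ ≡⟨ cong ℤ.∣_∣ (ℤₚ.i-j≡0⇒i≡j (a ℤ.* + suc j) (+ b ℤ.* i) e) ⟩
    ℤ.∣ + b ℤ.* i ∣ ≡⟨ ℤₚ.abs-* (+ b) i ⟩
    b * ℤ.∣ i ∣ ≤⟨ ℕₚ.*-monoʳ-≤ b h ⟩
    b * suc j ∎)
    where open ℕₚ.≤-Reasoning

  pos-difference : ∀ m n → n ≤ m → + m ℤ.- + n ≡ + (m ℕ.∸ n)
  pos-difference m n n≤m = trans (ℤₚ.m-n≡m⊖n m n) (ℤₚ.⊖-≥ n≤m)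

  ∣pos-difference∣ : ∀ {m n B} → m ≤ B → n ≤ B → ℤ.∣ + m ℤ.- + n ∣ ≤ B
  ∣pos-difference∣ {m} {n} {B} m≤B n≤B with ℕₚ.≤-total n m
  ... | inj₁ n≤m = subst (λ z → ℤ.∣ z ∣ ≤ B) (sym (pos-difference m n n≤m)) (ℕₚ.≤-trans (ℕₚ.m∸n≤m m n) m≤B)
  ... | inj₂ m≤n = subst (_≤ B) (sym (trans (ℤₚ.∣i-j∣≡∣j-i∣ (+ m) (+ n)) (cong ℤ.∣_∣ (pos-difference n m m≤n)))) (ℕₚ.≤-trans (ℕₚ.m∸n≤m n m) n≤B)

  ∣0-∣ : ∀ a → ℤ.∣ + 0 ℤ.- a ∣ ≡ ℤ.∣ a ∣
  ∣0-∣ a = trans (cong ℤ.∣_∣ (ℤₚ.+-identityˡ (ℤ.- a))) (ℤₚ.∣-i∣≡∣i∣ a)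

  module Collision (w j′ : ℕ) (i : ℤ) (f : Fin 2) (∣i∣≤j : ℤ.∣ i ∣ ≤ suc j′) where
    j : ℕ
    j = suc j′

    NoLower : Property
    NoLower S x = ∀ a b → 1 ≤ b → b < j → ℤ.∣ a ∣ ≤ b → Per (orient f (a , + b)) S x → ⊥

    Q : Fin (w * j) → Vec
    Q t = orient f (box w j t)

    Separated : Fin (w * j) → Fin (w * j) → Property
    Separated t t′ S x = Per (orient f (i , + j)) S x → NoLower S x → at S x (Q t) ≡ at S x (Q t′) → ⊥

    rise : Fin (w * j) → ℕ
    rise t = toℕ (proj₂ (remQuot {w} j t))

    difference : ∀ t t′ → ◇ (λ S x → at S x (Q t) ≡ at S x (Q t′) → Per (orient f (box w j t ⊖ box w j t′)) S x)
    difference t t′ = subst (λ d → ◇ (λ S x → at S x (Q t) ≡ at S x (Q t′) → Per d S x)) (orient-⊖ f (box w j t) (box w j t′))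
      (at≡⇒per (Q t) (Q t′))

    independent : ∀ t t′ → det (box w j t ⊖ box w j t′) (i , + j) ≢ + 0 → ◇ (Separated t t′)
    independent t t′ nz = ◇-map₂ (λ S x d contra hτ _ e → contra (d e) hτ) (difference t t′)
      (no-independent-periods (orient f (box w j t ⊖ box w j t′)) (orient f (i , + j)) (det-orient f _ _ nz))

    above : ∀ t t′ → rise t′ < rise t → ◇ (Separated t t′)
    above t t′ lt with det (box w j t ⊖ box w j t′) (i , + j) ℤₚ.≟ + 0
    ... | no nz = independent t t′ nz
    ... | yes z = ◇-map (λ S x d hτ low e → low a b (ℕₚ.m<n⇒0<n∸m lt) b<j (parallel-bound i j′ a b ∣i∣≤j (subst (λ p → det p (i , + j) ≡ + 0) eq z))
                                       (subst (λ p → Per (orient f p) S x) eq (d e)))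
                        (difference t t′)
      where
      a = proj₁ (box w j t ⊖ box w j t′)
      b = rise t ℕ.∸ rise t′
      b<j : b < j
      b<j = ℕₚ.≤-<-trans (ℕₚ.m∸n≤m (rise t) (rise t′)) (Finₚ.toℕ<n (proj₂ (remQuot {w} j t)))
      eq : box w j t ⊖ box w j t′ ≡ (a , + b)
      eq = cong (a ,_) (pos-difference (rise t) (rise t′) (ℕₚ.<⇒≤ lt))

    -- Cells that meet differ by a period. It cannot be independent of `τ`; if parallel with
    -- positive rise, the rise is below `j`, against the choice of `τ`; with rise 0, parallelism
    -- makes it zero.
    separated : ∀ t t′ → t ≢ t′ → ◇ (Separated t t′)
    separated t t′ t≢t′ with ℕₚ.<-cmp (rise t) (rise t′)
    ... | tri< lt _ _ = ◇-map (λ S x h hτ low e → h hτ low (sym e)) (above t′ t lt)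
    ... | tri> _ _ gt = above t t′ gt
    ... | tri≈ _ e _ with det (box w j t ⊖ box w j t′) (i , + j) ℤₚ.≟ + 0
    ...   | no nz = independent t t′ nz
    ...   | yes z = ⊥-elim (t≢t′ (box-injective w j t t′ (vec≡ (ℤₚ.i-j≡0⇒i≡j _ _ δ₁≡0) (cong +_ e))))
      where
      δ₁ = proj₁ (box w j t ⊖ box w j t′)
      ring : ∀ d j k i → k ≡ + 0 → d ℤ.* j ≡ d ℤ.* j ℤ.- k ℤ.* i
      ring d j _ i refl = ring′ d j i
        where
        ring′ : ∀ d j i → d ℤ.* j ≡ d ℤ.* j ℤ.- + 0 ℤ.* i
        ring′ = solve-∀
      δ₁≡0 : δ₁ ≡ + 0
      δ₁≡0 with ℤₚ.i*j≡0⇒i≡0∨j≡0 δ₁ {+ j} (trans (ring δ₁ (+ j) (+ rise t ℤ.- + rise t′) i (ℤₚ.i≡j⇒i-j≡0 {+ rise t} {+ rise t′} (cong +_ e))) z)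
      ... | inj₁ h = h

  patch-dominates : ∀ {E τ} (P : Patch E τ) → ◇ (λ S x → Per τ S x → ∀ t v →
    Dominates S (System.vtx S (at S x (Patch.Q P t))) v →
    ∃ λ s → s ∈ Patch.S P × Dominates S (System.vtx S (at S x s)) v)
  patch-dominates {E} {τ} P = ◇-map₂ gather
      (◇-∀ size λ t → ◇-run (tr (Q t)) dominated-step)
      (◇-∀ size λ t → ◇-∀ 7 λ m → single t m)
    where
    open Patch P
    Single : ∀ t m → Property
    Single t m Σ x = Per τ Σ x → ∃ λ s → s ∈ S × Dominates Σ (System.vtx Σ (at Σ x s)) (System.vtx Σ (at Σ (at Σ x (Q t)) (step₇ m)))
    single : ∀ t m → ◇ (Single t m)
    single t m =
      let (s , s∈ , m′ , k , e) = dominated t m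
      in ◇-map₃
        (λ Σ x f g dm hτ → s , s∈ , subst (Dominates Σ (System.vtx Σ (at Σ x s))) (cong (System.vtx Σ)
            (sym (trans (proj₁ f) (trans (sym (proj₂ f)) (cong (λ z → at Σ z (s ⊕ step₇ m′)) (g hτ)))))) dm)
        (◇-map₂ (λ Σ x a b → a , b) (at-cancel (Q t) ((s ⊕ step₇ m′) ⊕ (k ⊙ τ)) (step₇ m) e)
                                    (at-cancel (k ⊙ τ) ((s ⊕ step₇ m′) ⊕ (k ⊙ τ)) (s ⊕ step₇ m′) (⊕-comm (k ⊙ τ) (s ⊕ step₇ m′))))
        (per-⊙ k τ)
        (◇-map₂ (λ Σ x a b → subst (λ z → Dominates Σ (System.vtx Σ (at Σ x s)) (System.vtx Σ z)) b a)
           (◇-run (tr s) (step-dominated m′)) (at-⊕ s (step₇ m′)))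
    gather : ∀ Σ x →
      (∀ t v → Dominates Σ (System.vtx Σ (at Σ x (Q t))) v → ∃ λ m → v ≡ System.vtx Σ (at Σ (at Σ x (Q t)) (step₇ m))) →
      (∀ t m → Single t m Σ x) →
      Per τ Σ x → ∀ t v → Dominates Σ (System.vtx Σ (at Σ x (Q t))) v → ∃ λ s → s ∈ S × Dominates Σ (System.vtx Σ (at Σ x s)) v
    gather Σ x st sg hτ t v h with st t v h
    ... | m , refl = sg t m hτ

  -- The bound is the largest coordinate difference in a square of side 52. It is a variable with an
  -- equation, so that index types built from it stay unevaluated.
  module Classes (B : ℕ) (B≡51 : B ≡ 51) (E′ : ℕ) where
    private
      E : ℕ
      E = suc E′
      B≤51 : B ≤ 51
      B≤51 = ℕₚ.≤-reflexive B≡51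

    columns indices : ℕ
    columns = suc (B + B)
    indices = suc B * (columns * 2)

    encode : Fin (suc B) → Fin columns → Fin 2 → Fin indices
    encode J I f = combine J (combine I f)

    level : Fin indices → Fin (suc B)
    level κ = proj₁ (remQuot {suc B} (columns * 2) κ)

    height : Fin indices → ℕ
    height κ = toℕ (level κ)

    shear : Fin indices → ℤ
    shear κ = + toℕ (proj₁ (remQuot {columns} 2 (proj₂ (remQuot {suc B} (columns * 2) κ)))) ℤ.- + B

    flip : Fin indices → Fin 2
    flip κ = proj₂ (remQuot {columns} 2 (proj₂ (remQuot {suc B} (columns * 2) κ)))

    base vec : Fin indices → Vec
    base κ = shear κ , + height κ
    vec κ  = orient (flip κ) (base κ)

    admissible? : ∀ κ → Dec (1 ≤ height κ × ℤ.∣ shear κ ∣ ≤ height κ)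
    admissible? κ = (1 ℕₚ.≤? height κ) ×-dec (ℤ.∣ shear κ ∣ ℕₚ.≤? height κ)

    perᵇ : Fin indices → (S : System) → System.Flag S → Bool
    perᵇ κ S x = isYes (admissible? κ) ∧ isYes (at S x (vec κ) Finₚ.≟ x)

    firstPeriod : (S : System) → System.Flag S → Maybe (Fin indices)
    firstPeriod S x = firstTrue indices (λ κ → perᵇ κ S x)

    index : ∀ a b f → 1 ≤ b → b ≤ B → ℤ.∣ a ∣ ≤ b →
            ∃ λ κ → vec κ ≡ orient f (a , + b) × height κ ≡ b × isYes (admissible? κ) ≡ true
    index a b f 1≤b b≤B h =
      κ , cong₂ orient eqf (vec≡ eqa (cong +_ eqb)) , eqb ,
      isYes⇐ (admissible? κ) (subst (1 ≤_) (sym eqb) 1≤b , subst (ℤ.∣ shear κ ∣ ≤_) (sym eqb) (subst (λ z → ℤ.∣ z ∣ ≤ b) (sym eqa) h))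
      where
      b< = s≤s b≤B
      c = ℤ.∣ a ℤ.+ + B ∣
      c< : c < columns
      c< = s≤s (ℕₚ.≤-trans (ℤₚ.∣i+j∣≤∣i∣+∣j∣ a (+ B)) (ℕₚ.+-monoˡ-≤ B (ℕₚ.≤-trans h b≤B)))
      κ = encode (fromℕ< b<) (fromℕ< c<) f
      q₁ = Finₚ.remQuot-combine {suc B} (fromℕ< b<) (combine (fromℕ< c<) f)
      q₂ = Finₚ.remQuot-combine {columns} (fromℕ< c<) f
      eqb : height κ ≡ b
      eqb = trans (cong (λ z → toℕ (proj₁ z)) q₁) (Finₚ.toℕ-fromℕ< b<)
      eqa : shear κ ≡ a
      eqa = trans (cong (λ z → + toℕ (proj₁ (remQuot {columns} 2 (proj₂ z))) ℤ.- + B) q₁)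
           (trans (cong (λ z → + toℕ (proj₁ z) ℤ.- + B) q₂)
           (trans (cong (λ z → + z ℤ.- + B) (Finₚ.toℕ-fromℕ< c<)) (abs-shift a B (ℕₚ.≤-trans h b≤B))))
      eqf : flip κ ≡ f
      eqf = trans (cong (λ z → proj₂ (remQuot {columns} 2 (proj₂ z))) q₁) (cong proj₂ q₂)

    -- The height is the leading digit of the index, so the first period found is one of least
    -- height.
    lower-first : ∀ κ κ′ → height κ < height κ′ → toℕ κ < toℕ κ′
    lower-first κ κ′ h = subst₂′ (Finₚ.combine-remQuot {suc B} (columns * 2) κ) (Finₚ.combine-remQuot {suc B} (columns * 2) κ′)
      (Finₚ.combine-monoˡ-< (proj₂ (remQuot {suc B} (columns * 2) κ)) (proj₂ (remQuot {suc B} (columns * 2) κ′)) h)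
      where
      subst₂′ : ∀ {p q r s : Fin indices} → p ≡ q → r ≡ s → toℕ p < toℕ r → toℕ q < toℕ s
      subst₂′ refl refl h = h

    perᵇ-false : ∀ κ S x → perᵇ κ S x ≡ false → isYes (admissible? κ) ≡ true → Per (vec κ) S x → ⊥
    perᵇ-false κ S x h a p with isYes (admissible? κ) | at S x (vec κ) Finₚ.≟ x
    perᵇ-false κ S x () a p | true | yes _
    perᵇ-false κ S x h  a p | true | no ¬p = ¬p p

    firstPeriod-just : ∀ S x κ → firstPeriod S x ≡ just κ →
      (1 ≤ height κ × ℤ.∣ shear κ ∣ ≤ height κ) × Per (vec κ) S x × (∀ κ′ → height κ′ < height κ → perᵇ κ′ S x ≡ false)
    firstPeriod-just S x κ e =
      let (p , q) = firstTrue-just indices (λ κ → perᵇ κ S x) e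
          (a , b) = ∧-true {isYes (admissible? κ)} p
      in isYes⇒ (admissible? κ) a , isYes⇒ (at S x (vec κ) Finₚ.≟ x) b , λ κ′ h → q κ′ (lower-first κ′ κ h)

    tubePiece : ∀ i j → 1 ≤ j → j ≤ 51 → ℤ.∣ i ∣ ≤ j → valid (patternFor i j) i j ≡ true → Piece E (i , + j)
    tubePiece i (suc j) _ j≤51 h ok = Tube.piece (patternFor i (suc j)) i j ok (ℕₚ.≤-trans h j≤51) E′

    height≤51 : ∀ κ → height κ ≤ 51
    height≤51 κ = ℕₚ.≤-trans (ℕₚ.≤-pred (Finₚ.toℕ<n (level κ))) B≤51

    -- Inadmissible and short vectors are never first periods; their piece is a dummy.
    data Kind (κ : Fin indices) : Set where
      inadmissible : ¬ (1 ≤ height κ × ℤ.∣ shear κ ∣ ≤ height κ) → Kind κ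
      tooShort     : 1 ≤ height κ → short (shear κ) (height κ) ≡ true → Kind κ
      tube         : 1 ≤ height κ → ℤ.∣ shear κ ∣ ≤ height κ →
                     valid (patternFor (shear κ) (height κ)) (shear κ) (height κ) ≡ true → Kind κ

    kind : ∀ κ → Kind κ
    kind κ with admissible? κ
    ... | no ¬a = inadmissible ¬a
    ... | yes (p , q) with pattern-valid (shear κ) (height κ) p (height≤51 κ) q
    ...   | inj₁ s = tooShort p s
    ...   | inj₂ v = tube p q v

    pieceOf : ∀ κ → Kind κ → Piece E (base κ)
    pieceOf κ (tube p q v) = tubePiece (shear κ) (height κ) p (height≤51 κ) q v
    pieceOf κ _            = thickPiece E (base κ)

    no-period-in-square : ∀ a b → (a , b) ≢ 𝟎 → ℤ.∣ a ∣ ≤ B → ℤ.∣ b ∣ ≤ B →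
      ◇ (λ S x → (∀ κ → perᵇ κ S x ≡ false) → Per (a , b) S x → ⊥)
    no-period-in-square a b nz a≤B b≤B with ℕₚ.≤-<-connex ℤ.∣ a ∣ ℤ.∣ b ∣
    no-period-in-square a (+ suc n) nz a≤B b≤B | inj₁ h =
      let (κ , e , _ , ad) = index a (suc n) 0F (s≤s z≤n) b≤B h
      in always λ S x none p → perᵇ-false κ S x (none κ) ad (subst (λ q → Per q S x) (sym e) p)
    no-period-in-square a -[1+ n ] nz a≤B b≤B | inj₁ h =
      let (κ , e , _ , ad) = index (+ 0 ℤ.- a) (suc n) 0F (s≤s z≤n) b≤B (subst (_≤ suc n) (sym (∣0-∣ a)) h)
      in ◇-map (λ S x neg none p → perᵇ-false κ S x (none κ) ad (subst (λ q → Per q S x) (sym e) (neg p))) (per-neg (a , -[1+ n ]))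
    no-period-in-square (+ zero) (+ zero) nz a≤B b≤B | inj₁ h = ⊥-elim (nz refl)
    no-period-in-square (+ suc n) b nz a≤B b≤B | inj₂ h =
      let (κ , e , _ , ad) = index b (suc n) 1F (s≤s z≤n) a≤B (ℕₚ.<⇒≤ h)
      in always λ S x none p → perᵇ-false κ S x (none κ) ad (subst (λ q → Per q S x) (sym e) p)
    no-period-in-square -[1+ n ] b nz a≤B b≤B | inj₂ h =
      let (κ , e , _ , ad) = index (+ 0 ℤ.- b) (suc n) 1F (s≤s z≤n) a≤B (subst (_≤ suc n) (sym (∣0-∣ b)) (ℕₚ.<⇒≤ h))
      in ◇-map (λ S x neg none p → perᵇ-false κ S x (none κ) ad (subst (λ q → Per q S x) (sym e) (neg p))) (per-neg (-[1+ n ] , b))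

    classes : ℕ
    classes = suc indices

    -- Class zero collects the flags without any listed period. The vector `𝟎`, a period of every
    -- flag, lets it share the format of the tubes.
    period : Fin classes → Vec
    period zero    = 𝟎
    period (suc κ) = vec κ

    patch : ∀ c → Patch E (period c)
    patch zero    = orientPiece zero (thickPiece E 𝟎)
    patch (suc κ) = orientPiece (flip κ) (pieceOf κ (kind κ))

    toClass : Maybe (Fin indices) → Fin classes
    toClass nothing  = zero
    toClass (just κ) = suc κ

    class : (S : System) → System.Flag S → Fin classes
    class S x = toClass (firstPeriod S x)

    class-zero : ∀ S x → class S x ≡ zero → ∀ κ → perᵇ κ S x ≡ false
    class-zero S x e with firstPeriod S x in e′
    ... | nothing = firstTrue-nothing indices (λ κ → perᵇ κ S x) e′

    class-suc : ∀ S x κ → class S x ≡ suc κ →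
      (1 ≤ height κ × ℤ.∣ shear κ ∣ ≤ height κ) × Per (vec κ) S x × (∀ κ′ → height κ′ < height κ → perᵇ κ′ S x ≡ false)
    class-suc S x κ e with firstPeriod S x in e′
    class-suc S x κ refl | just _ = firstPeriod-just S x κ e′

    class-period : ∀ S x c → class S x ≡ c → Per (period c) S x
    class-period S x zero    e = refl
    class-period S x (suc κ) e = proj₁ (proj₂ (class-suc S x κ e))

    class-dominates : ∀ c → ◇ (λ S x → class S x ≡ c → ∀ t v →
      Dominates S (System.vtx S (at S x (Patch.Q (patch c) t))) v →
      ∃ λ s → s ∈ Patch.S (patch c) × Dominates S (System.vtx S (at S x s)) v)
    class-dominates c = ◇-map (λ S x h e → h (class-period S x c e)) (patch-dominates (patch c))

    class-invariant : ∀ p → ◇ (λ S x → class S (at S x p) ≡ class S x)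
    class-invariant p = ◇-map
      (λ S x h → cong toClass (firstTrue-cong indices λ κ →
         cong (isYes (admissible? κ) ∧_) (isYes-cong (at S (at S x p) (vec κ) Finₚ.≟ at S x p) (at S x (vec κ) Finₚ.≟ x) (proj₁ (h κ)) (proj₂ (h κ)))))
      (◇-∀ indices λ κ → per-invariant (vec κ) p)

    Injective : Fin classes → Property
    Injective c S x = class S x ≡ c → ∀ t t′ → t ≢ t′ → at S x (Patch.Q (patch c) t) ≡ at S x (Patch.Q (patch c) t′) → ⊥

    decide-pairs : ∀ n (P : Fin n → Fin n → Property) → (∀ t t′ → t ≢ t′ → ◇ (P t t′)) → ◇ (λ S x → ∀ t t′ → t ≢ t′ → P t t′ S x)
    decide-pairs n P h = ◇-∀ n λ t → ◇-∀ n λ t′ → pair t t′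
      where
      pair : ∀ t t′ → ◇ (λ S x → t ≢ t′ → P t t′ S x)
      pair t t′ with t Finₚ.≟ t′
      ... | yes e = always λ S x n → ⊥-elim (n e)
      ... | no  n = ◇-map (λ S x h _ → h) (h t t′ n)

    tube-separated : ∀ i j p j≤51 h ok f t t′ → t ≢ t′ → ◇ (λ S x →
      Per (orient f (i , + j)) S x →
      (∀ a b → 1 ≤ b → b < j → ℤ.∣ a ∣ ≤ b → Per (orient f (a , + b)) S x → ⊥) →
      at S x (Patch.Q (orientPiece f (tubePiece i j p j≤51 h ok)) t) ≡ at S x (Patch.Q (orientPiece f (tubePiece i j p j≤51 h ok)) t′) → ⊥)
    tube-separated i (suc j) p j≤51 h ok zero    t t′ t≢t′ = Collision.separated _ j i zero h t t′ t≢t′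
    tube-separated i (suc j) p j≤51 h ok (suc f) t t′ t≢t′ = Collision.separated _ j i (suc f) h t t′ t≢t′

    KindInjective : ∀ κ → Kind κ → Property
    KindInjective κ k S x = class S x ≡ suc κ → ∀ t t′ → t ≢ t′ →
      at S x (Patch.Q (orientPiece (flip κ) (pieceOf κ k)) t) ≡ at S x (Patch.Q (orientPiece (flip κ) (pieceOf κ k)) t′) → ⊥

    kind-injective : ∀ κ k → ◇ (KindInjective κ k)
    kind-injective κ (inadmissible ¬a) = always λ S x e → ⊥-elim (¬a (proj₁ (class-suc S x κ e)))
    kind-injective κ (tooShort p s) = ◇-map (λ S x no e → ⊥-elim (no (proj₁ (proj₂ (class-suc S x κ e)))))
      (no-short (flip κ) (shear κ) (height κ) p s)
    kind-injective κ k@(tube p q v) = ◇-map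
      (λ S x h e t t′ t≢t′ → h t t′ t≢t′ (proj₁ (proj₂ (class-suc S x κ e))) (lower S x (class-suc S x κ e)))
      (decide-pairs _ _ (tube-separated (shear κ) (height κ) p (height≤51 κ) q v (flip κ)))
      where
      lower : ∀ S x → _ × _ × (∀ κ′ → height κ′ < height κ → perᵇ κ′ S x ≡ false) →
              ∀ a b → 1 ≤ b → b < height κ → ℤ.∣ a ∣ ≤ b → Per (orient (flip κ) (a , + b)) S x → ⊥
      lower S x (_ , _ , first) a b 1≤b b<j a≤b per =
        let (κ′ , e , eh , ad) = index a b (flip κ) 1≤b (ℕₚ.≤-trans (ℕₚ.<⇒≤ b<j) (ℕₚ.≤-pred (Finₚ.toℕ<n (level κ)))) a≤b
        in perᵇ-false κ′ S x (first κ′ (subst (_< height κ) (sym eh) b<j)) ad (subst (λ q → Per q S x) (sym e) per)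

    square-separated : ∀ t t′ → t ≢ t′ → ◇ (λ S x → (∀ κ → perᵇ κ S x ≡ false) →
      at S x (box 52 52 t) ≡ at S x (box 52 52 t′) → ⊥)
    square-separated t t′ t≢t′ = ◇-map₂ (λ S x toPer no none e → no none (toPer e))
      (at≡⇒per (box 52 52 t) (box 52 52 t′))
      (no-period-in-square _ _ (λ e → t≢t′ (box-injective 52 52 t t′
          (vec≡ (ℤₚ.i-j≡0⇒i≡j _ _ (cong proj₁ e)) (ℤₚ.i-j≡0⇒i≡j _ _ (cong proj₂ e)))))
        (small (proj₁ (remQuot {52} 52 t)) (proj₁ (remQuot {52} 52 t′)))
        (small (proj₂ (remQuot {52} 52 t)) (proj₂ (remQuot {52} 52 t′))))
      where
      small : ∀ (m n : Fin 52) → ℤ.∣ + toℕ m ℤ.- + toℕ n ∣ ≤ B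
      small m n = ∣pos-difference∣ (bound m) (bound n)
        where
        bound : ∀ (m : Fin 52) → toℕ m ≤ B
        bound m = subst (toℕ m ≤_) (sym B≡51) (ℕₚ.≤-pred (Finₚ.toℕ<n m))

    class-injective : ∀ c → ◇ (Injective c)
    class-injective (suc κ) = kind-injective κ (kind κ)
    class-injective zero    = ◇-map (λ S x h e t t′ t≢t′ → h t t′ t≢t′ (class-zero S x e))
      (decide-pairs _ _ square-separated)

  -- Averaging a minimum dominating set over patches

  ind-∧ : ∀ b c → ind (b ∧ c) ≡ ind b * ind c
  ind-∧ false c     = refl
  ind-∧ true  false = refl
  ind-∧ true  true  = refl

  equalᵇ : ∀ {m} → Fin m → Fin m → Bool
  equalᵇ u v = isYes (u Finₚ.≟ v)

  equalᵇ-≢ : ∀ {m} {u v : Fin m} → u ≢ v → ind (equalᵇ u v) ≡ 0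
  equalᵇ-≢ {u = u} {v} u≢v with u Finₚ.≟ v
  ... | yes e = ⊥-elim (u≢v e)
  ... | no  _ = refl

  sum-zero : ∀ m → sum {m} (λ _ → 0) ≡ 0
  sum-zero m = sum≡0 {m} {λ _ → 0} λ _ → refl

  sum-delta : ∀ {m} (u : Fin m) (f : Fin m → ℕ) → sum (λ v → ind (equalᵇ u v) * f v) ≡ f u
  sum-delta {suc m} zero    f = trans (cong₂ _+_ (ℕₚ.+-identityʳ (f zero)) (sum-zero m)) (ℕₚ.+-identityʳ (f zero))
  sum-delta {suc m} (suc u) f = trans (sum-cong-≗ (λ v → cong (λ b → ind b * f (suc v)) (shift v))) (sum-delta u (f ∘ suc))
    where
    shift : ∀ v → equalᵇ (suc u) (suc v) ≡ equalᵇ u v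
    shift v = isYes-cong (suc u Finₚ.≟ suc v) (u Finₚ.≟ v) Finₚ.suc-injective (cong suc)

  count-partition : ∀ {m n} (f : Fin n → Fin m) (P : Fin n → Bool) →
    sum {m} (λ c → count (λ x → equalᵇ (f x) c ∧ P x)) ≡ count P
  count-partition f P = trans (∑-comm (λ c x → ind (equalᵇ (f x) c ∧ P x)))
    (sum-cong-≗ λ x → trans (sum-cong-≗ λ c → ind-∧ (equalᵇ (f x) c) (P x)) (sum-delta (f x) (λ _ → ind (P x))))

  memberᵇ : ∀ {m} → List (Fin m) → Fin m → Bool
  memberᵇ []       v = false
  memberᵇ (s ∷ ss) v = equalᵇ s v ∨ memberᵇ ss v

  memberᵇ-∈ : ∀ {m} {ss : List (Fin m)} {v} → v ∈ ss → memberᵇ ss v ≡ true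
  memberᵇ-∈ {v = v} (here refl) rewrite isYes⇐ (v Finₚ.≟ v) refl = refl
  memberᵇ-∈ {ss = s ∷ ss} {v} (there h) = trans (cong (equalᵇ s v ∨_) (memberᵇ-∈ h)) (Boolₚ.∨-zeroʳ _)

  ind-∨ : ∀ b c → ind (b ∨ c) ≤ ind b + ind c
  ind-∨ true  c = s≤s z≤n
  ind-∨ false c = ℕₚ.≤-refl

  count-member : ∀ {m} (ss : List (Fin m)) → count (memberᵇ ss) ≤ length ss
  count-member {m} []       = ℕₚ.≤-reflexive (sum-zero m)
  count-member     (s ∷ ss) = begin
    count (memberᵇ (s ∷ ss)) ≤⟨ sum-mono (λ v → ind-∨ (equalᵇ s v) (memberᵇ ss v)) ⟩
    sum (λ v → ind (equalᵇ s v) + ind (memberᵇ ss v)) ≡⟨ ∑-distrib-+ (ind ∘ equalᵇ s) _ ⟩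
    sum (λ v → ind (equalᵇ s v)) + count (memberᵇ ss) ≡⟨ cong (λ z → z + count (memberᵇ ss)) (trans (sum-cong-≗ λ v → sym (ℕₚ.*-identityʳ (ind (equalᵇ s v)))) (sum-delta s (λ _ → 1))) ⟩
    1 + count (memberᵇ ss) ≤⟨ s≤s (count-member ss) ⟩
    suc (length ss) ∎
    where open ℕₚ.≤-Reasoning

  module Minimal (S : System) (D : Fin (System.nv S) → Bool)
    (dominating : ∀ v → ∃ λ u → D u ≡ true × Dominates S u v)
    (minimal : ∀ (D′ : Fin (System.nv S) → Bool) → (∀ v → ∃ λ u → D′ u ≡ true × Dominates S u v) → count D ≤ count D′)
    where
    open System S

    -- A vertex whose dominator was removed lies in the closed neighbourhood of the patch and is
    -- dominated from `ss`; every other vertex keeps its dominator. Injectivity of `p` lets cells be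
    -- counted as vertices.
    exchange : ∀ {q} (p : Fin q → Fin nv) (ss : List (Fin nv)) →
      (∀ t t′ → p t ≡ p t′ → t ≡ t′) →
      (∀ t v → Dominates S (p t) v → ∃ λ s → s ∈ ss × Dominates S s v) →
      count (D ∘ p) ≤ length ss
    exchange {q} p ss p-injective covers = ℕₚ.≤-trans below (ℕₚ.+-cancelˡ-≤ (count outside) _ _ (begin
      count outside + count inside ≡⟨ ∑-distrib-+ (ind ∘ outside) (ind ∘ inside) ⟨
      sum (λ v → ind (outside v) + ind (inside v)) ≡⟨ sum-cong-≗ split ⟩
      count D ≤⟨ minimal D′ dominating′ ⟩
      count D′ ≤⟨ sum-mono (λ v → ind-∨ (outside v) (memberᵇ ss v)) ⟩
      sum (λ v → ind (outside v) + ind (memberᵇ ss v)) ≡⟨ ∑-distrib-+ (ind ∘ outside) (ind ∘ memberᵇ ss) ⟩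
      count outside + count (memberᵇ ss) ≤⟨ ℕₚ.+-monoʳ-≤ (count outside) (count-member ss) ⟩
      count outside + length ss ∎))
      where
      open ℕₚ.≤-Reasoning
      image? : ∀ v → Dec (∃ λ t → p t ≡ v)
      image? v = Finₚ.any? λ t → p t Finₚ.≟ v
      inside outside D′ : Fin nv → Bool
      inside v  = D v ∧ isYes (image? v)
      outside v = D v ∧ not (isYes (image? v))
      D′ v      = outside v ∨ memberᵇ ss v
      split : ∀ v → ind (outside v) + ind (inside v) ≡ ind (D v)
      split v with D v | isYes (image? v)
      ... | false | _     = refl
      ... | true  | false = refl
      ... | true  | true  = refl
      dominating′ : ∀ v → ∃ λ u → D′ u ≡ true × Dominates S u v
      dominating′ v with dominating v
      ... | u , Du , h with image? u in e
      ...   | yes (t , refl) = let (s , s∈ , h′) = covers t v h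
                               in s , trans (cong (outside s ∨_) (memberᵇ-∈ s∈)) (Boolₚ.∨-zeroʳ _) , h′
      ...   | no _ = u , cong₂ (λ b c → (b ∧ not c) ∨ memberᵇ ss u) Du (cong isYes e) , h
      below : count (D ∘ p) ≤ count inside
      below = begin
        sum (λ t → ind (D (p t))) ≡⟨ sum-cong-≗ (λ t → sum-delta (p t) (ind ∘ D)) ⟨
        sum (λ t → sum (λ v → ind (equalᵇ (p t) v) * ind (D v))) ≡⟨ ∑-comm (λ t v → ind (equalᵇ (p t) v) * ind (D v)) ⟩
        sum (λ v → sum (λ t → ind (equalᵇ (p t) v) * ind (D v))) ≤⟨ sum-mono per-vertex ⟩
        count inside ∎
        where
        per-vertex : ∀ v → sum (λ t → ind (equalᵇ (p t) v) * ind (D v)) ≤ ind (inside v)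
        per-vertex v = begin
          sum (λ t → ind (equalᵇ (p t) v) * ind (D v)) ≡⟨ sum-cong-≗ (λ t → ℕₚ.*-comm (ind (equalᵇ (p t) v)) (ind (D v))) ⟩
          sum (λ t → ind (D v) * ind (equalᵇ (p t) v)) ≡⟨ sum-*ˡ (ind (D v)) (λ t → ind (equalᵇ (p t) v)) ⟩
          ind (D v) * count (λ t → equalᵇ (p t) v) ≤⟨ ℕₚ.*-monoʳ-≤ (ind (D v)) (preimages v) ⟩
          ind (D v) * ind (isYes (image? v)) ≡⟨ ind-∧ (D v) _ ⟨
          ind (inside v) ∎
          where
          preimages : ∀ v → count (λ t → equalᵇ (p t) v) ≤ ind (isYes (image? v))
          preimages v with image? v
          ... | yes _ = count-unique _ λ t t′ e e′ t<t′ → ℕₚ.<⇒≢ t<t′ (cong toℕ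
                          (p-injective t t′ (trans (isYes⇒ (p t Finₚ.≟ v) e) (sym (isYes⇒ (p t′ Finₚ.≟ v) e′)))))
          ... | no ¬i = ℕₚ.≤-reflexive (sum≡0 λ t → equalᵇ-≢ λ e → ¬i (t , e))

  *-cancelˡ-≤-0< : ∀ s {a b} → 0 < s → s * a ≤ s * b → a ≤ b
  *-cancelˡ-≤-0< (suc s) _ h = ℕₚ.*-cancelˡ-≤ (suc s) h

  scaled-sum : ∀ {m} W n (f c : Fin m → ℕ) → (∀ i → W * f i ≤ c i * n) → W * sum f ≤ sum c * n
  scaled-sum {m} W n f c h = begin
    W * sum f ≡⟨ sum-*ˡ W f ⟨
    sum (λ i → W * f i) ≤⟨ sum-mono h ⟩
    sum (λ i → c i * n) ≡⟨ sum-cong-≗ (λ i → ℕₚ.*-comm (c i) n) ⟩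
    sum (λ i → n * c i) ≡⟨ sum-*ˡ n c ⟩
    n * sum c ≡⟨ ℕₚ.*-comm n (sum c) ⟩
    sum c * n ∎
    where open ℕₚ.≤-Reasoning

  common-bound : ∀ n {P : Fin n → ℕ → Set} → (∀ i {K L} → K ≤ L → P i K → P i L) → (∀ i → ∃ (P i)) → ∃ λ K → ∀ i → P i K
  common-bound zero    mono h = 0 , λ ()
  common-bound (suc n) mono h =
    let (K , p) = h zero
        (L , q) = common-bound n (λ i → mono (suc i)) (λ i → h (suc i))
    in K ⊔ L , λ { zero → mono zero (ℕₚ.m≤m⊔n K L) p ; (suc i) → mono (suc i) (ℕₚ.m≤n⊔m K L) (q i) }

  SparseAt : ℕ → Vec → ℕ → ℕ → Set
  SparseAt k d W K = ∀ S → K < System.nf S → W * count (λ y → System.deep S K y ∧ turnedᵇ k d S y) ≤ 2 * System.nf S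

  sparseAt-mono : ∀ k d W {K L} → K ≤ L → SparseAt k d W K → SparseAt k d W L
  sparseAt-mono k d W {K} {L} K≤L h S L<n = ℕₚ.≤-trans
    (ℕₚ.*-monoʳ-≤ W (sum-mono λ y → ind-mono λ e → cong₂ _∧_ (System.deep-mono S y K≤L (proj₁ (∧-true e))) (proj₂ (∧-true {System.deep S L y} e))))
    (h S (ℕₚ.≤-<-trans K≤L L<n))

  -- Twice the number of conceivable collisions inside patches of the given sizes.
  eventsOf : ∀ m → (Fin m → ℕ) → ℕ
  eventsOf m size = sum {m} λ c → sum {size c} λ t → sum {size c} λ t′ → sum {11} λ k → 2

  eventsOf-positive : ∀ m (size : Fin (suc m) → ℕ) → 0 < size zero → 0 < eventsOf (suc m) size
  eventsOf-positive m size h = ℕₚ.<-≤-trans (first (size zero) h)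
    (term≤sum {suc m} (λ c → sum {size c} λ t → sum {size c} λ t′ → sum {11} λ k → 2) zero)
    where
    first : ∀ n → 0 < n → 0 < sum {n} (λ t → sum {n} λ t′ → sum {11} λ k → 2)
    first (suc n) _ = s≤s z≤n

  sparse-family : ∀ m (size : Fin m → ℕ) (d : ∀ c → Fin (size c) → Fin (size c) → Vec) W →
    ∃ λ K → ∀ c t t′ (k : Fin 11) → SparseAt (suc (toℕ k)) (d c t t′) W K
  sparse-family m size d W =
    common-bound m {λ c K → ∀ t t′ k → At c t t′ k K} (λ c K≤L h t t′ k → mono c t t′ k K≤L (h t t′ k)) λ c →
    common-bound (size c) {λ t K → ∀ t′ k → At c t t′ k K} (λ t K≤L h t′ k → mono c t t′ k K≤L (h t′ k)) λ t →
    common-bound (size c) {λ t′ K → ∀ k → At c t t′ k K} (λ t′ K≤L h k → mono c t t′ k K≤L (h k)) λ t′ →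
    common-bound 11 {λ k K → At c t t′ k K} (λ k → mono c t t′ k) λ k → sparse-turns k (d c t t′) W
    where
    At : ∀ c (t t′ : Fin (size c)) → Fin 11 → ℕ → Set
    At c t t′ k K = SparseAt (suc (toℕ k)) (d c t t′) W K
    mono : ∀ c t t′ k {K L} → K ≤ L → At c t t′ k K → At c t t′ k L
    mono c t t′ k = sparseAt-mono (suc (toℕ k)) (d c t t′) W

  record Classification (E : ℕ) : Set where
    field
      indices : ℕ
    classes : ℕ
    classes = suc indices
    field
      period : Fin classes → Vec
      patch  : ∀ c → Patch E (period c)
      class  : (S : System) → System.Flag S → Fin classes
      class-dominates : ∀ c → ◇ (λ S x → class S x ≡ c → ∀ t v →
        Dominates S (System.vtx S (at S x (Patch.Q (patch c) t))) v →
        ∃ λ s → s ∈ Patch.S (patch c) × Dominates S (System.vtx S (at S x s)) v)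
      class-injective : ∀ c → ◇ (λ S x → class S x ≡ c → ∀ t t′ → t ≢ t′ →
        at S x (Patch.Q (patch c) t) ≡ at S x (Patch.Q (patch c) t′) → ⊥)
      class-invariant : ∀ p → ◇ (λ S x → class S (at S x p) ≡ class S x)

  module Count (E : ℕ) (classification : Classification E) where
    open Classification classification

    size : Fin classes → ℕ
    size c = Patch.size (patch c)

    Q : ∀ c → Fin (size c) → Vec
    Q c = Patch.Q (patch c)

    cost : Fin classes → ℕ
    cost c = length (Patch.S (patch c))

    events : ℕ
    events = eventsOf classes size

    -- Each kind of collision takes at most the fraction `2/W` of the flags. `events` adds up these
    -- twos over all kinds, so all collisions together number at most `nf/E`.
    W : ℕ
    W = events * E

    sparse-everywhere : ∃ λ K → ∀ c t t′ k → SparseAt (suc (toℕ k)) (Q c t ⊖ Q c t′) W K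
    sparse-everywhere = sparse-family classes size (λ c t t′ → Q c t ⊖ Q c t′) W

    -- What is needed at a flag to bound the number of dominating vertices in its patch.
    record Clear (K₁ : ℕ) (S : System) (x : System.Flag S) : Set where
      field
        dominates : ∀ c → class S x ≡ c → ∀ t v → Dominates S (System.vtx S (at S x (Q c t))) v →
                    ∃ λ s → s ∈ Patch.S (patch c) × Dominates S (System.vtx S (at S x s)) v
        injective : ∀ c → class S x ≡ c → ∀ t t′ → t ≢ t′ → at S x (Q c t) ≡ at S x (Q c t′) → ⊥
        deep-at   : ∀ c t → System.Deep S K₁ (at S x (Q c t))
        returns   : ∀ c t t′ → at S (at S x (Q c t′)) (Q c t ⊖ Q c t′) ≡ at S x (Q c t)

    clear : ∀ K₁ → ◇ (Clear K₁)
    clear K₁ = ◇-map₂ (λ S x p q → record { dominates = proj₁ p ; injective = proj₂ p ; deep-at = proj₁ q ; returns = proj₂ q })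
      (◇-map₂ (λ S x a b → a , b) (◇-∀ classes class-dominates) (◇-∀ classes class-injective))
      (◇-map₂ (λ S x a b → a , b)
        (◇-∀ classes λ c → ◇-∀ (size c) λ t → ◇-run (tr (Q c t)) (◇-deep K₁))
        (◇-∀ classes λ c → ◇-∀ (size c) λ t → ◇-∀ (size c) λ t′ →
          at-cancel (Q c t′) (Q c t) (Q c t ⊖ Q c t′) (trans (⊕-comm (Q c t′) (Q c t ⊖ Q c t′)) (⊖-⊕-cancel (Q c t) (Q c t′)))))

    -- The flag from which y is reached by Q c t.
    record Source (K : ℕ) (S : System) (y : System.Flag S) : Set where
      field
        same-class : ∀ c t → class S (at S y (𝟎 ⊖ Q c t)) ≡ class S y
        deep-at    : ∀ c t → System.Deep S K (at S y (𝟎 ⊖ Q c t))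
        back       : ∀ c t → at S (at S y (𝟎 ⊖ Q c t)) (Q c t) ≡ y

    source : ∀ K → ◇ (Source K)
    source K = ◇-map₃ (λ S x p q r → record { same-class = p ; deep-at = q ; back = r })
      (◇-∀ classes λ c → ◇-∀ (size c) λ t → class-invariant (𝟎 ⊖ Q c t))
      (◇-∀ classes λ c → ◇-∀ (size c) λ t → ◇-run (tr (𝟎 ⊖ Q c t)) (◇-deep K))
      (◇-∀ classes λ c → ◇-∀ (size c) λ t → at-cancel (𝟎 ⊖ Q c t) 𝟎 (Q c t) (⊖-⊕-cancel 𝟎 (Q c t)))

    module Fixed
      (K₁ K K₂ : ℕ) (S : System)
      (sparse : ∀ c t t′ (k : Fin 11) → W * count (λ y → System.deep S K₁ y ∧ turnedᵇ (suc (toℕ k)) (Q c t ⊖ Q c t′) S y) ≤ 2 * System.nf S)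
      (clearAt : ∀ x → System.Deep S K x → Clear K₁ S x)
      (sourceAt : ∀ y → System.Deep S K₂ y → Source K S y)
      (D : Fin (System.nv S) → Bool)
      (dominating : ∀ v → ∃ λ u → D u ≡ true × Dominates S u v)
      (minimal : ∀ (D′ : Fin (System.nv S) → Bool) → (∀ v → ∃ λ u → D′ u ≡ true × Dominates S u v) → count D ≤ count D′)
      where
      open System S
      open Minimal S D dominating minimal

      D̃ : Flag → Bool
      D̃ x = D (vtx x)

      event : ∀ c (t t′ : Fin (size c)) (k : Fin 11) → Flag → Bool
      event c t t′ k y = deep K₁ y ∧ turnedᵇ (suc (toℕ k)) (Q c t ⊖ Q c t′) S y

      collisions : Fin classes → Flag → ℕ
      collisions c x = sum λ t → sum λ t′ → sum {11} λ k → ind (event c t t′ k (at S x (Q c t′)))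

      hits : Fin classes → Flag → ℕ
      hits c x = count λ t → D̃ (at S x (Q c t))

      member : Fin classes → Flag → Bool
      member c x = equalᵇ (class S x) c ∧ deep K x

      -- Flags at one good vertex differ by some `alt k` with `k` < 12. The case `k = 0` contradicts
      -- injectivity on flags; the other eleven are the events being counted.
      collision⇒ : ∀ c x → class S x ≡ c → Clear K₁ S x → ∀ t t′ → t ≢ t′ →
                   vtx (at S x (Q c t)) ≡ vtx (at S x (Q c t′)) → 1 ≤ collisions c x
      collision⇒ c x cx cl t t′ t≢t′ e with good-orbit (at S x (Q c t′)) (deep-good K₁ _ (Clear.deep-at cl c t′)) _ e
      ... | zero  , _ , h = ⊥-elim (Clear.injective cl c cx t t′ t≢t′ h)
      ... | suc k , s≤s k<11 , h = ℕₚ.≤-trans (ℕₚ.≤-reflexive (cong ind (sym occurs)))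
          (ℕₚ.≤-trans (term≤sum (λ k → ind (event c t t′ k (at S x (Q c t′)))) κ)
          (ℕₚ.≤-trans (term≤sum (λ t′ → sum λ k → ind (event c t t′ k (at S x (Q c t′)))) t′)
            (term≤sum (λ t → sum λ t′ → sum λ k → ind (event c t t′ k (at S x (Q c t′)))) t)))
        where
        κ = fromℕ< k<11
        occurs : event c t t′ κ (at S x (Q c t′)) ≡ true
        occurs = cong₂ _∧_ (Clear.deep-at cl c t′) (isYes⇐ (_ Finₚ.≟ _)
          (trans (Clear.returns cl c t t′) (trans h (cong (λ m → run (alt (suc m)) (at S x (Q c t′))) (sym (Finₚ.toℕ-fromℕ< k<11))))))

      no-collision : ∀ c x → class S x ≡ c → Clear K₁ S x → collisions c x ≡ 0 → hits c x ≤ cost c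
      no-collision c x cx cl none = ℕₚ.≤-trans
        (exchange (λ t → vtx (at S x (Q c t))) (map (λ s → vtx (at S x s)) (Patch.S (patch c))) inj cov)
        (ℕₚ.≤-reflexive (List.length-map (λ s → vtx (at S x s)) (Patch.S (patch c))))
        where
        inj : ∀ t t′ → vtx (at S x (Q c t)) ≡ vtx (at S x (Q c t′)) → t ≡ t′
        inj t t′ eq = decide (t Finₚ.≟ t′)
          where
          decide : Dec (t ≡ t′) → t ≡ t′
          decide (yes t≡t′) = t≡t′
          decide (no  t≢t′) = ⊥-elim (ℕₚ.<⇒≢ (collision⇒ c x cx cl t t′ t≢t′ eq) (sym none))
        cov : ∀ t v → Dominates S (vtx (at S x (Q c t))) v → ∃ λ s → s ∈ map (λ s → vtx (at S x s)) (Patch.S (patch c)) × Dominates S s v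
        cov t v d = let (s , s∈ , d′) = Clear.dominates cl c cx t v d in vtx (at S x s) , ∈-map⁺ (λ s → vtx (at S x s)) s∈ , d′

      -- With at least one collision the trivial bound `size c` is good enough, since collisions are
      -- rare.
      hits-bound : ∀ c x → member c x ≡ true → hits c x ≤ cost c + size c * collisions c x
      hits-bound c x h = cases (collisions c x) refl
        where
        cases : ∀ n → collisions c x ≡ n → hits c x ≤ cost c + size c * n
        cases (suc n) _ = ℕₚ.≤-trans (count≤ (λ t → D̃ (at S x (Q c t)))) (ℕₚ.≤-trans (ℕₚ.m≤m*n (size c) (suc n)) (ℕₚ.m≤n+m _ (cost c)))
        cases zero    e = ℕₚ.≤-trans (no-collision c x (isYes⇒ (class S x Finₚ.≟ c) (proj₁ (∧-true h)))
                            (clearAt x (proj₂ (∧-true {equalᵇ (class S x) c} h))) e) (ℕₚ.m≤m+n (cost c) _)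

      inner : Fin classes → Flag → Bool
      inner c y = equalᵇ (class S y) c ∧ (deep K₂ y ∧ D̃ y)

      -- A flag `y` occupies position `t` in the patch of its translate by `𝟎 ⊖ Q c t`, which has
      -- the same class. The passage from `y` to this translate is a bijection of all flags.
      shifted : ∀ c t → count (inner c) ≤ sum (λ x → ind (member c x) * ind (D̃ (at S x (Q c t))))
      shifted c t = begin
        count (inner c) ≤⟨ sum-mono pointwise ⟩
        sum (λ y → h (run (tr (𝟎 ⊖ Q c t)) y)) ≡⟨ sum-run S (tr (𝟎 ⊖ Q c t)) h ⟩
        sum h ∎
        where
        open ℕₚ.≤-Reasoning
        h : Flag → ℕ
        h x = ind (member c x) * ind (D̃ (at S x (Q c t)))
        pointwise : ∀ y → ind (inner c y) ≤ h (at S y (𝟎 ⊖ Q c t))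
        pointwise y = ℕₚ.≤-trans (ind-mono transfer) (ℕₚ.≤-reflexive (ind-∧ (member c (at S y (𝟎 ⊖ Q c t))) _))
          where
          transfer : inner c y ≡ true → member c (at S y (𝟎 ⊖ Q c t)) ∧ D̃ (at S (at S y (𝟎 ⊖ Q c t)) (Q c t)) ≡ true
          transfer e =
            let (cy , e′) = ∧-true {equalᵇ (class S y) c} e
                (dy , Dy) = ∧-true {deep K₂ y} e′
                src = sourceAt y dy
            in cong₂ _∧_ (cong₂ _∧_ (trans (cong (λ z → equalᵇ z c) (Source.same-class src c t)) cy) (Source.deep-at src c t))
                         (trans (cong D̃ (Source.back src c t)) Dy)

      class-total : ∀ c → size c * count (inner c) ≤ cost c * count (member c) + size c * sum (collisions c)
      class-total c = begin
        size c * count (inner c) ≡⟨ sum-const (size c) (count (inner c)) ⟨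
        sum {size c} (λ t → count (inner c)) ≤⟨ sum-mono (shifted c) ⟩
        sum (λ t → sum (λ x → ind (member c x) * ind (D̃ (at S x (Q c t))))) ≡⟨ ∑-comm (λ t x → ind (member c x) * ind (D̃ (at S x (Q c t)))) ⟩
        sum (λ x → sum (λ t → ind (member c x) * ind (D̃ (at S x (Q c t))))) ≡⟨ sum-cong-≗ (λ x → sum-*ˡ (ind (member c x)) (λ t → ind (D̃ (at S x (Q c t))))) ⟩
        sum (λ x → ind (member c x) * hits c x) ≤⟨ sum-mono pointwise ⟩
        sum (λ x → cost c * ind (member c x) + size c * collisions c x) ≡⟨ ∑-distrib-+ (λ x → cost c * ind (member c x)) (λ x → size c * collisions c x) ⟩
        sum (λ x → cost c * ind (member c x)) + sum (λ x → size c * collisions c x) ≡⟨ cong₂ _+_ (sum-*ˡ (cost c) (ind ∘ member c)) (sum-*ˡ (size c) (collisions c)) ⟩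
        cost c * count (member c) + size c * sum (collisions c) ∎
        where
        open ℕₚ.≤-Reasoning
        pointwise : ∀ x → ind (member c x) * hits c x ≤ cost c * ind (member c x) + size c * collisions c x
        pointwise x = cases (member c x) refl
          where
          cases : ∀ b → member c x ≡ b → ind b * hits c x ≤ cost c * ind b + size c * collisions c x
          cases false _ = z≤n
          cases true  e = ℕₚ.≤-trans (ℕₚ.≤-reflexive (ℕₚ.+-identityʳ (hits c x)))
            (ℕₚ.≤-trans (hits-bound c x e) (ℕₚ.≤-reflexive (cong (λ z → z + size c * collisions c x) (sym (ℕₚ.*-identityʳ (cost c))))))

      class-bound : ∀ c → (6 * E) * count (inner c) ≤ (E + 6) * count (member c) + (6 * E) * sum (collisions c)
      class-bound c = *-cancelˡ-≤-0< (size c) (Patch.nonempty (patch c)) (begin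
        size c * ((6 * E) * count (inner c)) ≡⟨ ring₁ (size c) (6 * E) (count (inner c)) ⟩
        (6 * E) * (size c * count (inner c)) ≤⟨ ℕₚ.*-monoʳ-≤ (6 * E) (class-total c) ⟩
        (6 * E) * (cost c * count (member c) + size c * sum (collisions c)) ≡⟨ ring₂ (6 * E) (cost c) (count (member c)) (size c) (sum (collisions c)) ⟩
        ((6 * E) * cost c) * count (member c) + size c * ((6 * E) * sum (collisions c)) ≤⟨ ℕₚ.+-monoˡ-≤ _ (ℕₚ.*-monoˡ-≤ (count (member c)) (Patch.density (patch c))) ⟩
        ((E + 6) * size c) * count (member c) + size c * ((6 * E) * sum (collisions c)) ≡⟨ ring₃ (E + 6) (size c) (count (member c)) ((6 * E) * sum (collisions c)) ⟩
        size c * ((E + 6) * count (member c) + (6 * E) * sum (collisions c)) ∎)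
        where
        open ℕₚ.≤-Reasoning
        ring₁ : ∀ s e n → s * (e * n) ≡ e * (s * n)
        ring₁ = solve-∀ℕ
        ring₂ : ∀ e l m s n → e * (l * m + s * n) ≡ (e * l) * m + s * (e * n)
        ring₂ = solve-∀ℕ
        ring₃ : ∀ a s m n → (a * s) * m + s * n ≡ s * (a * m + n)
        ring₃ = solve-∀ℕ

      few-collisions : E * sum (λ c → sum (collisions c)) ≤ nf
      few-collisions = *-cancelˡ-≤-0< events (eventsOf-positive indices size (Patch.nonempty (patch zero))) (ℕₚ.≤-trans (ℕₚ.≤-reflexive (sym (ℕₚ.*-assoc events E _)))
        (scaled-sum W nf (λ c → sum (collisions c)) (λ c → sum {size c} λ t → sum {size c} λ t′ → sum {11} λ k → 2) λ c → begin
          W * sum (collisions c) ≡⟨ cong (W *_) (exchange-sums c) ⟩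
          W * sum (λ t → sum λ t′ → sum λ k → count (event c t t′ k))
            ≤⟨ scaled-sum W nf _ (λ t → sum {size c} λ t′ → sum {11} λ k → 2) (λ t → scaled-sum W nf _ (λ t′ → sum {11} λ k → 2) λ t′ → scaled-sum W nf _ (λ k → 2) λ k → sparse c t t′ k) ⟩
          sum {size c} (λ t → sum {size c} λ t′ → sum {11} λ k → 2) * nf ∎))
        where
        open ℕₚ.≤-Reasoning
        exchange-sums : ∀ c → sum (collisions c) ≡ sum (λ t → sum λ t′ → sum λ k → count (event c t t′ k))
        exchange-sums c = trans (∑-comm (λ x t → sum λ t′ → sum λ k → ind (event c t t′ k (at S x (Q c t′)))))
          (sum-cong-≗ λ t → trans (∑-comm (λ x t′ → sum λ k → ind (event c t t′ k (at S x (Q c t′)))))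
          (sum-cong-≗ λ t′ → trans (∑-comm (λ x k → ind (event c t t′ k (at S x (Q c t′)))))
          (sum-cong-≗ λ k → sum-run S (tr (Q c t′)) (ind ∘ event c t t′ k))))

      -- Summed over classes, the patches contribute `E + 6` per flag, and the collisions 6 more.
      inner-bound : (6 * E) * count (λ y → deep K₂ y ∧ D̃ y) ≤ (E + 12) * nf
      inner-bound = begin
        (6 * E) * count (λ y → deep K₂ y ∧ D̃ y) ≡⟨ cong ((6 * E) *_) (count-partition (class S) (λ y → deep K₂ y ∧ D̃ y)) ⟨
        (6 * E) * sum (λ c → count (inner c)) ≡⟨ sum-*ˡ (6 * E) (λ c → count (inner c)) ⟨
        sum (λ c → (6 * E) * count (inner c)) ≤⟨ sum-mono class-bound ⟩
        sum (λ c → (E + 6) * count (member c) + (6 * E) * sum (collisions c)) ≡⟨ ∑-distrib-+ (λ c → (E + 6) * count (member c)) (λ c → (6 * E) * sum (collisions c)) ⟩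
        sum (λ c → (E + 6) * count (member c)) + sum (λ c → (6 * E) * sum (collisions c))
          ≡⟨ cong₂ _+_ (sum-*ˡ (E + 6) (λ c → count (member c))) (sum-*ˡ (6 * E) (λ c → sum (collisions c))) ⟩
        (E + 6) * sum (λ c → count (member c)) + (6 * E) * total ≡⟨ cong₂ (λ u v → (E + 6) * u + v) (count-partition (class S) (deep K)) (ℕₚ.*-assoc 6 E total) ⟩
        (E + 6) * count (deep K) + 6 * (E * total) ≤⟨ ℕₚ.+-mono-≤ (ℕₚ.*-monoʳ-≤ (E + 6) (count≤ (deep K))) (ℕₚ.*-monoʳ-≤ 6 few-collisions) ⟩
        (E + 6) * nf + 6 * nf ≡⟨ ring E nf ⟩
        (E + 12) * nf ∎
        where
        open ℕₚ.≤-Reasoning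
        total = sum (λ c → sum (collisions c))
        ring : ∀ e n → (e + 6) * n + 6 * n ≡ (e + 12) * n
        ring = solve-∀ℕ

      flag-bound : (6 * E) * count D̃ ≤ (E + 12) * nf + (6 * E) * (4 ^ K₂ * count (λ x → not (good (vtx x))))
      flag-bound = begin
        (6 * E) * count D̃ ≤⟨ ℕₚ.*-monoʳ-≤ (6 * E) (sum-mono pointwise) ⟩
        (6 * E) * sum (λ y → ind (deep K₂ y ∧ D̃ y) + ind (not (deep K₂ y))) ≡⟨ cong ((6 * E) *_) (∑-distrib-+ (λ y → ind (deep K₂ y ∧ D̃ y)) (λ y → ind (not (deep K₂ y)))) ⟩
        (6 * E) * (count (λ y → deep K₂ y ∧ D̃ y) + count (not ∘ deep K₂)) ≡⟨ ℕₚ.*-distribˡ-+ (6 * E) _ _ ⟩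
        (6 * E) * count (λ y → deep K₂ y ∧ D̃ y) + (6 * E) * count (not ∘ deep K₂) ≤⟨ ℕₚ.+-mono-≤ inner-bound (ℕₚ.*-monoʳ-≤ (6 * E) (count-nondeep S K₂)) ⟩
        (E + 12) * nf + (6 * E) * (4 ^ K₂ * count (λ x → not (good (vtx x)))) ∎
        where
        open ℕₚ.≤-Reasoning
        pointwise : ∀ y → ind (D̃ y) ≤ ind (deep K₂ y ∧ D̃ y) + ind (not (deep K₂ y))
        pointwise y with deep K₂ y
        ... | true  = ℕₚ.m≤m+n _ 0
        ... | false = ind≤1 (D̃ y)

  IsMinimumDominating : (S : System) → (Fin (System.nv S) → Bool) → Set
  IsMinimumDominating S D =
    (∀ v → ∃ λ u → D u ≡ true × Dominates S u v) ×
    (∀ (D′ : Fin (System.nv S) → Bool) → (∀ v → ∃ λ u → D′ u ≡ true × Dominates S u v) → count D ≤ count D′)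

  FlagBound : ℕ → ℕ → ℕ → Set
  FlagBound E K C = ∀ S → K < System.nf S → ∀ D → IsMinimumDominating S D →
    (6 * E) * count (λ x → D (System.vtx S x)) ≤ (E + 12) * System.nf S + C * count (λ x → not (System.good S (System.vtx S x)))

  module _ (E : ℕ) (classification : Classification E) where
    open Count E classification

    -- The depths depend on each other in this order: `K₁` makes coincidences sparse, `K` puts all
    -- cells of a patch at depth `K₁`, and `K₂` puts all translates used in `shifted` at depth `K`.
    assemble-source : ∀ K₁ → (∀ c t t′ k → SparseAt (suc (toℕ k)) (Q c t ⊖ Q c t′) W K₁) →
                      ∀ K → (∀ S → K < System.nf S → ∀ x → System.Deep S K x → Clear K₁ S x) →
                      ◇ (Source K) → ∃₂ λ K C → FlagBound E K C
    assemble-source K₁ sparse K clearAt (K₂ , sourceAt) = K₁ ⊔ (K ⊔ K₂) , (6 * E) * 4 ^ K₂ , λ S large D (dom , min) →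
      subst (λ z → (6 * E) * count (λ x → D (System.vtx S x)) ≤ (E + 12) * System.nf S + z) (sym (ℕₚ.*-assoc (6 * E) (4 ^ K₂) _))
      (Fixed.flag-bound K₁ K K₂ S
        (λ c t t′ k → sparse c t t′ k S (ℕₚ.≤-<-trans (ℕₚ.m≤m⊔n K₁ _) large))
        (clearAt S (ℕₚ.≤-<-trans (ℕₚ.≤-trans (ℕₚ.m≤m⊔n K K₂) (ℕₚ.m≤n⊔m K₁ _)) large))
        (sourceAt S (ℕₚ.≤-<-trans (ℕₚ.≤-trans (ℕₚ.m≤n⊔m K K₂) (ℕₚ.m≤n⊔m K₁ _)) large))
        D dom min)

    assemble-clear : ∀ K₁ → (∀ c t t′ k → SparseAt (suc (toℕ k)) (Q c t ⊖ Q c t′) W K₁) → ◇ (Clear K₁) → ∃₂ λ K C → FlagBound E K C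
    assemble-clear K₁ sparse (K , clearAt) = assemble-source K₁ sparse K clearAt (source K)

    assemble : (∃ λ K₁ → ∀ c t t′ k → SparseAt (suc (toℕ k)) (Q c t ⊖ Q c t′) W K₁) → ∃₂ λ K C → FlagBound E K C
    assemble (K₁ , sparse) = assemble-clear K₁ sparse (clear K₁)

    flag-bounds-from : ∃₂ λ K C → FlagBound E K C
    flag-bounds-from = assemble sparse-everywhere

  periodClassification : ∀ B → B ≡ 51 → ∀ E′ → Classification (suc E′)
  periodClassification B B≡51 E′ = record { Classes B B≡51 E′ }

  flag-bounds : ∀ E′ → ∃₂ λ K C → FlagBound (suc E′) K C
  flag-bounds E′ = flag-bounds-from (suc E′) (periodClassification 51 refl E′)

  -- From triangulations to systems

  least : ∀ (P : ℕ → Set) → (∀ k → Dec (P k)) → ∀ n → P n → ∃ λ m → P m × (∀ k → k < m → ¬ P k)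
  least P P? n p with P? 0
  ... | yes p₀ = 0 , p₀ , λ k ()
  least P P? zero    p | no ¬p₀ = ⊥-elim (¬p₀ p)
  least P P? (suc n) p | no ¬p₀ with least (P ∘ suc) (P? ∘ suc) n p
  ... | m , pm , below = suc m , pm , λ { zero _ → ¬p₀ ; (suc k) (s≤s k<m) → below k k<m }

  -- The orbit of y under two fixed-point-free involutions is a 2m-gon, m being the order of the rotation b ∘ a at y.
  module Dihedral {N : ℕ} (a b : Fin N → Fin N)
    (inv-a : ∀ x → a (a x) ≡ x) (inv-b : ∀ x → b (b x) ≡ x)
    (fpf-a : ∀ x → a x ≢ x) (fpf-b : ∀ x → b x ≢ x) where

    ρ : Fin N → Fin N
    ρ x = b (a x)

    ρ^ : ℕ → Fin N → Fin N
    ρ^ = iterate ρ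

    ρ-injective : ∀ {x y} → ρ x ≡ ρ y → x ≡ y
    ρ-injective {x} {y} e = trans (sym (back x)) (trans (cong (λ z → a (b z)) e) (back y))
      where
      back : ∀ x → a (b (ρ x)) ≡ x
      back x = trans (cong a (inv-b (a x))) (inv-a x)

    ρ^-injective : ∀ n {x y} → ρ^ n x ≡ ρ^ n y → x ≡ y
    ρ^-injective zero    e = e
    ρ^-injective (suc n) e = ρ^-injective n (ρ-injective e)

    ρ^-suc : ∀ n x → ρ^ n (ρ x) ≡ ρ^ (suc n) x
    ρ^-suc zero    x = refl
    ρ^-suc (suc n) x = cong ρ (ρ^-suc n x)

    -- If `ρ^ (n + 2) u = b u`, then `ρ^ n (ρ u) = b (ρ u)`, because `ρ ∘ b ∘ ρ = b`. The descent
    -- ends at a fixed point of `a` or of `b`.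
    not-reflected : ∀ n u → ρ^ n u ≢ b u
    not-reflected 0             u e = fpf-b u (sym e)
    not-reflected 1             u e = fpf-a u (trans (sym (inv-b (a u))) (trans (cong b e) (inv-b u)))
    not-reflected (suc (suc n)) u e = not-reflected n (ρ u) (trans (ρ^-suc n u) (ρ-injective (trans e
      (sym (trans (cong (λ z → b (a z)) (inv-b (a u))) (cong b (inv-a u)))))))

    returns : ∀ y → ∃ λ n → ρ^ (suc n) y ≡ y
    returns y with Finₚ.pigeonhole (ℕₚ.n<1+n N) (λ i → ρ^ (toℕ i) y)
    ... | i , j , i<j , e = toℕ j ∸ suc (toℕ i) , ρ^-injective (toℕ i) (begin
        ρ^ (toℕ i) (ρ^ (suc d) y) ≡⟨ iterate-+ ρ (toℕ i) (suc d) y ⟨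
        ρ^ (toℕ i + suc d) y ≡⟨ cong (λ n → ρ^ n y) (trans (ℕₚ.+-suc (toℕ i) d) (ℕₚ.m+[n∸m]≡n i<j)) ⟩
        ρ^ (toℕ j) y ≡⟨ e ⟨
        ρ^ (toℕ i) y ∎)
      where
      open ≡-Reasoning
      d = toℕ j ∸ suc (toℕ i)

    order : ∀ y → ∃ λ m → ρ^ (suc m) y ≡ y × (∀ k → k < m → ρ^ (suc k) y ≢ y)
    order y = least (λ n → ρ^ (suc n) y ≡ y) (λ n → ρ^ (suc n) y Finₚ.≟ y) (proj₁ (returns y)) (proj₂ (returns y))

    module Orbit (y : Fin N) (m : ℕ) (period : ρ^ (suc m) y ≡ y) (minimal : ∀ k → k < m → ρ^ (suc k) y ≢ y) where

      point : Fin 2 → Fin (suc m) → Fin N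
      point zero    i = ρ^ (toℕ i) y
      point (suc _) i = a (ρ^ (toℕ i) y)

      rotation-distinct : ∀ i j → i < j → j < suc m → ρ^ i y ≢ ρ^ j y
      rotation-distinct i j i<j j<m e = minimal (j ∸ suc i) (ℕₚ.≤-trans (ℕₚ.≤-trans (ℕₚ.≤-reflexive (sym (ℕₚ.+-∸-assoc 1 i<j))) (ℕₚ.m∸n≤m j i)) (ℕₚ.≤-pred j<m))
        (ρ^-injective i (trans (sym (iterate-+ ρ i (suc (j ∸ suc i)) y))
          (trans (cong (λ n → ρ^ n y) (trans (ℕₚ.+-suc i (j ∸ suc i)) (ℕₚ.m+[n∸m]≡n i<j))) (sym e))))

      rotation-injective : ∀ i j → i < suc m → j < suc m → ρ^ i y ≡ ρ^ j y → i ≡ j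
      rotation-injective i j i<m j<m e with ℕₚ.<-cmp i j
      ... | tri< lt _ _ = ⊥-elim (rotation-distinct i j lt j<m e)
      ... | tri≈ _ eq _ = eq
      ... | tri> _ _ gt = ⊥-elim (rotation-distinct j i gt i<m (sym e))

      not-reflection : ∀ i j → i < suc m → ρ^ j y ≢ b (ρ^ i y)
      -- Going on round the cycle expresses `ρ^ j y` as a nonnegative power of `ρ` applied to
      -- `ρ^ i y`.
      not-reflection i j i<m e = not-reflected (j + (suc m ∸ i)) (ρ^ i y) (begin
        ρ^ (j + (suc m ∸ i)) (ρ^ i y) ≡⟨ iterate-+ ρ (j + (suc m ∸ i)) i y ⟨
        ρ^ (j + (suc m ∸ i) + i) y ≡⟨ cong (λ n → ρ^ n y) (trans (ℕₚ.+-assoc j (suc m ∸ i) i) (cong (ℕ._+_ j) (ℕₚ.m∸n+n≡m (ℕₚ.<⇒≤ i<m)))) ⟩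
        ρ^ (j + suc m) y ≡⟨ iterate-+ ρ j (suc m) y ⟩
        ρ^ j (ρ^ (suc m) y) ≡⟨ cong (ρ^ j) period ⟩
        ρ^ j y ≡⟨ e ⟩
        b (ρ^ i y) ∎)
        where open ≡-Reasoning

      rotation≢reflection : ∀ i j → i < suc m → ρ^ i y ≢ a (ρ^ j y)
      rotation≢reflection i j i<m e = not-reflection i (suc j) i<m (cong b (sym e))

      point-injective : ∀ f g i j → point f i ≡ point g j → f ≡ g × i ≡ j
      point-injective zero zero i j e = refl , Finₚ.toℕ-injective (rotation-injective (toℕ i) (toℕ j) (Finₚ.toℕ<n i) (Finₚ.toℕ<n j) e)
      point-injective zero (suc zero) i j e = ⊥-elim (rotation≢reflection (toℕ i) (toℕ j) (Finₚ.toℕ<n i) e)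
      point-injective (suc zero) zero i j e = ⊥-elim (rotation≢reflection (toℕ j) (toℕ i) (Finₚ.toℕ<n j) (sym e))
      point-injective (suc zero) (suc zero) i j e = refl , Finₚ.toℕ-injective (rotation-injective (toℕ i) (toℕ j) (Finₚ.toℕ<n i) (Finₚ.toℕ<n j)
        (trans (sym (inv-a _)) (trans (cong a e) (inv-a _))))

      next : ∀ i → i < suc m → ∃ λ j → j < suc m × ρ^ (suc i) y ≡ ρ^ j y
      next i i<m with ℕₚ.m≤n⇒m<n∨m≡n i<m
      ... | inj₁ si<m = suc i , si<m , refl
      ... | inj₂ refl = 0 , s≤s z≤n , period

      On : Fin N → Set
      On z = ∃ λ i → i < suc m × (z ≡ ρ^ i y ⊎ z ≡ a (ρ^ i y))

      on-a : ∀ z → On z → On (a z)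
      on-a z (i , i<m , inj₁ refl) = i , i<m , inj₂ refl
      on-a z (i , i<m , inj₂ refl) = i , i<m , inj₁ (inv-a _)

      on-b : ∀ z → On z → On (b z)
      on-b z (zero  , i<m , inj₁ refl) = m , ℕₚ.≤-refl , inj₂ (trans (cong b (sym period)) (inv-b _))
      on-b z (suc i , i<m , inj₁ refl) = i , ℕₚ.<-trans (ℕₚ.n<1+n i) i<m , inj₂ (inv-b _)
      on-b z (i , i<m , inj₂ refl) = let (j , j<m , e) = next i i<m in j , j<m , inj₁ e

      on-orbit : ∀ {z} → Orb (a ∷ b ∷ []) y z → On z
      on-orbit here                          = 0 , s≤s z≤n , inj₁ refl
      on-orbit (step g (here refl) o)         = on-a _ (on-orbit o)
      on-orbit (step g (there (here refl)) o) = on-b _ (on-orbit o)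

      spread : Fin (2 * suc m) → Fin N
      spread t = point (proj₁ (remQuot {2} (suc m) t)) (proj₂ (remQuot {2} (suc m) t))

      spread-injective : ∀ s t → spread s ≡ spread t → s ≡ t
      spread-injective s t e =
        let (p , q) = point-injective (proj₁ (remQuot {2} (suc m) s)) (proj₁ (remQuot {2} (suc m) t))
                                      (proj₂ (remQuot {2} (suc m) s)) (proj₂ (remQuot {2} (suc m) t)) e
        in trans (sym (Finₚ.combine-remQuot {2} (suc m) s)) (trans (cong₂ combine p q) (Finₚ.combine-remQuot {2} (suc m) t))

  ∣∣-count : ∀ {n} (p : Subset n) → ∣ p ∣ ≡ count (lookup p)
  ∣∣-count []            = refl
  ∣∣-count (true ∷ p)  = cong suc (∣∣-count p)
  ∣∣-count (false ∷ p) = ∣∣-count p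

  ∣tabulate∣ : ∀ {n} (f : Fin n → Bool) → ∣ tabulate f ∣ ≡ count f
  ∣tabulate∣ {zero}  f = refl
  ∣tabulate∣ {suc n} f with f zero
  ... | true  = cong suc (∣tabulate∣ (f ∘ suc))
  ... | false = ∣tabulate∣ (f ∘ suc)

  image-count : ∀ {q n} (p : Fin q → Fin n) (P : Fin n → Bool) → (∀ s t → p s ≡ p t → s ≡ t) →
    (∀ v → P v ≡ true → ∃ λ t → p t ≡ v) → (∀ t → P (p t) ≡ true) → count P ≡ q
  image-count {q} p P p-injective onto into = begin
    sum (λ v → ind (P v)) ≡⟨ sum-cong-≗ fibre ⟩
    sum (λ v → sum (λ t → ind (equalᵇ (p t) v))) ≡⟨ ∑-comm (λ v t → ind (equalᵇ (p t) v)) ⟩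
    sum (λ t → sum (λ v → ind (equalᵇ (p t) v))) ≡⟨ sum-cong-≗ (λ t → trans (sum-cong-≗ λ v → sym (ℕₚ.*-identityʳ (ind (equalᵇ (p t) v)))) (sum-delta (p t) (λ _ → 1))) ⟩
    sum {q} (λ t → 1) ≡⟨ trans (sum-const q 1) (ℕₚ.*-identityʳ q) ⟩
    q ∎
    where
    open ≡-Reasoning
    fibre : ∀ v → ind (P v) ≡ sum (λ t → ind (equalᵇ (p t) v))
    fibre v = cases (P v) refl
      where
      cases : ∀ b → P v ≡ b → ind b ≡ sum (λ t → ind (equalᵇ (p t) v))
      cases true h = let (t , e) = onto v h in ℕₚ.≤-antisym
        (ℕₚ.≤-trans (ℕₚ.≤-reflexive (cong ind (sym (isYes⇐ (p t Finₚ.≟ v) e)))) (term≤sum (λ t → ind (equalᵇ (p t) v)) t))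
        (count-unique (λ t → equalᵇ (p t) v) λ s t e e′ s<t → ℕₚ.<⇒≢ s<t (cong toℕ (p-injective s t (trans (isYes⇒ (p s Finₚ.≟ v) e) (sym (isYes⇒ (p t Finₚ.≟ v) e′))))))
      cases false h = sym (sum≡0 λ t → equalᵇ-≢ λ e → true≢false (trans (sym (into t)) (trans (cong P e) h)))
        where
        true≢false : true ≢ false
        true≢false ()

  injection-count : ∀ {q n} (p : Fin q → Fin n) (P : Fin n → Bool) → (∀ s t → p s ≡ p t → s ≡ t) →
    (∀ t → P (p t) ≡ true) → q ≤ count P
  injection-count {q} p P p-injective into = ℕₚ.≤-trans (ℕₚ.≤-reflexive (sym exact)) (sum-mono λ v → ind-mono (included v))
    where
    image? : ∀ v → Dec (∃ λ t → p t ≡ v)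
    image? v = Finₚ.any? λ t → p t Finₚ.≟ v
    exact : count (λ v → isYes (image? v)) ≡ q
    exact = image-count p (λ v → isYes (image? v)) p-injective (λ v h → isYes⇒ (image? v) h) (λ t → isYes⇐ (image? (p t)) (t , refl))
    included : ∀ v → isYes (image? v) ≡ true → P v ≡ true
    included v h with isYes⇒ (image? v) h
    ... | t , refl = into t

  count-fibres : ∀ {m n} (f : Fin m → Fin n) (g : Fin n → ℕ) → sum (λ x → g (f x)) ≡ sum (λ v → g v * count (λ x → equalᵇ (f x) v))
  count-fibres f g = begin
    sum (λ x → g (f x)) ≡⟨ sum-cong-≗ (λ x → sum-delta (f x) g) ⟨
    sum (λ x → sum (λ v → ind (equalᵇ (f x) v) * g v)) ≡⟨ ∑-comm (λ x v → ind (equalᵇ (f x) v) * g v) ⟩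
    sum (λ v → sum (λ x → ind (equalᵇ (f x) v) * g v)) ≡⟨ sum-cong-≗ (λ v → trans (sum-cong-≗ λ x → ℕₚ.*-comm (ind (equalᵇ (f x) v)) (g v)) (sum-*ˡ (g v) (λ x → ind (equalᵇ (f x) v)))) ⟩
    sum (λ v → g v * count (λ x → equalᵇ (f x) v)) ∎
    where open ≡-Reasoning

  letter-even : ∀ k → letter (k + k) ≡ g₁
  letter-even zero    = refl
  letter-even (suc k) = trans (cong (letter ∘ suc) (ℕₚ.+-suc k k)) (letter-even k)

  module FromTriangulation {Σs : Surface} {n : ℕ} (T : Triangulation Σs n) where
    open Triangulation T

    flags : Flags
    flags = record { nf = nf ; α₀ = α₀ ; α₁ = α₁ ; α₂ = α₂ }
    open Flags flags using (act; run)

    loopless : ∀ x → vtx x ≢ vtx (α₀ x)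
    loopless = proj₁ simple

    vtx₁ : ∀ x → vtx (α₁ x) ≡ vtx x
    vtx₁ x = sym (Equivalence.from (vtx-orb x (α₁ x)) (step α₁ (here refl) here))

    vtx₂ : ∀ x → vtx (α₂ x) ≡ vtx x
    vtx₂ x = sym (Equivalence.from (vtx-orb x (α₂ x)) (step α₂ (there (here refl)) here))

    vtx₀₂ : ∀ x → vtx (α₀ (α₂ x)) ≡ vtx (α₀ x)
    vtx₀₂ x = trans (cong vtx (comm₀₂ x)) (vtx₂ (α₀ x))

    open Dihedral α₁ α₂ inv₁ inv₂ fpf₁ fpf₂

    run-even : ∀ k x → run (alt (k + k)) x ≡ ρ^ k x
    run-even zero    x = refl
    run-even (suc k) x = trans (cong (λ m → run (alt (suc m)) x) (ℕₚ.+-suc k k))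
      (trans (cong₂ (λ g h → act g (act h (run (alt (k + k)) x))) (letter-odd k) (letter-even k)) (cong ρ (run-even k x)))

    run-odd : ∀ k x → run (alt (suc (k + k))) x ≡ α₁ (ρ^ k x)
    run-odd k x = trans (cong (λ g → act g (run (alt (k + k)) x)) (letter-even k)) (cong α₁ (run-even k x))

    vtx-ρ^ : ∀ k x → vtx (ρ^ k x) ≡ vtx x
    vtx-ρ^ zero    x = refl
    vtx-ρ^ (suc k) x = trans (vtx₂ _) (trans (vtx₁ _) (vtx-ρ^ k x))

    edge-orbit : ∀ {u z} → Orb (α₀ ∷ α₂ ∷ []) u z → z ∈ (u ∷ α₂ u ∷ α₀ u ∷ α₀ (α₂ u) ∷ [])
    edge-orbit here = here refl
    edge-orbit (step g (here refl) o) with edge-orbit o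
    ... | here refl = there (there (here refl))
    ... | there (here refl) = there (there (there (here refl)))
    ... | there (there (here refl)) = here (inv₀ _)
    ... | there (there (there (here refl))) = there (here (inv₀ _))
    edge-orbit (step g (there (here refl)) o) with edge-orbit o
    ... | here refl = there (here refl)
    ... | there (here refl) = here (inv₂ _)
    ... | there (there (here refl)) = there (there (there (here (sym (comm₀₂ _)))))
    ... | there (there (there (here refl))) = there (there (here (trans (sym (comm₀₂ _)) (cong α₀ (inv₂ _)))))

    -- Simplicity makes the order of the rotation at a flag equal to the degree of its vertex.
    module AtVertex (y : Fin nf) where
      m = proj₁ (order y)
      open Orbit y m (proj₁ (proj₂ (order y))) (proj₂ (proj₂ (order y))) public

      neighbour : Fin (suc m) → Fin n
      neighbour i = vtx (α₀ (ρ^ (toℕ i) y))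

      -- Of the four flags on the edge, the `α₂`-image is not in the rotation orbit by
      -- `not-reflection`, and the two at the other end would make the edge a loop.
      same-edge : ∀ i j → i < suc m → j < suc m →
        ρ^ j y ∈ (ρ^ i y ∷ α₂ (ρ^ i y) ∷ α₀ (ρ^ i y) ∷ α₀ (α₂ (ρ^ i y)) ∷ []) → i ≡ j
      same-edge i j i<m j<m (here h) = sym (rotation-injective j i j<m i<m h)
      same-edge i j i<m j<m (there (here h)) = ⊥-elim (not-reflection i j i<m h)
      same-edge i j i<m j<m (there (there (here h))) = ⊥-elim (loopless (ρ^ i y)
        (trans (vtx-ρ^ i y) (trans (sym (vtx-ρ^ j y)) (cong vtx h))))
      same-edge i j i<m j<m (there (there (there (here h)))) = ⊥-elim (loopless (ρ^ i y)
        (trans (vtx-ρ^ i y) (trans (sym (vtx-ρ^ j y)) (trans (cong vtx h) (vtx₀₂ (ρ^ i y))))))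

      neighbour-injective : ∀ i j → neighbour i ≡ neighbour j → i ≡ j
      neighbour-injective i j e = Finₚ.toℕ-injective (same-edge (toℕ i) (toℕ j) (Finₚ.toℕ<n i) (Finₚ.toℕ<n j)
        (edge-orbit (Equivalence.to (edg-orb (ρ^ (toℕ i) y) (ρ^ (toℕ j) y))
          (proj₂ simple (ρ^ (toℕ i) y) (ρ^ (toℕ j) y) (trans (vtx-ρ^ (toℕ i) y) (sym (vtx-ρ^ (toℕ j) y))) e))))

      at-vertex : ∀ z → vtx z ≡ vtx y → On z
      at-vertex z e = on-orbit (Equivalence.to (vtx-orb y z) (sym e))

      on-neighbour : ∀ z → On z → ∃ λ i → neighbour i ≡ vtx (α₀ z)
      on-neighbour z (i , i<m , inj₁ refl) = fromℕ< i<m , cong (λ k → vtx (α₀ (ρ^ k y))) (Finₚ.toℕ-fromℕ< i<m)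
      on-neighbour z (i , i<m , inj₂ refl) =
        let (j , j<m , e) = next i i<m
        in fromℕ< j<m , trans (cong (λ k → vtx (α₀ (ρ^ k y))) (Finₚ.toℕ-fromℕ< j<m))
             (trans (cong (vtx ∘ α₀) (sym e)) (vtx₀₂ (α₁ (ρ^ i y))))

      neighbours-onto : ∀ w → isYes (adj? (vtx y) w) ≡ true → ∃ λ i → neighbour i ≡ w
      neighbours-onto w h =
        let (z , ez , e) = isYes⇒ (adj? (vtx y) w) h
            (i , e′) = on-neighbour z (at-vertex z ez)
        in i , trans e′ e

      degree≡ : degree (vtx y) ≡ suc m
      degree≡ = trans (∣tabulate∣ (λ w → isYes (adj? (vtx y) w)))
        (image-count neighbour (λ w → isYes (adj? (vtx y) w)) neighbour-injective neighbours-onto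
          λ i → isYes⇐ (adj? (vtx y) (neighbour i)) (ρ^ (toℕ i) y , vtx-ρ^ (toℕ i) y , refl))

    good : Fin n → Bool
    good v = isYes (degree v ℕₚ.≟ 6)

    module AtGood (y : Fin nf) (h : good (vtx y) ≡ true) where
      open AtVertex y using (m; degree≡)

      m≡5 : m ≡ 5
      m≡5 = ℕₚ.suc-injective (trans (sym degree≡) (isYes⇒ (degree (vtx y) ℕₚ.≟ 6) h))

      period₆ : ρ^ 6 y ≡ y
      period₆ = subst (λ m → ρ^ (suc m) y ≡ y) m≡5 (proj₁ (proj₂ (order y)))

      minimal₆ : ∀ k → k < 5 → ρ^ (suc k) y ≢ y
      minimal₆ = subst (λ m → ∀ k → k < m → ρ^ (suc k) y ≢ y) m≡5 (proj₂ (proj₂ (order y)))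

      open Orbit y 5 period₆ minimal₆ public

    good-cycle : ∀ x → good (vtx x) ≡ true → run (alt 12) x ≡ x
    good-cycle x h = trans (run-even 6 x) (AtGood.period₆ x h)

    good-free : ∀ x → good (vtx x) ≡ true → ∀ k → 0 < k → k < 12 → run (alt k) x ≢ x
    good-free x h k 0<k k<12 e with halve k
    ... | zero  , inj₁ refl = ⊥-elim (ℕₚ.<-irrefl refl 0<k)
    ... | suc i , inj₁ refl = AtGood.minimal₆ x h i (ℕₚ.≤-pred (double-< (suc i) 6 k<12)) (trans (sym (run-even (suc i) x)) e)
    ... | i , inj₂ refl = AtGood.rotation≢reflection x h 0 i (s≤s z≤n) (trans (sym e) (run-odd i x))

    good-orbit : ∀ x → good (vtx x) ≡ true → ∀ z → vtx z ≡ vtx x → ∃ λ k → k < 12 × z ≡ run (alt k) x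
    good-orbit x h z e = name (AtGood.on-orbit x h (Equivalence.to (vtx-orb x z) (sym e)))
      where
      name : AtGood.On x h z → ∃ λ k → k < 12 × z ≡ run (alt k) x
      name (i , i<6 , inj₁ eq) = i + i , ℕₚ.+-mono-< i<6 i<6 , trans eq (sym (run-even i x))
      name (i , i<6 , inj₂ eq) = suc (i + i) ,
        ℕₚ.≤-trans (ℕₚ.≤-reflexive (cong suc (sym (ℕₚ.+-suc i i)))) (ℕₚ.+-mono-≤ i<6 i<6) , trans eq (sym (run-odd i x))

    good-nbrs : ∀ x → good (vtx x) ≡ true → ∀ k l → k < 6 → l < 6 →
                vtx (α₀ (run (alt (k + k)) x)) ≡ vtx (α₀ (run (alt (l + l)) x)) → k ≡ l
    good-nbrs x h k l k<6 l<6 e = trans (sym (Finₚ.toℕ-fromℕ< (bound k<6))) (trans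
      (cong toℕ (AtVertex.neighbour-injective x (fromℕ< (bound k<6)) (fromℕ< (bound l<6)) eq)) (Finₚ.toℕ-fromℕ< (bound l<6)))
      where
      bound : ∀ {i} → i < 6 → i < suc (AtVertex.m x)
      bound {i} = subst (λ m → i < suc m) (sym (AtGood.m≡5 x h))
      name : ∀ {i} (p : i < suc (AtVertex.m x)) → AtVertex.neighbour x (fromℕ< p) ≡ vtx (α₀ (run (alt (i + i)) x))
      name {i} p = trans (cong (λ k → vtx (α₀ (ρ^ k x))) (Finₚ.toℕ-fromℕ< p)) (cong (vtx ∘ α₀) (sym (run-even i x)))
      eq : AtVertex.neighbour x (fromℕ< (bound k<6)) ≡ AtVertex.neighbour x (fromℕ< (bound l<6))
      eq = trans (name (bound k<6)) (trans e (sym (name (bound l<6))))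

    system : System
    system = record
      { flags      = flags
      ; nv         = n
      ; inv        = λ { g₀ → inv₀ ; g₁ → inv₁ ; g₂ → inv₂ }
      ; comm₀₂     = comm₀₂
      ; triangle   = λ x → proj₁ (triangular x)
      ; connected  = connected
      ; vtx        = vtx
      ; vtx₁       = vtx₁
      ; vtx₂       = vtx₂
      ; good       = good
      ; good-cycle = good-cycle
      ; good-free  = good-free
      ; good-orbit = good-orbit
      ; good-nbrs  = good-nbrs
      }

    flags-over : Fin n → ℕ
    flags-over v = count λ x → equalᵇ (vtx x) v

    flags-over-good : ∀ v → good v ≡ true → 12 ≤ flags-over v
    flags-over-good v h with vtx-onto v
    ... | y , refl = injection-count (AtGood.spread y h) (λ x → equalᵇ (vtx x) (vtx y)) (AtGood.spread-injective y h)
      λ t → isYes⇐ (_ Finₚ.≟ _) (over (proj₁ (remQuot {2} 6 t)) (proj₂ (remQuot {2} 6 t)))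
      where
      over : ∀ f i → vtx (AtGood.point y h f i) ≡ vtx y
      over zero    i = vtx-ρ^ (toℕ i) y
      over (suc _) i = trans (vtx₁ _) (vtx-ρ^ (toℕ i) y)

    flags-over-set : ∀ (P : Fin n → Bool) → 12 * count (λ v → P v ∧ good v) ≤ count (P ∘ vtx)
    flags-over-set P = begin
      12 * count (λ v → P v ∧ good v) ≡⟨ sum-*ˡ 12 (λ v → ind (P v ∧ good v)) ⟨
      sum (λ v → 12 * ind (P v ∧ good v)) ≤⟨ sum-mono pointwise ⟩
      sum (λ v → ind (P v) * flags-over v) ≡⟨ count-fibres vtx (ind ∘ P) ⟨
      count (P ∘ vtx) ∎
      where
      open ℕₚ.≤-Reasoning
      pointwise : ∀ v → 12 * ind (P v ∧ good v) ≤ ind (P v) * flags-over v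
      pointwise v = cases (P v) (good v) refl
        where
        cases : ∀ p g → good v ≡ g → 12 * ind (p ∧ g) ≤ ind p * flags-over v
        cases false g     _ = z≤n
        cases true  false _ = z≤n
        cases true  true  h = ℕₚ.≤-trans (flags-over-good v h) (ℕₚ.≤-reflexive (sym (ℕₚ.+-identityʳ _)))

    edge-count : nf ≤ 4 * ne
    edge-count = begin
      nf ≡⟨ trans (sum-const nf 1) (ℕₚ.*-identityʳ nf) ⟨
      sum {nf} (λ x → 1) ≡⟨ count-fibres edg (λ _ → 1) ⟩
      sum (λ e → 1 * count (λ x → equalᵇ (edg x) e)) ≤⟨ sum-mono (λ e → ℕₚ.≤-trans (ℕₚ.≤-reflexive (ℕₚ.+-identityʳ _)) (fibre e)) ⟩
      sum {ne} (λ e → 4) ≡⟨ trans (sum-const ne 4) (ℕₚ.*-comm ne 4) ⟩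
      4 * ne ∎
      where
      open ℕₚ.≤-Reasoning
      fibre : ∀ e → count (λ x → equalᵇ (edg x) e) ≤ 4
      fibre e with edg-onto e
      ... | u , refl = ℕₚ.≤-trans (sum-mono λ x → ind-mono λ h → memberᵇ-∈
                         (edge-orbit (Equivalence.to (edg-orb u x) (sym (isYes⇒ (edg x Finₚ.≟ edg u) h)))))
                         (count-member (u ∷ α₂ u ∷ α₀ u ∷ α₀ (α₂ u) ∷ []))

    module Face = Dihedral α₁ α₀ inv₁ inv₀ fpf₁ fpf₀

    face-count : 6 * nfc ≤ nf
    face-count = begin
      6 * nfc ≡⟨ trans (ℕₚ.*-comm 6 nfc) (sym (sum-const nfc 6)) ⟩
      sum {nfc} (λ f → 6) ≤⟨ sum-mono (λ f → ℕₚ.≤-trans (fibre f) (ℕₚ.≤-reflexive (sym (ℕₚ.+-identityʳ _)))) ⟩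
      sum (λ f → 1 * count (λ x → equalᵇ (fac x) f)) ≡⟨ count-fibres fac (λ _ → 1) ⟨
      sum {nf} (λ x → 1) ≡⟨ trans (sum-const nf 1) (ℕₚ.*-identityʳ nf) ⟩
      nf ∎
      where
      open ℕₚ.≤-Reasoning
      fac₀ : ∀ x → fac (α₀ x) ≡ fac x
      fac₀ x = sym (Equivalence.from (fac-orb x (α₀ x)) (step α₀ (here refl) here))
      fac₁ : ∀ x → fac (α₁ x) ≡ fac x
      fac₁ x = sym (Equivalence.from (fac-orb x (α₁ x)) (step α₁ (there (here refl)) here))
      fac-ρ^ : ∀ k x → fac (Face.ρ^ k x) ≡ fac x
      fac-ρ^ zero    x = refl
      fac-ρ^ (suc k) x = trans (fac₀ _) (trans (fac₁ _) (fac-ρ^ k x))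
      minimal₃ : ∀ u k → k < 2 → Face.ρ^ (suc k) u ≢ u
      minimal₃ u 0 _ e = proj₂ (triangular u) e
      minimal₃ u 1 _ e = proj₂ (triangular u) (trans (cong Face.ρ (sym e)) (proj₁ (triangular u)))
      minimal₃ u (suc (suc k)) (s≤s (s≤s ()))
      fibre : ∀ f → 6 ≤ count (λ x → equalᵇ (fac x) f)
      fibre f with fac-onto f
      ... | u , refl = injection-count spread (λ x → equalᵇ (fac x) (fac u)) spread-injective
        λ t → isYes⇐ (_ Finₚ.≟ _) (over (proj₁ (remQuot {2} 3 t)) (proj₂ (remQuot {2} 3 t)))
        where
        open Face.Orbit u 2 (proj₁ (triangular u)) (minimal₃ u)
        over : ∀ f i → fac (point f i) ≡ fac u
        over zero    i = fac-ρ^ (toℕ i) u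
        over (suc _) i = trans (fac₁ _) (fac-ρ^ (toℕ i) u)

    X : ℕ
    X = ℤ.∣ euler Σs ∣

    edges≤ : ne ≤ (n + nfc) + X
    edges≤ = ℤₚ.drop‿+≤+ (begin
      + ne ≡⟨ ring (+ n) (+ ne) (+ nfc) ⟩
      (+ n ℤ.+ + nfc) ℤ.+ ℤ.- ((+ n ℤ.- + ne) ℤ.+ + nfc) ≡⟨ cong (λ z → (+ n ℤ.+ + nfc) ℤ.+ ℤ.- z) euler-eq ⟩
      (+ n ℤ.+ + nfc) ℤ.+ ℤ.- euler Σs ≤⟨ ℤₚ.+-monoʳ-≤ (+ n ℤ.+ + nfc) (neg≤ (euler Σs)) ⟩
      (+ n ℤ.+ + nfc) ℤ.+ + X ∎)
      where
      open ℤₚ.≤-Reasoning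
      ring : ∀ n e f → e ≡ (n ℤ.+ f) ℤ.+ ℤ.- ((n ℤ.- e) ℤ.+ f)
      ring = solve-∀
      neg≤ : ∀ z → ℤ.- z ℤ.≤ + ℤ.∣ z ∣
      neg≤ (+ zero)    = ℤₚ.≤-refl
      neg≤ (+ suc k)   = ℤ.-≤+
      neg≤ -[1+ k ]    = ℤₚ.≤-refl

    -- Three times the flags are at most `12 ne`. Euler's formula replaces `ne` by `n + nfc + X`,
    -- and `12 nfc ≤ 2 nf` is cancelled.
    flag-count : nf ≤ 12 * (n + X)
    flag-count = ℕₚ.+-cancelˡ-≤ (2 * nf) _ _ (begin
      2 * nf + nf ≡⟨ ring₁ nf ⟩
      3 * nf ≤⟨ ℕₚ.*-monoʳ-≤ 3 edge-count ⟩
      3 * (4 * ne) ≤⟨ ℕₚ.*-monoʳ-≤ 3 (ℕₚ.*-monoʳ-≤ 4 edges≤) ⟩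
      3 * (4 * ((n + nfc) + X)) ≡⟨ ring₂ n nfc X ⟩
      2 * (6 * nfc) + 12 * (n + X) ≤⟨ ℕₚ.+-monoˡ-≤ (12 * (n + X)) (ℕₚ.*-monoʳ-≤ 2 face-count) ⟩
      2 * nf + 12 * (n + X) ∎)
      where
      open ℕₚ.≤-Reasoning
      ring₁ : ∀ f → 2 * f + f ≡ 3 * f
      ring₁ = solve-∀ℕ
      ring₂ : ∀ n f x → 3 * (4 * ((n + f) + x)) ≡ 2 * (6 * f) + 12 * (n + x)
      ring₂ = solve-∀ℕ

    module FewBad (t : ℕ) (bad : count (not ∘ good) ≤ t) where

      good-part : ∀ (P : Fin n → Bool) → count P ≤ count (λ v → P v ∧ good v) + t
      good-part P = begin
        count P ≤⟨ sum-mono (λ v → pointwise (P v) (good v)) ⟩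
        sum (λ v → ind (P v ∧ good v) + ind (not (good v))) ≡⟨ ∑-distrib-+ (λ v → ind (P v ∧ good v)) (λ v → ind (not (good v))) ⟩
        count (λ v → P v ∧ good v) + count (not ∘ good) ≤⟨ ℕₚ.+-monoʳ-≤ _ bad ⟩
        count (λ v → P v ∧ good v) + t ∎
        where
        open ℕₚ.≤-Reasoning
        pointwise : ∀ p g → ind p ≤ ind (p ∧ g) + ind (not g)
        pointwise false g     = z≤n
        pointwise true  false = s≤s z≤n
        pointwise true  true  = s≤s z≤n

      -- No single exceptional degree is bounded in advance. But at least `n − t` good vertices take
      -- 12 flags each out of at most `12 (n + X)`, which bounds the rest.
      bad-flags : count (λ x → not (good (vtx x))) ≤ 12 * (X + t)
      bad-flags = ℕₚ.+-cancelˡ-≤ (12 * n) _ _ (begin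
        12 * n + count (λ x → not (good (vtx x))) ≤⟨ ℕₚ.+-monoˡ-≤ _ (ℕₚ.*-monoʳ-≤ 12 all) ⟩
        12 * (count (λ v → true ∧ good v) + t) + count (λ x → not (good (vtx x)))
          ≤⟨ ℕₚ.+-monoˡ-≤ _ (ℕₚ.≤-trans (ℕₚ.≤-reflexive (ℕₚ.*-distribˡ-+ 12 (count (λ v → true ∧ good v)) t)) (ℕₚ.+-monoˡ-≤ (12 * t) (good≤))) ⟩
        (count (good ∘ vtx) + 12 * t) + count (λ x → not (good (vtx x))) ≡⟨ ring (count (good ∘ vtx)) (12 * t) (count (λ x → not (good (vtx x)))) ⟩
        (count (good ∘ vtx) + count (λ x → not (good (vtx x)))) + 12 * t ≡⟨ cong (λ z → z + 12 * t) complement ⟩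
        nf + 12 * t ≤⟨ ℕₚ.+-monoˡ-≤ (12 * t) flag-count ⟩
        12 * (n + X) + 12 * t ≡⟨ ring₂ n X t ⟩
        12 * n + 12 * (X + t) ∎)
        where
        open ℕₚ.≤-Reasoning
        ring : ∀ a b c → (a + b) + c ≡ (a + c) + b
        ring = solve-∀ℕ
        ring₂ : ∀ n x t → 12 * (n + x) + 12 * t ≡ 12 * n + 12 * (x + t)
        ring₂ = solve-∀ℕ
        all : n ≤ count (λ v → true ∧ good v) + t
        all = ℕₚ.≤-trans (ℕₚ.≤-reflexive (sym (trans (sum-const n 1) (ℕₚ.*-identityʳ n)))) (good-part (λ _ → true))
        good≤ : 12 * count (λ v → true ∧ good v) ≤ count (good ∘ vtx)
        good≤ = ℕₚ.≤-trans (ℕₚ.≤-reflexive (cong (12 *_) (sum-cong-≗ λ v → cong ind (idem (good v))))) (flags-over-set good)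
          where
          idem : ∀ b → true ∧ b ≡ b ∧ b
          idem true  = refl
          idem false = refl
        complement : count (good ∘ vtx) + count (λ x → not (good (vtx x))) ≡ nf
        complement = trans (sym (∑-distrib-+ (ind ∘ good ∘ vtx) (λ x → ind (not (good (vtx x))))))
          (trans (sum-cong-≗ λ x → one (good (vtx x))) (trans (sum-const nf 1) (ℕₚ.*-identityʳ nf)))
          where
          one : ∀ b → ind b + ind (not b) ≡ 1
          one true  = refl
          one false = refl

      vertex-bound : ∀ E C (D : Fin n → Bool) →
        (6 * E) * count (D ∘ vtx) ≤ (E + 12) * nf + C * count (λ x → not (good (vtx x))) →
        (6 * E) * count D ≤ (E + 12) * n + ((E + 12) * X + C * (X + t) + (6 * E) * t)
      vertex-bound E C D h = ℕₚ.*-cancelˡ-≤ 12 (begin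
        12 * ((6 * E) * count D) ≤⟨ ℕₚ.*-monoʳ-≤ 12 (ℕₚ.*-monoʳ-≤ (6 * E) (good-part D)) ⟩
        12 * ((6 * E) * (count (λ v → D v ∧ good v) + t)) ≡⟨ ring₁ (6 * E) (count (λ v → D v ∧ good v)) t ⟩
        (6 * E) * (12 * count (λ v → D v ∧ good v)) + 12 * ((6 * E) * t) ≤⟨ ℕₚ.+-monoˡ-≤ _ (ℕₚ.*-monoʳ-≤ (6 * E) (flags-over-set D)) ⟩
        (6 * E) * count (D ∘ vtx) + 12 * ((6 * E) * t) ≤⟨ ℕₚ.+-monoˡ-≤ _ h ⟩
        ((E + 12) * nf + C * count (λ x → not (good (vtx x)))) + 12 * ((6 * E) * t)
          ≤⟨ ℕₚ.+-monoˡ-≤ _ (ℕₚ.+-mono-≤ (ℕₚ.*-monoʳ-≤ (E + 12) flag-count) (ℕₚ.*-monoʳ-≤ C bad-flags)) ⟩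
        ((E + 12) * (12 * (n + X)) + C * (12 * (X + t))) + 12 * ((6 * E) * t) ≡⟨ ring₂ (E + 12) n X C t (6 * E) ⟩
        12 * ((E + 12) * n + ((E + 12) * X + C * (X + t) + (6 * E) * t)) ∎)
        where
        open ℕₚ.≤-Reasoning
        ring₁ : ∀ e a t → 12 * (e * (a + t)) ≡ e * (12 * a) + 12 * (e * t)
        ring₁ = solve-∀ℕ
        ring₂ : ∀ e n x c t f → (e * (12 * (n + x)) + c * (12 * (x + t))) + 12 * (f * t) ≡ 12 * (e * n + (e * x + c * (x + t) + f * t))
        ring₂ = solve-∀ℕ

    vertices≤flags : n ≤ nf
    vertices≤flags = Finₚ.injective⇒≤ {f = λ v → proj₁ (vtx-onto v)}
      λ {v} {w} e → trans (sym (proj₂ (vtx-onto v))) (trans (cong vtx e) (proj₂ (vtx-onto w)))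

-- Rational arithmetic and conclusion

open import Data.Rational using (ℚ; Positive; _/_; _+_; _*_) renaming (_≤_ to _≤ℚ_)
open import Data.Rational using (mkℚ; toℚᵘ)
import Data.Rational.Properties as ℚₚ
open import Data.Rational.Unnormalised.Base as ℚᵘ using (mkℚᵘ)
import Data.Rational.Unnormalised.Properties as ℚᵘₚ

minimum-subset : ∀ {n} (P : Subset n → Set) → (∀ D → Dec (P D)) → ∀ D₀ → P D₀ →
  ∃ λ D → P D × (∀ D′ → P D′ → ∣ D ∣ ≤ ∣ D′ ∣)
minimum-subset {n} P P? D₀ p₀ = search ∣ D₀ ∣ D₀ ℕₚ.≤-refl p₀
  where
  search : ∀ k D → ∣ D ∣ ≤ k → P D → ∃ λ D → P D × (∀ D′ → P D′ → ∣ D ∣ ≤ ∣ D′ ∣)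
  search k D D≤k p with Subsetₚ.anySubset? (λ D′ → P? D′ ×-dec (∣ D′ ∣ ℕₚ.<? ∣ D ∣))
  ... | no none = D , p , λ D′ p′ → ℕₚ.≮⇒≥ λ lt → none (D′ , p′ , lt)
  search zero    D D≤k p | yes (D′ , p′ , lt) = ⊥-elim (ℕₚ.n≮0 (ℕₚ.<-≤-trans lt D≤k))
  search (suc k) D D≤k p | yes (D′ , p′ , lt) = search k D′ (ℕₚ.≤-pred (ℕₚ.<-≤-trans lt D≤k)) p′

-- The hypothesis is the conclusion with ε replaced by 1/(suc q) and denominators cleared.
rational-bound : ∀ d n c m q .(cop : Coprime (suc m) (suc q)) →
  (6 ℕ.* suc q) ℕ.* d ≤ (suc q ℕ.+ 6) ℕ.* n ℕ.+ (6 ℕ.* suc q) ℕ.* c →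
  (+ d / 1) ≤ℚ ((+ n / 1) * ((+ 1 / 6) + mkℚ (+ suc m) q cop) + (+ c / 1))
rational-bound d n c m q cop h = ℚₚ.toℚᵘ-cancel-≤ (ℚᵘₚ.≤-respˡ-≃ (ℚᵘₚ.≃-sym (ℚₚ.toℚᵘ-fromℚᵘ (mkℚᵘ (+ d) 0)))
  (ℚᵘₚ.≤-respʳ-≃ (ℚᵘₚ.≃-sym unfold) (ℚᵘ.*≤* (ℤₚ.≤-trans (ℤₚ.≤-reflexive left) (ℤₚ.≤-trans (ℤ.+≤+ enough) (ℤₚ.≤-reflexive right))))))
  where
  ε : ℚ
  ε = mkℚ (+ suc m) q cop
  unfold : toℚᵘ ((+ n / 1) * ((+ 1 / 6) + ε) + (+ c / 1)) ℚᵘ.≃ (mkℚᵘ (+ n) 0 ℚᵘ.* (mkℚᵘ (+ 1) 5 ℚᵘ.+ mkℚᵘ (+ suc m) q)) ℚᵘ.+ mkℚᵘ (+ c) 0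
  unfold = ℚᵘₚ.≃-trans (ℚₚ.toℚᵘ-homo-+ ((+ n / 1) * ((+ 1 / 6) + ε)) (+ c / 1))
    (ℚᵘₚ.+-cong (ℚᵘₚ.≃-trans (ℚₚ.toℚᵘ-homo-* (+ n / 1) ((+ 1 / 6) + ε))
      (ℚᵘₚ.*-cong (ℚₚ.toℚᵘ-fromℚᵘ (mkℚᵘ (+ n) 0))
        (ℚᵘₚ.≃-trans (ℚₚ.toℚᵘ-homo-+ (+ 1 / 6) ε) (ℚᵘₚ.+-cong (ℚₚ.toℚᵘ-fromℚᵘ (mkℚᵘ (+ 1) 5)) (ℚᵘₚ.≃-refl {mkℚᵘ (+ suc m) q})))))
      (ℚₚ.toℚᵘ-fromℚᵘ (mkℚᵘ (+ c) 0)))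
  enough : (6 ℕ.* suc q) ℕ.* d ≤ (suc q ℕ.+ 6 ℕ.* suc m) ℕ.* n ℕ.+ (6 ℕ.* suc q) ℕ.* c
  enough = ℕₚ.≤-trans h (ℕₚ.+-monoˡ-≤ _ (ℕₚ.*-monoˡ-≤ n (ℕₚ.+-monoʳ-≤ (suc q) (ℕₚ.m≤m*n 6 (suc m)))))
  left : + d ℤ.* ℚᵘ.↧ ((mkℚᵘ (+ n) 0 ℚᵘ.* (mkℚᵘ (+ 1) 5 ℚᵘ.+ mkℚᵘ (+ suc m) q)) ℚᵘ.+ mkℚᵘ (+ c) 0) ≡ + ((6 ℕ.* suc q) ℕ.* d)
  left = trans (sym (ℤₚ.pos-* d _)) (cong +_ (ring d q))
    where
    ring : ∀ d q → d ℕ.* ((1 ℕ.* (6 ℕ.* suc q)) ℕ.* 1) ≡ (6 ℕ.* suc q) ℕ.* d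
    ring = solve-∀ℕ
  right : + ((suc q ℕ.+ 6 ℕ.* suc m) ℕ.* n ℕ.+ (6 ℕ.* suc q) ℕ.* c) ≡
          ℚᵘ.↥ ((mkℚᵘ (+ n) 0 ℚᵘ.* (mkℚᵘ (+ 1) 5 ℚᵘ.+ mkℚᵘ (+ suc m) q)) ℚᵘ.+ mkℚᵘ (+ c) 0) ℤ.* + 1
  right = trans (cong₂ ℤ._+_ (trans (ℤₚ.pos-* (suc q ℕ.+ 6 ℕ.* suc m) n) (cong (λ z → (+ suc q ℤ.+ z) ℤ.* + n) (ℤₚ.pos-* 6 (suc m))))
                             (ℤₚ.pos-* (6 ℕ.* suc q) c))
                (trans (ring (+ suc q) (+ suc m) (+ n) (+ c) (+ (6 ℕ.* suc q))) (cong (λ z → (((+ n ℤ.* (+ 1 ℤ.* + suc q ℤ.+ + suc m ℤ.* + 6)) ℤ.* + 1) ℤ.+ + c ℤ.* + z) ℤ.* + 1) (sym (ℕₚ.+-identityʳ (6 ℕ.* suc q)))))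
    where
    ring : ∀ q m n c d → (q ℤ.+ + 6 ℤ.* m) ℤ.* n ℤ.+ d ℤ.* c ≡ (((n ℤ.* (+ 1 ℤ.* q ℤ.+ m ℤ.* + 6)) ℤ.* + 1) ℤ.+ c ℤ.* d) ℤ.* + 1
    ring = solve-∀

module _ {Σs : Surface} {n : ℕ} (T : Triangulation Σs n) where
  open Triangulation T
  open FromTriangulation T

  dominating? : ∀ D → Dec (Dominating D)
  dominating? D = Finₚ.all? λ v → (v Subsetₚ.∈? D) ⊎-dec Finₚ.any? λ u → (u Subsetₚ.∈? D) ×-dec adj? u v

  ⊤-dominating : Dominating ⊤
  ⊤-dominating v = inj₁ Subsetₚ.∈⊤

  dominating⇒ : ∀ D → Dominating D → ∀ v → ∃ λ u → lookup D u ≡ true × Dominates system u v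
  dominating⇒ D dom v with dom v
  ... | inj₁ v∈D           = v , Vecₚ.[]=⇒lookup v∈D , inj₁ refl
  ... | inj₂ (u , u∈D , a) = u , Vecₚ.[]=⇒lookup u∈D , inj₂ a

  dominating⇐ : ∀ (D : Fin n → Bool) → (∀ v → ∃ λ u → D u ≡ true × Dominates system u v) → Dominating (tabulate D)
  dominating⇐ D dom v with dom v
  ... | u , Du , inj₁ refl = inj₁ (Vecₚ.lookup⇒[]= u (tabulate D) (trans (Vecₚ.lookup∘tabulate D u) Du))
  ... | u , Du , inj₂ a    = inj₂ (u , Vecₚ.lookup⇒[]= u (tabulate D) (trans (Vecₚ.lookup∘tabulate D u) Du) , a)

  minimum-dominating : ∃ λ D → Dominating D × IsMinimumDominating system (lookup D)
  minimum-dominating =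
    let (D , dom , min) = minimum-subset Dominating dominating? ⊤ ⊤-dominating
    in D , dom , dominating⇒ D dom , λ D′ dom′ →
       ℕₚ.≤-trans (ℕₚ.≤-reflexive (sym (∣∣-count D))) (ℕₚ.≤-trans (min (tabulate D′) (dominating⇐ D′ dom′)) (ℕₚ.≤-reflexive (∣tabulate∣ D′)))

  bad≤ : ∀ t (B : Subset n) → ∣ B ∣ ≤ t → (∀ v → v ∉ B → degree v ≡ 6) → count (not ∘ good) ≤ t
  bad≤ t B B≤t deg = ℕₚ.≤-trans (sum-mono λ v → ind-mono (inB v)) (ℕₚ.≤-trans (ℕₚ.≤-reflexive (sym (∣∣-count B))) B≤t)
    where
    inB : ∀ v → not (good v) ≡ true → lookup B v ≡ true
    inB v h with v Subsetₚ.∈? B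
    ... | yes v∈B = Vecₚ.[]=⇒lookup v∈B
    ... | no v∉B with trans (sym h) (cong not (isYes⇐ (degree v ℕₚ.≟ 6) (deg v v∉B)))
    ...   | ()

  -- The averaging loses `12/(6E) = 2/E` per vertex, so `E = 2 (q + 1)` gives `1/(q + 1)`. If there
  -- are at most `K` flags, all vertices are taken and the additive constant pays for them.
  small-or-bounded : ∀ t q K C → FlagBound (2 ℕ.* suc q) K C →
    (∃ λ (B : Subset n) → ∣ B ∣ ≤ t × (∀ v → v ∉ B → degree v ≡ 6)) →
    let E = 2 ℕ.* suc q
        c₀ = (E ℕ.+ 12) ℕ.* X ℕ.+ C ℕ.* (X ℕ.+ t) ℕ.+ (6 ℕ.* E) ℕ.* t
    in ∃ λ D → Dominating D × (6 ℕ.* suc q) ℕ.* ∣ D ∣ ≤ (suc q ℕ.+ 6) ℕ.* n ℕ.+ (6 ℕ.* suc q) ℕ.* (K ℕ.+ c₀)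
  small-or-bounded t q K C bound (B , B≤t , deg) with K ℕₚ.<? nf
  ... | no K≮nf = ⊤ , ⊤-dominating ,
    ℕₚ.≤-trans (ℕₚ.*-monoʳ-≤ (6 ℕ.* suc q) (ℕₚ.≤-trans (ℕₚ.≤-reflexive (Subsetₚ.∣⊤∣≡n n)) (ℕₚ.≤-trans vertices≤flags (ℕₚ.≤-trans (ℕₚ.≮⇒≥ K≮nf) (ℕₚ.m≤m+n K _)))))
               (ℕₚ.m≤n+m _ ((suc q ℕ.+ 6) ℕ.* n))
  ... | yes K<nf = let (D , dom , min) = minimum-dominating in D , dom , arithmetic ∣ D ∣
        (subst (λ d → (6 ℕ.* E) ℕ.* d ≤ (E ℕ.+ 12) ℕ.* n ℕ.+ c₀) (sym (∣∣-count D)) (vertex-bound E C (lookup D) (bound system K<nf (lookup D) min)))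
    where
    open FewBad t (bad≤ t B B≤t deg)
    E = 2 ℕ.* suc q
    c₀ = (E ℕ.+ 12) ℕ.* X ℕ.+ C ℕ.* (X ℕ.+ t) ℕ.+ (6 ℕ.* E) ℕ.* t
    arithmetic : ∀ d → (6 ℕ.* E) ℕ.* d ≤ (E ℕ.+ 12) ℕ.* n ℕ.+ c₀ → (6 ℕ.* suc q) ℕ.* d ≤ (suc q ℕ.+ 6) ℕ.* n ℕ.+ (6 ℕ.* suc q) ℕ.* (K ℕ.+ c₀)
    arithmetic d h = ℕₚ.≤-trans (ℕₚ.*-cancelˡ-≤ 2 (begin
        2 ℕ.* ((6 ℕ.* suc q) ℕ.* d) ≡⟨ ring₁ (suc q) d ⟩
        (6 ℕ.* E) ℕ.* d ≤⟨ h ⟩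
        (E ℕ.+ 12) ℕ.* n ℕ.+ c₀ ≤⟨ ℕₚ.+-monoʳ-≤ ((E ℕ.+ 12) ℕ.* n) (ℕₚ.m≤n*m c₀ 2) ⟩
        (E ℕ.+ 12) ℕ.* n ℕ.+ 2 ℕ.* c₀ ≡⟨ ring₂ (suc q) n c₀ ⟩
        2 ℕ.* ((suc q ℕ.+ 6) ℕ.* n ℕ.+ c₀) ∎))
      (ℕₚ.+-monoʳ-≤ ((suc q ℕ.+ 6) ℕ.* n) (ℕₚ.≤-trans (ℕₚ.m≤n+m c₀ K) (ℕₚ.m≤n*m (K ℕ.+ c₀) (6 ℕ.* suc q))))
      where
      open ℕₚ.≤-Reasoning
      ring₁ : ∀ q d → 2 ℕ.* ((6 ℕ.* q) ℕ.* d) ≡ (6 ℕ.* (2 ℕ.* q)) ℕ.* d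
      ring₁ = solve-∀ℕ
      ring₂ : ∀ q n c → (2 ℕ.* q ℕ.+ 12) ℕ.* n ℕ.+ 2 ℕ.* c ≡ 2 ℕ.* ((q ℕ.+ 6) ℕ.* n ℕ.+ c)
      ring₂ = solve-∀ℕ

theorem4 : (Σs : Surface) (t : ℕ) (ε : ℚ) → Positive ε →
    ∃ λ (c : ℚ) → ∀ (n : ℕ) (T : Triangulation Σs n) →
    (∃ λ (B : Subset n) → ∣ B ∣ ≤ t × (∀ v → v ∉ B → Triangulation.degree T v ≡ 6)) →
    ∃ λ (D : Subset n) → Triangulation.Dominating T D
    × (+ ∣ D ∣ / 1) ≤ℚ ((+ n / 1) * ((+ 1 / 6) + ε) + c)
-- The argument is the predecessor of `2 * suc q` in the form to which that product computes. A
-- positive `ε` with denominator `suc q` is at least `1/(suc q)`.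
theorem4 Σs t (mkℚ (+ suc m) q cop) _ = conclude (flag-bounds (q ℕ.+ 1 ℕ.* suc q))
  where
  E X : ℕ
  E = 2 ℕ.* suc q
  X = ℤ.∣ euler Σs ∣
  Conclusion : Set
  Conclusion = ∃ λ (c : ℚ) → ∀ (n : ℕ) (T : Triangulation Σs n) →
    (∃ λ (B : Subset n) → ∣ B ∣ ≤ t × (∀ v → v ∉ B → Triangulation.degree T v ≡ 6)) →
    ∃ λ (D : Subset n) → Triangulation.Dominating T D
    × (+ ∣ D ∣ / 1) ≤ℚ ((+ n / 1) * ((+ 1 / 6) + mkℚ (+ suc m) q cop) + c)
  conclude : (∃₂ λ K C → FlagBound E K C) → Conclusion
  conclude (K , C , bound) = (+ c / 1) , λ n T few →
    let (D , dom , h) = small-or-bounded T t q K C bound few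
    in D , dom , rational-bound ∣ D ∣ n c m q cop h
    where
    c = K ℕ.+ ((E ℕ.+ 12) ℕ.* X ℕ.+ C ℕ.* (X ℕ.+ t) ℕ.+ (6 ℕ.* E) ℕ.* t)
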